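{- Let $\varepsilon>0$ and let $F$ be an $r$-vertex graph. Then there is some $n_0$ such that the following holds for all $n\geq n_0$. Suppose $\mathfrak{G}=(G_1,\ldots,G_n)$ is a graph collection on $[rn]$ with $|\mathfrak{G}|=n$ and $\delta(\mathfrak{G})\geq (\delta_F+\varepsilon)rn$. Then there are vertex-disjoint copies $F_i$ of $F$ with $F_i\subset G_i$ for each $i\in[n]$.
   Context: A graph collection on a set $V$ is a finite sequence $\mathfrak{G}=(G_1,\ldots,G_m)$ of (not necessarily distinct) graphs, each with vertex set $V$; $|\mathfrak{G}|=m$ and $\delta(\mathfrak{G})=\min_{i}\delta(G_i)$. For a graph $F$, $\delta_F$ is the smallest real number $\delta$ such that for each $\varepsilon>0$ there is $n_0$ such that for every $n\geq n_0$ with $|F|$ dividing $n$, every $n$-vertex graph with minimum degree at least $(\delta+\varepsilon)n$ contains an $F$-factor (a spanning union of vertex-disjoint copies of $F$). -}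

module Defs where

open import Data.Bool using (Bool; true; false)
open import Data.Nat using (ℕ; _≥_; _*_)
open import Data.Nat.Divisibility using (_∣_)
open import Data.Fin using (Fin)
open import Data.List using (length; filterᵇ; allFin)
open import Data.Product using (Σ; ∃; _×_)
open import Data.Integer using (+_)
open import Data.Rational using (ℚ; _+_; _≤_; _<_; 0ℚ) renaming (_*_ to _*ℚ_; _/_ to _/ℚ_)
open import Relation.Binary.PropositionalEquality using (_≡_)

record Graph (N : ℕ) : Set where
  field
    adj   : Fin N → Fin N → Bool
    sym   : ∀ u v → adj u v ≡ adj v u
    irref : ∀ v → adj v v ≡ false
open Graph public

ℕ→ℚ : ℕ → ℚ
ℕ→ℚ n = (+ n) /ℚ 1

deg : ∀ {N} → Graph N → Fin N → ℕ
deg G v = length (filterᵇ (adj G v) (allFin _))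

MinDegAtLeast : ∀ {N} → Graph N → ℚ → Set
MinDegAtLeast G t = ∀ v → t ≤ ℕ→ℚ (deg G v)

-- φ : Fin r → Fin N maps edges of F to edges of G (a copy of F in G
-- once φ is also injective)
EdgePreserving : ∀ {r N} → Graph r → Graph N → (Fin r → Fin N) → Set
EdgePreserving F G φ = ∀ a b → adj F a b ≡ true → adj G (φ a) (φ b) ≡ true

FFactor : ∀ {r N} → Graph r → Graph N → Set
FFactor {r} {N} F G =
  Σ ℕ λ k → Σ (Fin k → Fin r → Fin N) λ φ →
    (∀ i → EdgePreserving F G (φ i))
    × (∀ i j a b → φ i a ≡ φ j b → (i ≡ j × a ≡ b))
    × (∀ v → Σ (Fin k) λ i → Σ (Fin r) λ a → φ i a ≡ v)

-- "d satisfies the defining property of δ_F": for every ε > 0 there is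
-- n0 such that for all n ≥ n0 with |F| ∣ n, every n-vertex graph with
-- minimum degree ≥ (d+ε)n has an F-factor.  δ_F is the least such d.
FactorThreshold : ∀ {r} → Graph r → ℚ → Set
FactorThreshold {r} F d =
  ∀ (ε : ℚ) → 0ℚ < ε → Σ ℕ λ n0 → ∀ n → n ≥ n0 → r ∣ n →
    ∀ (G : Graph n) → MinDegAtLeast G ((d + ε) *ℚ ℕ→ℚ n) → FFactor F G

-- Transversal F-factor: vertex-disjoint copies F_i ⊂ G_i, i ∈ [n]
-- (on vertex set [rn], so they cover everything).
TransversalFactor : ∀ {r n} → Graph r → (Fin n → Graph (r * n)) → Set
TransversalFactor {r} {n} F Gs =
  Σ (Fin n → Fin r → Fin (r * n)) λ φ →
    (∀ i → EdgePreserving F (Gs i) (φ i))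
    × (∀ i j a b → φ i a ≡ φ j b → (i ≡ j × a ≡ b))

{-# OPTIONS --safe #-}
module Submission where

-- Fix a large constant m divisible by r. By a fourth-moment bound, all but O(1/m) of the m-tuples of
-- vertices induce, in a given colour, a graph whose minimum degree exceeds the threshold of F, hence
-- which has an F-factor. The colours induce boundedly many labelled graphs on an m-tuple, so by
-- pigeonhole many colours agree there, and an F-factor in one of them may be coloured by m/r of them.
--
-- * Absorbers. For r vertices x and a colour c, a positive proportion of the pairs (A, K) of an m-tuple
--   of vertices and m/r colours agreeing on A ∪ x are such that K tiles A, and K ∪ {c} tiles A ∪ x:
--   give c a copy of F inside A, and the rest of A together with x is still dense in the colours of K.
--   A weight argument picks linearly many disjoint absorbers so that every (x, c) has linearly many.
-- * Cover. Arrange the remaining vertices in an m′ × M grid and rotate the columns; on average over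
--   the rotations, few (row, colour) pairs are bad. Rows are then tiled greedily by agreeing colours.
-- * The few uncovered vertices and colours are grouped into pairs (x, c) and absorbed one by one.

open import Defs hiding (sym)
open import Algebra.Structures using (IsCommutativeSemiring)
open import Data.Bool using (Bool; true; false; T; _∧_; not; if_then_else_)
import Data.Bool.Properties as BoolP
open import Data.Bool.ListAction using (any; all)
open import Data.Empty using (⊥; ⊥-elim)
open import Data.Fin as Fin using (Fin; toℕ; combine)
import Data.Fin.Properties as FinP
open import Data.Integer as ℤ using (ℤ; +_; -_)
import Data.Integer.Properties as ℤP
import Data.Integer.Tactic.RingSolver as ℤR
open import Data.List as List using (List; []; _∷_; _++_; concat; concatMap; length; tabulate; allFin; filterᵇ)
import Data.List.Properties as ListP
open import Data.List.Membership.Propositional using (_∈_)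
open import Data.List.Membership.Propositional.Properties
open import Data.List.Relation.Binary.Permutation.Propositional using (_↭_; ↭-refl; ↭-sym; ↭-trans; ↭-reflexive; ↭-prep; ↭⇒↭ₛ)
import Data.List.Relation.Binary.Permutation.Propositional.Properties as ↭P
import Data.List.Relation.Binary.Permutation.Setoid.Properties as ↭SetoidP
open import Data.List.Relation.Unary.All as All using (All; []; _∷_)
import Data.List.Relation.Unary.All.Properties as AllP
open import Data.List.Relation.Unary.AllPairs using ([]; _∷_)
import Data.List.Relation.Unary.AllPairs.Properties as AllPairsP
open import Data.List.Relation.Unary.Any as Any using (here; there)
open import Data.List.Relation.Unary.Unique.Propositional using (Unique)
import Data.List.Relation.Unary.Unique.Propositional.Properties as UniqueP
open import Data.Nat as ℕ using (ℕ; zero; suc; _+_; _*_; _^_; _∸_; _≤_; _<_; _≥_; z≤n; s≤s; NonZero)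
open import Data.Nat.Divisibility using (_∣_; divides)
open import Data.Nat.DivMod using (_%_; _/_; _mod_; %-distribˡ-+; [m+n]%n≡m%n; m<n⇒m%n≡m; m≡m%n+[m/n]*n; m%n<n; /-monoˡ-≤; m*n/n≡m; m/n*n≤m)
import Data.Nat.Properties as ℕP
import Data.Nat.Tactic.RingSolver as ℕR
open import Data.Product using (Σ; ∃; ∃₂; _×_; _,_; proj₁; proj₂)
open import Data.Rational as ℚ using (ℚ; 0ℚ; mkℚ; toℚᵘ; ↧ₙ_; Positive; NonNegative)
import Data.Rational.Properties as ℚP
import Data.Rational.Unnormalised as ℚᵘ
import Data.Rational.Unnormalised.Properties as ℚᵘP
open import Data.Sum using (inj₁; inj₂)
open import Data.Vec as Vec using (Vec; []; _∷_; lookup; _[_]≔_)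
import Data.Vec.Properties as VecP
import Data.Vec.Relation.Unary.All as VAll
import Data.Vec.Relation.Unary.All.Properties as VAllP
open import Function using (_∘_)
open import Relation.Binary.PropositionalEquality as ≡ using (_≡_; cong; cong₂; subst; module ≡-Reasoning)
open import Relation.Nullary using (Dec; yes; no; does)
open import Relation.Nullary.Decidable using (dec-true)

-- Why the fourth moment: Chebyshev bounds the failure of one vertex only by O(1/m), and a union
-- over the m vertices of a sample would use that up. The fourth moment gives O(1/m^2), so O(1/m)
-- survives the union.
--
-- Why two block sizes: the absorber size `m₁` determines, exponentially, how many leftover colours
-- n/D can be absorbed. The cover leaves a proportion of order 1/sqrt(`m₂`) of the colours, so `m₂`
-- has to be chosen after D, of order D^2.
--
-- Why degrees start at (p + 2)/q when F-factors appear at p/q: one unit of surplus pays for the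
-- vertices placed in absorbers or outside the grid, the other for the fluctuation of samples.
--
-- Probabilities are counts over the list of all tuples, repetitions allowed. This keeps coordinates
-- independent; distinctness is imposed afterwards by discarding few tuples. All averages stay
-- unnormalised, so the combinatorics takes place in ℕ and ℤ, and rationals occur only at the very
-- end.

private variable
  X Y V : Set

-- Sums and counts over lists

vecs : List X → ∀ m → List (Vec X m)
vecs xs zero    = [] ∷ []
vecs xs (suc m) = concatMap (λ x → List.map (x ∷_) (vecs xs m)) xs

-- Over an arbitrary commutative semiring, because counts are summed in ℕ while signed deviations
-- are summed in ℤ.
module ListSum {A : Set} {_⊕_ _⊗_ : A → A → A} {0# 1# : A}
               (R : IsCommutativeSemiring _≡_ _⊕_ _⊗_ 0# 1#) where
  open IsCommutativeSemiring R

  ∑ : List X → (X → A) → A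
  ∑ []       f = 0#
  ∑ (x ∷ xs) f = f x ⊕ ∑ xs f

  ∑-cong : ∀ (xs : List X) {f g : X → A} → (∀ x → f x ≡ g x) → ∑ xs f ≡ ∑ xs g
  ∑-cong []       e = ≡.refl
  ∑-cong (x ∷ xs) e = cong₂ _⊕_ (e x) (∑-cong xs e)

  ∑-++ : ∀ (xs ys : List X) (f : X → A) → ∑ (xs ++ ys) f ≡ (∑ xs f ⊕ ∑ ys f)
  ∑-++ []       ys f = ≡.sym (+-identityˡ _)
  ∑-++ (x ∷ xs) ys f = ≡.trans (cong (f x ⊕_) (∑-++ xs ys f)) (≡.sym (+-assoc _ _ _))

  ∑-map : ∀ (g : X → Y) (xs : List X) (f : Y → A) → ∑ (List.map g xs) f ≡ ∑ xs (f ∘ g)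
  ∑-map g []       f = ≡.refl
  ∑-map g (x ∷ xs) f = cong (f (g x) ⊕_) (∑-map g xs f)

  ∑-concatMap : ∀ (h : X → List Y) (xs : List X) (f : Y → A) →
                ∑ (concatMap h xs) f ≡ ∑ xs (λ x → ∑ (h x) f)
  ∑-concatMap h []       f = ≡.refl
  ∑-concatMap h (x ∷ xs) f =
    ≡.trans (∑-++ (h x) (concatMap h xs) f) (cong (∑ (h x) f ⊕_) (∑-concatMap h xs f))

  ∑-vecs : ∀ (xs : List X) m (f : Vec X (suc m) → A) →
           ∑ (vecs xs (suc m)) f ≡ ∑ xs (λ x → ∑ (vecs xs m) (λ s → f (x ∷ s)))
  ∑-vecs xs m f = ≡.trans (∑-concatMap _ xs f) (∑-cong xs λ x → ∑-map (x ∷_) (vecs xs m) f)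

  ∑-0 : ∀ (xs : List X) → ∑ xs (λ _ → 0#) ≡ 0#
  ∑-0 []       = ≡.refl
  ∑-0 (x ∷ xs) = ≡.trans (+-identityˡ _) (∑-0 xs)

  private
    interchange : ∀ a b c d → ((a ⊕ b) ⊕ (c ⊕ d)) ≡ ((a ⊕ c) ⊕ (b ⊕ d))
    interchange a b c d = begin
      (a ⊕ b) ⊕ (c ⊕ d) ≡⟨ +-assoc a b _ ⟩
      a ⊕ (b ⊕ (c ⊕ d)) ≡⟨ cong (a ⊕_) (≡.sym (+-assoc b c d)) ⟩
      a ⊕ ((b ⊕ c) ⊕ d) ≡⟨ cong (λ z → a ⊕ (z ⊕ d)) (+-comm b c) ⟩
      a ⊕ ((c ⊕ b) ⊕ d) ≡⟨ cong (a ⊕_) (+-assoc c b d) ⟩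
      a ⊕ (c ⊕ (b ⊕ d)) ≡⟨ ≡.sym (+-assoc a c _) ⟩
      (a ⊕ c) ⊕ (b ⊕ d) ∎ where open ≡-Reasoning

  ∑-+ : ∀ (xs : List X) (f g : X → A) → ∑ xs (λ x → f x ⊕ g x) ≡ (∑ xs f ⊕ ∑ xs g)
  ∑-+ []       f g = ≡.sym (+-identityˡ _)
  ∑-+ (x ∷ xs) f g =
    ≡.trans (cong ((f x ⊕ g x) ⊕_) (∑-+ xs f g)) (interchange (f x) (g x) (∑ xs f) (∑ xs g))

  ∑-*ˡ : ∀ (xs : List X) c (f : X → A) → ∑ xs (λ x → c ⊗ f x) ≡ (c ⊗ ∑ xs f)
  ∑-*ˡ []       c f = ≡.sym (zeroʳ c)
  ∑-*ˡ (x ∷ xs) c f = ≡.trans (cong ((c ⊗ f x) ⊕_) (∑-*ˡ xs c f)) (≡.sym (distribˡ c _ _))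

  ∑-*ʳ : ∀ (xs : List X) c (f : X → A) → ∑ xs (λ x → f x ⊗ c) ≡ (∑ xs f ⊗ c)
  ∑-*ʳ xs c f =
    ≡.trans (∑-cong xs λ x → *-comm (f x) c) (≡.trans (∑-*ˡ xs c f) (*-comm c _))

  ∑-swap : ∀ (xs : List X) (ys : List Y) (f : X → Y → A) →
           ∑ xs (λ x → ∑ ys (f x)) ≡ ∑ ys (λ y → ∑ xs (λ x → f x y))
  ∑-swap []       ys f = ≡.sym (∑-0 ys)
  ∑-swap (x ∷ xs) ys f =
    ≡.trans (cong (∑ ys (f x) ⊕_) (∑-swap xs ys f)) (≡.sym (∑-+ ys (f x) _))

  ∑-↭ : ∀ {xs ys : List X} (f : X → A) → xs ↭ ys → ∑ xs f ≡ ∑ ys f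
  ∑-↭ f _↭_.refl = ≡.refl
  ∑-↭ f (_↭_.prep x p) = cong (f x ⊕_) (∑-↭ f p)
  ∑-↭ {xs = x ∷ y ∷ xs} f (_↭_.swap x y p) =
    ≡.trans (≡.sym (+-assoc (f x) (f y) _))
      (≡.trans (cong₂ _⊕_ (+-comm (f x) (f y)) (∑-↭ f p)) (+-assoc (f y) (f x) _))
  ∑-↭ f (_↭_.trans p q) = ≡.trans (∑-↭ f p) (∑-↭ f q)

open ListSum ℕP.+-*-isCommutativeSemiring public
module ℤSum = ListSum ℤP.+-*-isCommutativeSemiring

∑-mono-∈ : ∀ (xs : List X) {f g : X → ℕ} → (∀ x → x ∈ xs → f x ≤ g x) → ∑ xs f ≤ ∑ xs g
∑-mono-∈ []       h = z≤n
∑-mono-∈ (x ∷ xs) h = ℕP.+-mono-≤ (h x (here ≡.refl)) (∑-mono-∈ xs λ y y∈ → h y (there y∈))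

∑-mono : ∀ (xs : List X) {f g : X → ℕ} → (∀ x → f x ≤ g x) → ∑ xs f ≤ ∑ xs g
∑-mono xs h = ∑-mono-∈ xs λ x _ → h x

∑-const : ∀ (xs : List X) c → ∑ xs (λ _ → c) ≡ length xs * c
∑-const []       c = ≡.refl
∑-const (x ∷ xs) c = cong (c ℕ.+_) (∑-const xs c)

length-∑ : ∀ (xs : List X) → length xs ≡ ∑ xs (λ _ → 1)
length-∑ xs = ≡.sym (≡.trans (∑-const xs 1) (ℕP.*-identityʳ _))

length-vecs : ∀ (xs : List X) m → length (vecs xs m) ≡ length xs ^ m
length-vecs xs zero    = ≡.refl
length-vecs xs (suc m) = begin
  length (vecs xs (suc m))                   ≡⟨ length-∑ (vecs xs (suc m)) ⟩
  ∑ (vecs xs (suc m)) (λ _ → 1)              ≡⟨ ∑-vecs xs m _ ⟩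
  ∑ xs (λ _ → ∑ (vecs xs m) (λ _ → 1))       ≡⟨ ∑-const xs _ ⟩
  length xs * ∑ (vecs xs m) (λ _ → 1)        ≡⟨ cong (length xs *_) (≡.trans (≡.sym (length-∑ (vecs xs m))) (length-vecs xs m)) ⟩
  length xs * length xs ^ m                  ∎ where open ≡-Reasoning

∈-∑-≤ : ∀ {xs : List X} {x} (f : X → ℕ) → x ∈ xs → f x ≤ ∑ xs f
∈-∑-≤ f (here ≡.refl) = ℕP.m≤m+n _ _
∈-∑-≤ f (there x∈)  = ℕP.≤-trans (∈-∑-≤ f x∈) (ℕP.m≤n+m _ _)

-- The averaging step behind both probabilistic choices: the next absorber in the weight argument
-- and the shift of the grid.
∑-pigeonhole : ∀ (xs : List X) (f g : X → ℕ) → 0 < length xs → ∑ xs f ≤ ∑ xs g →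
               ∃ λ x → x ∈ xs × f x ≤ g x
∑-pigeonhole {X} (x₀ ∷ xs₀) f g _ = go x₀ xs₀
  where
  go : ∀ x xs → ∑ (x ∷ xs) f ≤ ∑ (x ∷ xs) g → ∃ λ z → z ∈ x ∷ xs × f z ≤ g z
  go x []       le = x , here ≡.refl , ≡.subst₂ _≤_ (ℕP.+-identityʳ _) (ℕP.+-identityʳ _) le
  go x (y ∷ xs) le with f x ℕP.≤? g x
  ... | yes p = x , here ≡.refl , p
  ... | no ¬p = let z , z∈ , q = go y xs (ℕP.+-cancelˡ-≤ (f x) _ _ (ℕP.≤-trans le (ℕP.+-monoˡ-≤ _ (ℕP.<⇒≤ (ℕP.≰⇒> ¬p)))))
                in z , there z∈ , q

𝟙 : Bool → ℕ
𝟙 true  = 1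
𝟙 false = 0

𝟙≤1 : ∀ b → 𝟙 b ≤ 1
𝟙≤1 true  = s≤s z≤n
𝟙≤1 false = z≤n

# : (X → Bool) → List X → ℕ
# P xs = ∑ xs (𝟙 ∘ P)

#≤length : ∀ (P : X → Bool) xs → # P xs ≤ length xs
#≤length P xs = ℕP.≤-trans (∑-mono xs (𝟙≤1 ∘ P)) (ℕP.≤-reflexive (≡.sym (length-∑ xs)))

length-filterᵇ : ∀ (P : X → Bool) xs → length (filterᵇ P xs) ≡ # P xs
length-filterᵇ P []       = ≡.refl
length-filterᵇ P (x ∷ xs) with P x
... | true  = cong suc (length-filterᵇ P xs)
... | false = length-filterᵇ P xs

-- Fourth moment of a sum of independent centred variables

∑ᶻ-mono : ∀ (xs : List X) {f g : X → ℤ} → (∀ x → x ∈ xs → f x ℤ.≤ g x) → ℤSum.∑ xs f ℤ.≤ ℤSum.∑ xs g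
∑ᶻ-mono []       h = ℤP.≤-refl
∑ᶻ-mono (x ∷ xs) h = ℤP.+-mono-≤ (h x (here ≡.refl)) (∑ᶻ-mono xs λ y y∈ → h y (there y∈))

∑ᶻ-cast : ∀ (xs : List X) (f : X → ℕ) → ℤSum.∑ xs (λ x → + f x) ≡ + ∑ xs f
∑ᶻ-cast []       f = ≡.refl
∑ᶻ-cast (x ∷ xs) f = cong (ℤ._+_ (+ f x)) (∑ᶻ-cast xs f)

∑ᶻ-const : ∀ (xs : List X) c → ℤSum.∑ xs (λ _ → c) ≡ + length xs ℤ.* c
∑ᶻ-const []       c = ≡.sym (ℤP.*-zeroˡ c)
∑ᶻ-const (x ∷ xs) c = ≡.trans (cong (ℤ._+_ c) (∑ᶻ-const xs c)) (≡.sym (ℤP.suc-* (+ length xs) c))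

total : ∀ {m} → Vec (X → ℤ) m → Vec X m → ℤ
total []       []      = + 0
total (y ∷ ys) (x ∷ s) = y x ℤ.+ total ys s

module Moments {X : Set} (xs : List X) where
  open ℤSum using () renaming (∑ to ∑ᶻ)

  private
    M : ℤ
    M = + length xs

    Mᵐ : ℕ → ℤ
    Mᵐ m = + (length xs ^ m)

    -- A term stands for `c * (f x * g s)`. Once a power of `y x + total ys s` is expanded into such
    -- terms, its sum over all tuples factorises term by term; this is where independence of the
    -- first coordinate from the others enters.
    BilinearTerm : ℕ → Set
    BilinearTerm m = ℤ × (X → ℤ) × (Vec X m → ℤ)

    bilinear : ∀ {m} → List (BilinearTerm m) → X → Vec X m → ℤ
    bilinear []                  x s = + 0
    bilinear ((c , f , g) ∷ ts) x s = c ℤ.* (f x ℤ.* g s) ℤ.+ bilinear ts x s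

    bilinear-∑ : ∀ {m} → List (BilinearTerm m) → ℤ
    bilinear-∑     []                  = + 0
    bilinear-∑ {m} ((c , f , g) ∷ ts) = c ℤ.* (∑ᶻ xs f ℤ.* ∑ᶻ (vecs xs m) g) ℤ.+ bilinear-∑ ts

    ∑-bilinear : ∀ {m} (ts : List (BilinearTerm m)) →
                 ∑ᶻ xs (λ x → ∑ᶻ (vecs xs m) (bilinear ts x)) ≡ bilinear-∑ ts
    ∑-bilinear {m} [] = ≡.trans (ℤSum.∑-cong xs λ x → ℤSum.∑-0 (vecs xs m)) (ℤSum.∑-0 xs)
    ∑-bilinear {m} ((c , f , g) ∷ ts) =
      ≡.trans (ℤSum.∑-cong xs λ x → ℤSum.∑-+ (vecs xs m) (λ s → c ℤ.* (f x ℤ.* g s)) (bilinear ts x))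
      (≡.trans (ℤSum.∑-+ xs (λ x → ∑ᶻ (vecs xs m) λ s → c ℤ.* (f x ℤ.* g s)) λ x → ∑ᶻ (vecs xs m) (bilinear ts x))
        (cong₂ ℤ._+_ (begin
          ∑ᶻ xs (λ x → ∑ᶻ (vecs xs m) (λ s → c ℤ.* (f x ℤ.* g s)))
            ≡⟨ ℤSum.∑-cong xs (λ x → ≡.trans (ℤSum.∑-*ˡ (vecs xs m) c (λ s → f x ℤ.* g s))
                                            (cong (c ℤ.*_) (ℤSum.∑-*ˡ (vecs xs m) (f x) g))) ⟩
          ∑ᶻ xs (λ x → c ℤ.* (f x ℤ.* ∑ᶻ (vecs xs m) g))
            ≡⟨ ℤSum.∑-*ˡ xs c (λ x → f x ℤ.* ∑ᶻ (vecs xs m) g) ⟩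
          c ℤ.* ∑ᶻ xs (λ x → f x ℤ.* ∑ᶻ (vecs xs m) g)
            ≡⟨ cong (c ℤ.*_) (ℤSum.∑-*ʳ xs (∑ᶻ (vecs xs m) g) f) ⟩
          c ℤ.* (∑ᶻ xs f ℤ.* ∑ᶻ (vecs xs m) g) ∎)
        (∑-bilinear ts)))
      where open ≡-Reasoning

    one : ∀ {Y : Set} → Y → ℤ
    one _ = + 1

    ∑one : ∑ᶻ xs one ≡ M
    ∑one = ≡.trans (∑ᶻ-const xs (+ 1)) (ℤP.*-identityʳ M)

    ∑ones : ∀ m → ∑ᶻ (vecs xs m) one ≡ Mᵐ m
    ∑ones m = ≡.trans (∑ᶻ-const (vecs xs m) (+ 1)) (≡.trans (ℤP.*-identityʳ _) (cong +_ (length-vecs xs m)))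

  moment : ℕ → ∀ {m} → Vec (X → ℤ) m → ℤ
  moment k {m} ys = ∑ᶻ (vecs xs m) (λ s → total ys s ℤ.^ k)

  private
    split : ∀ k {m} (y : X → ℤ) (ys : Vec (X → ℤ) m) (ts : List (BilinearTerm m)) →
            (∀ x s → (y x ℤ.+ total ys s) ℤ.^ k ≡ bilinear ts x s) → moment k (y ∷ ys) ≡ bilinear-∑ ts
    split k {m} y ys ts e =
      ≡.trans (ℤSum.∑-vecs xs m (λ s → total (y ∷ ys) s ℤ.^ k))
        (≡.trans (ℤSum.∑-cong xs λ x → ℤSum.∑-cong (vecs xs m) (e x)) (∑-bilinear ts))

    pow : ∀ {Y : Set} → (Y → ℤ) → ℕ → Y → ℤ
    pow f k y = f y ℤ.^ k

  -- Deviations are multiplied by the number `M` of sample points to remain integers, so the usual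
  -- bound of 1 on a centred indicator becomes `M`.
  record Centred (y : X → ℤ) : Set where
    field
      mean≡0  : ∑ᶻ xs y ≡ + 0
      bounded : ∀ x → x ∈ xs → y x ℤ.^ 2 ℤ.≤ M ℤ.^ 2

  open Centred

  moment₁ : ∀ {m} {ys : Vec (X → ℤ) m} → VAll.All Centred ys → moment 1 ys ≡ + 0
  moment₁ VAll.[] = ≡.refl
  moment₁ {suc m} {y ∷ ys} (c VAll.∷ cs) = begin
    moment 1 (y ∷ ys)
      ≡⟨ split 1 y ys ((+ 1 , y , one) ∷ (+ 1 , one , pow (total ys) 1) ∷ []) (λ x s → expand (y x) (total ys s)) ⟩
    + 1 ℤ.* (∑ᶻ xs y ℤ.* ∑ᶻ (vecs xs m) one) ℤ.+ (+ 1 ℤ.* (∑ᶻ xs one ℤ.* moment 1 ys) ℤ.+ + 0)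
      ≡⟨ cong₂ (λ a b → + 1 ℤ.* (a ℤ.* ∑ᶻ (vecs xs m) one) ℤ.+ (+ 1 ℤ.* (∑ᶻ xs one ℤ.* b) ℤ.+ + 0)) (mean≡0 c) (moment₁ cs) ⟩
    + 1 ℤ.* (+ 0 ℤ.* ∑ᶻ (vecs xs m) one) ℤ.+ (+ 1 ℤ.* (∑ᶻ xs one ℤ.* + 0) ℤ.+ + 0)
      ≡⟨ vanish (∑ᶻ (vecs xs m) one) (∑ᶻ xs one) ⟩
    + 0 ∎
    where
    open ≡-Reasoning
    expand : ∀ a b → ((a ℤ.+ b) ℤ.* + 1) ≡ + 1 ℤ.* (a ℤ.* + 1) ℤ.+ (+ 1 ℤ.* (+ 1 ℤ.* (b ℤ.* + 1)) ℤ.+ + 0)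
    expand = ℤR.solve-∀
    vanish : ∀ a b → + 1 ℤ.* (+ 0 ℤ.* a) ℤ.+ (+ 1 ℤ.* (b ℤ.* + 0) ℤ.+ + 0) ≡ + 0
    vanish = ℤR.solve-∀

  private
    0≤square : ∀ a → + 0 ℤ.≤ a ℤ.^ 2
    0≤square a = subst (λ z → + 0 ℤ.≤ a ℤ.* z) (≡.sym (ℤP.*-identityʳ a)) (h a)
      where
      h : ∀ a → + 0 ℤ.≤ a ℤ.* a
      h (+ zero)     = ℤ.+≤+ z≤n
      h (+ suc n)    = ℤ.+≤+ z≤n
      h (ℤ.-[1+ n ]) = ℤ.+≤+ z≤n

    *-monoˡ : ∀ c {a b} → + 0 ℤ.≤ c → a ℤ.≤ b → c ℤ.* a ℤ.≤ c ℤ.* b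
    *-monoˡ (+ c) _ le = ℤP.*-monoˡ-≤-nonNeg (+ c) le

    *-mono : ∀ {a b c d} → + 0 ℤ.≤ a → + 0 ℤ.≤ d → a ℤ.≤ b → c ℤ.≤ d → a ℤ.* c ℤ.≤ b ℤ.* d
    *-mono {a} {b} {c} {d} 0≤a 0≤d a≤b c≤d =
      ℤP.≤-trans (*-monoˡ a 0≤a c≤d) (≡.subst₂ ℤ._≤_ (ℤP.*-comm d a) (ℤP.*-comm d b) (*-monoˡ d 0≤d a≤b))

    ∑bound : ∀ {f : X → ℤ} {c} → (∀ x → x ∈ xs → f x ℤ.≤ c) → ∑ᶻ xs f ℤ.≤ M ℤ.* c
    ∑bound {c = c} h = ℤP.≤-trans (∑ᶻ-mono xs h) (ℤP.≤-reflexive (∑ᶻ-const xs c))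

    ∑0≤ : ∀ {f : X → ℤ} → (∀ x → + 0 ℤ.≤ f x) → + 0 ℤ.≤ ∑ᶻ xs f
    ∑0≤ {f} h = ℤP.≤-trans (ℤP.≤-reflexive (≡.sym (ℤSum.∑-0 xs))) (∑ᶻ-mono xs (λ x _ → h x))

    Mᵐ-suc : ∀ m → Mᵐ (suc m) ≡ M ℤ.* Mᵐ m
    Mᵐ-suc m = ℤP.pos-* (length xs) (length xs ^ m)

    fourth : ∀ a → (a ℤ.* (a ℤ.* (a ℤ.* (a ℤ.* + 1)))) ≡ (a ℤ.* (a ℤ.* + 1)) ℤ.* (a ℤ.* (a ℤ.* + 1))
    fourth = ℤR.solve-∀

  moment₂ : ∀ {m} {ys : Vec (X → ℤ) m} → VAll.All Centred ys →
            moment 2 ys ℤ.≤ + m ℤ.* (M ℤ.^ 2 ℤ.* Mᵐ m)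
  moment₂ VAll.[] = ℤP.≤-refl
  moment₂ {suc m} {y ∷ ys} (c VAll.∷ cs) = begin
    moment 2 (y ∷ ys)
      ≡⟨ split 2 y ys ((+ 1 , pow y 2 , one) ∷ (+ 2 , y , pow (total ys) 1) ∷ (+ 1 , one , pow (total ys) 2) ∷ [])
           (λ x s → expand (y x) (total ys s)) ⟩
    + 1 ℤ.* (∑ᶻ xs (pow y 2) ℤ.* ∑ᶻ (vecs xs m) one) ℤ.+ (+ 2 ℤ.* (∑ᶻ xs y ℤ.* moment 1 ys) ℤ.+ (+ 1 ℤ.* (∑ᶻ xs one ℤ.* moment 2 ys) ℤ.+ + 0))
      ≡⟨ cong (λ a → + 1 ℤ.* (∑ᶻ xs (pow y 2) ℤ.* ∑ᶻ (vecs xs m) one) ℤ.+ (+ 2 ℤ.* (a ℤ.* moment 1 ys) ℤ.+ (+ 1 ℤ.* (∑ᶻ xs one ℤ.* moment 2 ys) ℤ.+ + 0))) (mean≡0 c) ⟩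
    + 1 ℤ.* (∑ᶻ xs (pow y 2) ℤ.* ∑ᶻ (vecs xs m) one) ℤ.+ (+ 2 ℤ.* (+ 0 ℤ.* moment 1 ys) ℤ.+ (+ 1 ℤ.* (∑ᶻ xs one ℤ.* moment 2 ys) ℤ.+ + 0))
      ≡⟨ cong₂ (λ a b → + 1 ℤ.* (∑ᶻ xs (pow y 2) ℤ.* a) ℤ.+ (+ 2 ℤ.* (+ 0 ℤ.* moment 1 ys) ℤ.+ (+ 1 ℤ.* (b ℤ.* moment 2 ys) ℤ.+ + 0))) (∑ones m) ∑one ⟩
    _ ≡⟨ simp (∑ᶻ xs (pow y 2)) (Mᵐ m) (moment 1 ys) M (moment 2 ys) ⟩
    ∑ᶻ xs (pow y 2) ℤ.* Mᵐ m ℤ.+ M ℤ.* moment 2 ys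
      ≤⟨ ℤP.+-mono-≤ (*-mono (∑0≤ (λ x → 0≤square (y x))) (ℤ.+≤+ z≤n) (∑bound (bounded c)) (ℤP.≤-refl {Mᵐ m}))
                     (*-monoˡ M (ℤ.+≤+ z≤n) (moment₂ cs)) ⟩
    (M ℤ.* M ℤ.^ 2) ℤ.* Mᵐ m ℤ.+ M ℤ.* (+ m ℤ.* (M ℤ.^ 2 ℤ.* Mᵐ m))
      ≡⟨ collect M (Mᵐ m) (+ m) ⟩
    (+ 1 ℤ.+ + m) ℤ.* (M ℤ.^ 2 ℤ.* (M ℤ.* Mᵐ m))
      ≡⟨ cong (λ z → + suc m ℤ.* (M ℤ.^ 2 ℤ.* z)) (Mᵐ-suc m) ⟨
    + suc m ℤ.* (M ℤ.^ 2 ℤ.* Mᵐ (suc m)) ∎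
    where
    open ℤP.≤-Reasoning
    expand : ∀ a b → ((a ℤ.+ b) ℤ.* ((a ℤ.+ b) ℤ.* + 1)) ≡ + 1 ℤ.* ((a ℤ.* (a ℤ.* + 1)) ℤ.* + 1) ℤ.+ (+ 2 ℤ.* (a ℤ.* (b ℤ.* + 1)) ℤ.+ (+ 1 ℤ.* (+ 1 ℤ.* (b ℤ.* (b ℤ.* + 1))) ℤ.+ + 0))
    expand = ℤR.solve-∀
    simp : ∀ a b c d e → + 1 ℤ.* (a ℤ.* b) ℤ.+ (+ 2 ℤ.* (+ 0 ℤ.* c) ℤ.+ (+ 1 ℤ.* (d ℤ.* e) ℤ.+ + 0)) ≡ a ℤ.* b ℤ.+ d ℤ.* e
    simp = ℤR.solve-∀
    collect : ∀ a b c → (a ℤ.* (a ℤ.* (a ℤ.* + 1))) ℤ.* b ℤ.+ a ℤ.* (c ℤ.* ((a ℤ.* (a ℤ.* + 1)) ℤ.* b)) ≡ (+ 1 ℤ.+ c) ℤ.* ((a ℤ.* (a ℤ.* + 1)) ℤ.* (a ℤ.* b))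
    collect = ℤR.solve-∀

  -- Split off the first variable y and let S be the sum of the others. The terms y^3 S and y S^3
  -- vanish because S and y have mean zero. What remains is y^4 + 6 y^2 S^2 + S^4, and in units of
  -- M^4 the bound follows from 1 + 6m + 3m^2 = 3(m + 1)^2 - 2.
  moment₄ : ∀ {m} {ys : Vec (X → ℤ) m} → VAll.All Centred ys →
            moment 4 ys ℤ.≤ + 3 ℤ.* (+ m ℤ.* + m) ℤ.* (M ℤ.^ 4 ℤ.* Mᵐ m)
  moment₄ VAll.[] = ℤP.≤-refl
  moment₄ {suc m} {y ∷ ys} (c VAll.∷ cs) = begin
    moment 4 (y ∷ ys)
      ≡⟨ split 4 y ys ((+ 1 , pow y 4 , one) ∷ (+ 4 , pow y 3 , pow (total ys) 1) ∷ (+ 6 , pow y 2 , pow (total ys) 2)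
                        ∷ (+ 4 , y , pow (total ys) 3) ∷ (+ 1 , one , pow (total ys) 4) ∷ [])
           (λ x s → expand (y x) (total ys s)) ⟩
    + 1 ℤ.* (y4 ℤ.* ∑ᶻ (vecs xs m) one) ℤ.+ (+ 4 ℤ.* (∑ᶻ xs (pow y 3) ℤ.* moment 1 ys) ℤ.+ (+ 6 ℤ.* (y2 ℤ.* moment 2 ys)
      ℤ.+ (+ 4 ℤ.* (∑ᶻ xs y ℤ.* moment 3 ys) ℤ.+ (+ 1 ℤ.* (∑ᶻ xs one ℤ.* moment 4 ys) ℤ.+ + 0))))
      ≡⟨ cong₂ (λ a b → + 1 ℤ.* (y4 ℤ.* ∑ᶻ (vecs xs m) one) ℤ.+ (+ 4 ℤ.* (∑ᶻ xs (pow y 3) ℤ.* a) ℤ.+ (+ 6 ℤ.* (y2 ℤ.* moment 2 ys)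
                          ℤ.+ (+ 4 ℤ.* (b ℤ.* moment 3 ys) ℤ.+ (+ 1 ℤ.* (∑ᶻ xs one ℤ.* moment 4 ys) ℤ.+ + 0)))))
               (moment₁ cs) (mean≡0 c) ⟩
    + 1 ℤ.* (y4 ℤ.* ∑ᶻ (vecs xs m) one) ℤ.+ (+ 4 ℤ.* (∑ᶻ xs (pow y 3) ℤ.* + 0) ℤ.+ (+ 6 ℤ.* (y2 ℤ.* moment 2 ys)
      ℤ.+ (+ 4 ℤ.* (+ 0 ℤ.* moment 3 ys) ℤ.+ (+ 1 ℤ.* (∑ᶻ xs one ℤ.* moment 4 ys) ℤ.+ + 0))))
      ≡⟨ cong₂ (λ a b → + 1 ℤ.* (y4 ℤ.* a) ℤ.+ (+ 4 ℤ.* (∑ᶻ xs (pow y 3) ℤ.* + 0) ℤ.+ (+ 6 ℤ.* (y2 ℤ.* moment 2 ys)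
                          ℤ.+ (+ 4 ℤ.* (+ 0 ℤ.* moment 3 ys) ℤ.+ (+ 1 ℤ.* (b ℤ.* moment 4 ys) ℤ.+ + 0)))))
               (∑ones m) ∑one ⟩
    _ ≡⟨ simp y4 (Mᵐ m) (∑ᶻ xs (pow y 3)) y2 (moment 2 ys) (moment 3 ys) M (moment 4 ys) ⟩
    y4 ℤ.* Mᵐ m ℤ.+ (+ 6 ℤ.* (y2 ℤ.* moment 2 ys) ℤ.+ M ℤ.* moment 4 ys)
      ≤⟨ ℤP.+-mono-≤ (*-mono (∑0≤ (λ x → y⁴≥0 x)) (ℤ.+≤+ z≤n) (∑bound y⁴≤) (ℤP.≤-refl {Mᵐ m}))
         (ℤP.+-mono-≤ (*-monoˡ (+ 6) (ℤ.+≤+ z≤n) (*-mono (∑0≤ (λ x → 0≤square (y x))) rhs≥0 (∑bound (bounded c)) (moment₂ cs)))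
                      (*-monoˡ M (ℤ.+≤+ z≤n) (moment₄ cs))) ⟩
    (M ℤ.* (M ℤ.^ 2 ℤ.* M ℤ.^ 2)) ℤ.* Mᵐ m ℤ.+ (+ 6 ℤ.* ((M ℤ.* M ℤ.^ 2) ℤ.* (+ m ℤ.* (M ℤ.^ 2 ℤ.* Mᵐ m)))
      ℤ.+ M ℤ.* (+ 3 ℤ.* (+ m ℤ.* + m) ℤ.* (M ℤ.^ 4 ℤ.* Mᵐ m)))
      ≡⟨ collect M (Mᵐ m) (+ m) ⟩
    (+ 3 ℤ.* ((+ 1 ℤ.+ + m) ℤ.* (+ 1 ℤ.+ + m)) ℤ.+ (- + 2)) ℤ.* (M ℤ.^ 4 ℤ.* (M ℤ.* Mᵐ m))
      ≤⟨ *-mono-weak ⟩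
    + 3 ℤ.* (+ suc m ℤ.* + suc m) ℤ.* (M ℤ.^ 4 ℤ.* (M ℤ.* Mᵐ m))
      ≡⟨ cong (λ z → + 3 ℤ.* (+ suc m ℤ.* + suc m) ℤ.* (M ℤ.^ 4 ℤ.* z)) (Mᵐ-suc m) ⟨
    + 3 ℤ.* (+ suc m ℤ.* + suc m) ℤ.* (M ℤ.^ 4 ℤ.* Mᵐ (suc m)) ∎
    where
    open ℤP.≤-Reasoning
    y2 = ∑ᶻ xs (pow y 2)
    y4 = ∑ᶻ xs (pow y 4)
    y⁴≥0 : ∀ x → + 0 ℤ.≤ y x ℤ.^ 4
    y⁴≥0 x = subst (+ 0 ℤ.≤_) (≡.sym (fourth (y x))) (ℤP.≤-trans (ℤP.≤-reflexive (≡.sym (ℤP.*-zeroʳ (y x ℤ.^ 2)))) (*-monoˡ _ (0≤square (y x)) (0≤square (y x))))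
    y⁴≤ : ∀ x → x ∈ xs → y x ℤ.^ 4 ℤ.≤ M ℤ.^ 2 ℤ.* M ℤ.^ 2
    y⁴≤ x x∈ = subst (ℤ._≤ _) (≡.sym (fourth (y x))) (*-mono (0≤square (y x)) (0≤square M) (bounded c x x∈) (bounded c x x∈))
    0≤* : ∀ {a b} → + 0 ℤ.≤ a → + 0 ℤ.≤ b → + 0 ℤ.≤ a ℤ.* b
    0≤* {a} 0≤a 0≤b = ℤP.≤-trans (ℤP.≤-reflexive (≡.sym (ℤP.*-zeroʳ a))) (*-monoˡ a 0≤a 0≤b)
    rhs≥0 : + 0 ℤ.≤ + m ℤ.* (M ℤ.^ 2 ℤ.* Mᵐ m)
    rhs≥0 = 0≤* {+ m} (ℤ.+≤+ z≤n) (0≤* (0≤square M) (ℤ.+≤+ z≤n))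
    tail≥0 : + 0 ℤ.≤ M ℤ.^ 4 ℤ.* (M ℤ.* Mᵐ m)
    tail≥0 = 0≤* (subst (+ 0 ℤ.≤_) (≡.sym (fourth M)) (0≤* (0≤square M) (0≤square M))) (0≤* {M} (ℤ.+≤+ z≤n) (ℤ.+≤+ z≤n))
    *-mono-weak : (+ 3 ℤ.* (+ suc m ℤ.* + suc m) ℤ.+ (- + 2)) ℤ.* (M ℤ.^ 4 ℤ.* (M ℤ.* Mᵐ m)) ℤ.≤ + 3 ℤ.* (+ suc m ℤ.* + suc m) ℤ.* (M ℤ.^ 4 ℤ.* (M ℤ.* Mᵐ m))
    *-mono-weak = ≡.subst₂ ℤ._≤_ (ℤP.*-comm w (v ℤ.+ - + 2)) (ℤP.*-comm w v)
      (*-monoˡ w tail≥0 (ℤP.≤-trans (ℤP.+-monoʳ-≤ v (ℤ.-≤+ {1} {0})) (ℤP.≤-reflexive (ℤP.+-identityʳ v))))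
      where
      v = + 3 ℤ.* (+ suc m ℤ.* + suc m)
      w = M ℤ.^ 4 ℤ.* (M ℤ.* Mᵐ m)
    expand : ∀ a b → ((a ℤ.+ b) ℤ.* ((a ℤ.+ b) ℤ.* ((a ℤ.+ b) ℤ.* ((a ℤ.+ b) ℤ.* + 1)))) ≡ + 1 ℤ.* ((a ℤ.* (a ℤ.* (a ℤ.* (a ℤ.* + 1)))) ℤ.* + 1) ℤ.+ (+ 4 ℤ.* ((a ℤ.* (a ℤ.* (a ℤ.* + 1))) ℤ.* (b ℤ.* + 1)) ℤ.+ (+ 6 ℤ.* ((a ℤ.* (a ℤ.* + 1)) ℤ.* (b ℤ.* (b ℤ.* + 1)))
               ℤ.+ (+ 4 ℤ.* (a ℤ.* (b ℤ.* (b ℤ.* (b ℤ.* + 1)))) ℤ.+ (+ 1 ℤ.* (+ 1 ℤ.* (b ℤ.* (b ℤ.* (b ℤ.* (b ℤ.* + 1))))) ℤ.+ + 0))))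
    expand = ℤR.solve-∀
    simp : ∀ a b c d e f g h → + 1 ℤ.* (a ℤ.* b) ℤ.+ (+ 4 ℤ.* (c ℤ.* + 0) ℤ.+ (+ 6 ℤ.* (d ℤ.* e)
             ℤ.+ (+ 4 ℤ.* (+ 0 ℤ.* f) ℤ.+ (+ 1 ℤ.* (g ℤ.* h) ℤ.+ + 0)))) ≡ a ℤ.* b ℤ.+ (+ 6 ℤ.* (d ℤ.* e) ℤ.+ g ℤ.* h)
    simp = ℤR.solve-∀
    collect : ∀ a b c → (a ℤ.* ((a ℤ.* (a ℤ.* + 1)) ℤ.* (a ℤ.* (a ℤ.* + 1)))) ℤ.* b ℤ.+ (+ 6 ℤ.* ((a ℤ.* (a ℤ.* (a ℤ.* + 1))) ℤ.* (c ℤ.* ((a ℤ.* (a ℤ.* + 1)) ℤ.* b)))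
                ℤ.+ a ℤ.* (+ 3 ℤ.* (c ℤ.* c) ℤ.* ((a ℤ.* (a ℤ.* (a ℤ.* (a ℤ.* + 1)))) ℤ.* b)))
              ≡ (+ 3 ℤ.* ((+ 1 ℤ.+ c) ℤ.* (+ 1 ℤ.+ c)) ℤ.+ (- + 2)) ℤ.* ((a ℤ.* (a ℤ.* (a ℤ.* (a ℤ.* + 1)))) ℤ.* (a ℤ.* b))
    collect = ℤR.solve-∀

-- Tail bounds for degrees into a random sample

-- Each coordinate is read through its own map `fs b`. Thus one bound covers both a tuple of
-- vertices, where all maps are the identity, and a row of the grid, where `fs b` lists column `b`.
sample : ∀ {m} → (Fin m → X → V) → Vec X m → List V
sample fs s = tabulate (λ b → fs b (lookup s b))

-- `σ` is a surplus demanded beyond `t`; it later pays for vertices that are exchanged after the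
-- sample has been drawn.
low : ℕ → ℕ → ℕ → (V → Bool) → List V → Bool
low q t σ g us = q * # g us ℕ.<ᵇ t + σ

module Tail {X V : Set} (xs : List X) where
  open Moments xs
  open ℤSum using () renaming (∑ to ∑ᶻ)

  -- `length xs` times the expectation of `# g (sample fs s)` for a uniform tuple `s`.
  mass : ∀ {m} → (V → Bool) → (Fin m → X → V) → ℕ
  mass g fs = ∑ (tabulate (λ b → # (g ∘ fs b) xs)) (λ d → d)

  private
    L : ℕ
    L = length xs

    dev : (X → Bool) → X → ℤ
    dev h x = + L ℤ.* + 𝟙 (h x) ℤ.- + # h xs

    dev-centred : ∀ h → Centred (dev h)
    dev-centred h = record { mean≡0 = mean ; bounded = λ x _ → bound (h x) }
      where
      open ≡-Reasoning
      d = # h xs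
      mean : ∑ᶻ xs (dev h) ≡ + 0
      mean = begin
        ∑ᶻ xs (dev h) ≡⟨ ℤSum.∑-+ xs _ _ ⟩
        ∑ᶻ xs (λ x → + L ℤ.* + 𝟙 (h x)) ℤ.+ ∑ᶻ xs (λ _ → - + d)
          ≡⟨ cong₂ ℤ._+_ (≡.trans (ℤSum.∑-*ˡ xs (+ L) _) (cong (ℤ._*_ (+ L)) (∑ᶻ-cast xs (𝟙 ∘ h)))) (∑ᶻ-const xs (- + d)) ⟩
        + L ℤ.* + d ℤ.+ + L ℤ.* (- + d) ≡⟨ cancel (+ L) (+ d) ⟩
        + 0 ∎
        where
        cancel : ∀ a b → a ℤ.* b ℤ.+ a ℤ.* (- b) ≡ + 0
        cancel = ℤR.solve-∀
      square : ∀ {a b : ℕ} → a ≤ b → (+ a) ℤ.^ 2 ℤ.≤ (+ b) ℤ.^ 2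
      square {a} {b} le = ≡.subst₂ ℤ._≤_ (pos a) (pos b) (ℤ.+≤+ (ℕP.*-mono-≤ le le))
        where
        pos : ∀ c → + (c * c) ≡ (+ c) ℤ.^ 2
        pos c = ≡.trans (ℤP.pos-* c c) (cong (ℤ._*_ (+ c)) (≡.sym (ℤP.*-identityʳ (+ c))))
      bound : ∀ b → (+ L ℤ.* + 𝟙 b ℤ.- + d) ℤ.^ 2 ℤ.≤ (+ L) ℤ.^ 2
      bound false = subst (ℤ._≤ (+ L) ℤ.^ 2) (neg (+ d) (+ L)) (square (#≤length h xs))
        where
        neg : ∀ a l → a ℤ.* (a ℤ.* + 1) ≡ (l ℤ.* + 0 ℤ.- a) ℤ.* ((l ℤ.* + 0 ℤ.- a) ℤ.* + 1)
        neg = ℤR.solve-∀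
      bound true = subst (λ z → z ℤ.^ 2 ℤ.≤ (+ L) ℤ.^ 2) e (square (ℕP.m∸n≤m L d))
        where
        e : + (L ∸ d) ≡ + L ℤ.* + 1 ℤ.- + d
        e = ≡.trans (≡.sym (ℤP.⊖-≥ (#≤length h xs))) (≡.trans (≡.sym (ℤP.m-n≡m⊖n L d)) (cong (ℤ._- + d) (≡.sym (ℤP.*-identityʳ (+ L)))))

    devs : ∀ {m} → (V → Bool) → (Fin m → X → V) → Vec (X → ℤ) m
    devs g fs = Vec.tabulate (λ b → dev (g ∘ fs b))

    total-devs : ∀ {m} g (fs : Fin m → X → V) s →
                 total (devs g fs) s ≡ + L ℤ.* + # g (sample fs s) ℤ.- + mass g fs
    total-devs {zero}  g fs []      = ≡.sym (≡.trans (ℤP.+-identityʳ _) (ℤP.*-zeroʳ (+ L)))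
    total-devs {suc m} g fs (x ∷ s) =
      ≡.trans (cong (ℤ._+_ (dev (g ∘ fs Fin.zero) x)) (total-devs g (fs ∘ Fin.suc) s))
        (regroup (+ L) (+ 𝟙 (g (fs Fin.zero x))) (+ # (g ∘ fs Fin.zero) xs) (+ # g (sample (fs ∘ Fin.suc) s)) (+ mass g (fs ∘ Fin.suc)))
      where
      regroup : ∀ l a b c d → (l ℤ.* a ℤ.- b) ℤ.+ (l ℤ.* c ℤ.- d) ≡ l ℤ.* (a ℤ.+ c) ℤ.- (b ℤ.+ d)
      regroup = ℤR.solve-∀

    pos^ : ∀ a k → + (a ^ k) ≡ (+ a) ℤ.^ k
    pos^ a zero    = ≡.refl
    pos^ a (suc k) = ≡.trans (ℤP.pos-* a (a ^ k)) (cong (ℤ._*_ (+ a)) (pos^ a k))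

    pow4-mono : ∀ {a b} → + 0 ℤ.≤ a → a ℤ.≤ b → a ℤ.^ 4 ℤ.≤ b ℤ.^ 4
    pow4-mono {+ a} {+ b} _ (ℤ.+≤+ le) = ≡.subst₂ ℤ._≤_ (pos^ a 4) (pos^ b 4) (ℤ.+≤+ (ℕP.^-monoˡ-≤ 4 le))

  -- Markov's inequality for the fourth power. The hypothesis places `L` times the count at least L
  -- m / (2 q) below its mean `mass g fs`; the constant is 48 = 2^4 * 3, with 2^4 from 2 q and 3
  -- from the fourth moment.
  deviation : ∀ {m} q g (fs : Fin m → X → V) (P : Vec X m → Bool) →
              (∀ s → P s ≡ true → L * m + 2 * q * (L * # g (sample fs s)) ≤ 2 * q * mass g fs) →
              # P (vecs xs m) * (L * m) ^ 4 ≤ 48 * q ^ 4 * ((m * m) * (L ^ 4 * L ^ m))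
  deviation {m} q g fs P far = ℤP.drop‿+≤+ (begin
    + (# P (vecs xs m) * (L * m) ^ 4)
      ≡⟨ cong +_ (≡.sym (∑-*ʳ (vecs xs m) ((L * m) ^ 4) (𝟙 ∘ P))) ⟩
    + ∑ (vecs xs m) (λ s → 𝟙 (P s) * (L * m) ^ 4)
      ≡⟨ ≡.sym (∑ᶻ-cast (vecs xs m) _) ⟩
    ∑ᶻ (vecs xs m) (λ s → + (𝟙 (P s) * (L * m) ^ 4))
      ≤⟨ ∑ᶻ-mono (vecs xs m) (λ s _ → pointwise s (P s) ≡.refl) ⟩
    ∑ᶻ (vecs xs m) (λ s → (+ (2 * q)) ℤ.^ 4 ℤ.* total ys s ℤ.^ 4)
      ≡⟨ ℤSum.∑-*ˡ (vecs xs m) ((+ (2 * q)) ℤ.^ 4) _ ⟩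
    (+ (2 * q)) ℤ.^ 4 ℤ.* moment 4 ys
      ≤⟨ scale (moment₄ (VAllP.tabulate⁺ (λ b → dev-centred (g ∘ fs b)))) ⟩
    (+ (2 * q)) ℤ.^ 4 ℤ.* (+ 3 ℤ.* (+ m ℤ.* + m) ℤ.* ((+ L) ℤ.^ 4 ℤ.* + (L ^ m)))
      ≡⟨ cast ⟩
    + (48 * q ^ 4 * ((m * m) * (L ^ 4 * L ^ m))) ∎)
    where
    open ℤP.≤-Reasoning
    ys = devs g fs
    scale : ∀ {a b} → a ℤ.≤ b → (+ (2 * q)) ℤ.^ 4 ℤ.* a ℤ.≤ (+ (2 * q)) ℤ.^ 4 ℤ.* b
    scale {a} {b} le = subst (λ z → z ℤ.* a ℤ.≤ z ℤ.* b) (pos^ (2 * q) 4) (ℤP.*-monoˡ-≤-nonNeg (+ ((2 * q) ^ 4)) le)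
    cast : (+ (2 * q)) ℤ.^ 4 ℤ.* (+ 3 ℤ.* (+ m ℤ.* + m) ℤ.* ((+ L) ℤ.^ 4 ℤ.* + (L ^ m))) ≡ + (48 * q ^ 4 * ((m * m) * (L ^ 4 * L ^ m)))
    cast = ≡.trans (≡.trans (cong₂ (λ a b → a ℤ.* (+ 3 ℤ.* (+ m ℤ.* + m) ℤ.* (b ℤ.* + (L ^ m)))) (≡.sym (pos^ (2 * q) 4)) (≡.sym (pos^ L 4)))
        (≡.trans (cong₂ (λ a b → + ((2 * q) ^ 4) ℤ.* (+ 3 ℤ.* a ℤ.* b)) (≡.sym (ℤP.pos-* m m)) (≡.sym (ℤP.pos-* (L ^ 4) (L ^ m))))
        (≡.trans (cong (λ a → + ((2 * q) ^ 4) ℤ.* (a ℤ.* + (L ^ 4 * L ^ m))) (≡.sym (ℤP.pos-* 3 (m * m))))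
        (≡.trans (cong (ℤ._*_ (+ ((2 * q) ^ 4))) (≡.sym (ℤP.pos-* (3 * (m * m)) (L ^ 4 * L ^ m))))
        (≡.sym (ℤP.pos-* ((2 * q) ^ 4) (3 * (m * m) * (L ^ 4 * L ^ m))))))))
        (cong +_ (arith q (m * m) (L ^ 4 * L ^ m)))
      where
      arith : ∀ q a b → (2 * q) ^ 4 * (3 * a * b) ≡ 48 * q ^ 4 * (a * b)
      arith q a b = h q a b
        where
        h : ∀ q a b → (2 * q) * ((2 * q) * ((2 * q) * ((2 * q) * 1))) * (3 * a * b) ≡ 48 * (q * (q * (q * (q * 1)))) * (a * b)
        h = ℕR.solve-∀
    pointwise : ∀ s b → P s ≡ b → + (𝟙 b * (L * m) ^ 4) ℤ.≤ (+ (2 * q)) ℤ.^ 4 ℤ.* total ys s ℤ.^ 4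
    pointwise s false e = subst (+ 0 ℤ.≤_) (prod (+ (2 * q)) (total ys s)) (nonneg ((+ (2 * q) ℤ.* total ys s) ℤ.* (+ (2 * q) ℤ.* total ys s)))
      where
      nonneg : ∀ a → + 0 ℤ.≤ a ℤ.* a
      nonneg (+ zero)     = ℤ.+≤+ z≤n
      nonneg (+ suc n)    = ℤ.+≤+ z≤n
      nonneg (ℤ.-[1+ n ]) = ℤ.+≤+ z≤n
      prod : ∀ a b → ((a ℤ.* b) ℤ.* (a ℤ.* b)) ℤ.* ((a ℤ.* b) ℤ.* (a ℤ.* b)) ≡ (a ℤ.* (a ℤ.* (a ℤ.* (a ℤ.* + 1)))) ℤ.* (b ℤ.* (b ℤ.* (b ℤ.* (b ℤ.* + 1))))
      prod = ℤR.solve-∀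
    pointwise s true e = begin
      + (1 * (L * m) ^ 4) ≡⟨ cong +_ (ℕP.*-identityˡ _) ⟩
      + ((L * m) ^ 4) ≡⟨ pos^ (L * m) 4 ⟩
      (+ (L * m)) ℤ.^ 4 ≤⟨ pow4-mono (ℤ.+≤+ z≤n) lower ⟩
      (- (+ (2 * q) ℤ.* total ys s)) ℤ.^ 4 ≡⟨ prod (+ (2 * q)) (total ys s) ⟩
      (+ (2 * q)) ℤ.^ 4 ℤ.* total ys s ℤ.^ 4 ∎
      where
      prod : ∀ a b → (- (a ℤ.* b)) ℤ.* ((- (a ℤ.* b)) ℤ.* ((- (a ℤ.* b)) ℤ.* ((- (a ℤ.* b)) ℤ.* + 1))) ≡ (a ℤ.* (a ℤ.* (a ℤ.* (a ℤ.* + 1)))) ℤ.* (b ℤ.* (b ℤ.* (b ℤ.* (b ℤ.* + 1))))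
      prod = ℤR.solve-∀
      h = # g (sample fs s)
      D = mass g fs
      lower : + (L * m) ℤ.≤ - (+ (2 * q) ℤ.* total ys s)
      lower = begin
        + (L * m) ≡⟨ add (+ (L * m)) (+ (2 * q) ℤ.* (+ L ℤ.* + h)) ⟩
        (+ (L * m) ℤ.+ + (2 * q) ℤ.* (+ L ℤ.* + h)) ℤ.- + (2 * q) ℤ.* (+ L ℤ.* + h)
          ≡⟨ cong (λ z → (+ (L * m) ℤ.+ z) ℤ.- + (2 * q) ℤ.* (+ L ℤ.* + h))
                 (≡.trans (cong (ℤ._*_ (+ (2 * q))) (≡.sym (ℤP.pos-* L h))) (≡.sym (ℤP.pos-* (2 * q) (L * h)))) ⟩
        + (L * m + 2 * q * (L * h)) ℤ.- + (2 * q) ℤ.* (+ L ℤ.* + h)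
          ≤⟨ ℤP.+-monoˡ-≤ (- (+ (2 * q) ℤ.* (+ L ℤ.* + h))) (ℤ.+≤+ (far s e)) ⟩
        + (2 * q * D) ℤ.- + (2 * q) ℤ.* (+ L ℤ.* + h)
          ≡⟨ cong (ℤ._- + (2 * q) ℤ.* (+ L ℤ.* + h)) (ℤP.pos-* (2 * q) D) ⟩
        + (2 * q) ℤ.* + D ℤ.- + (2 * q) ℤ.* (+ L ℤ.* + h)
          ≡⟨ factor (+ (2 * q)) (+ D) (+ L ℤ.* + h) ⟩
        - (+ (2 * q) ℤ.* (+ L ℤ.* + h ℤ.- + D))
          ≡⟨ cong (λ z → - (+ (2 * q) ℤ.* z)) (≡.sym (total-devs g fs s)) ⟩
        - (+ (2 * q) ℤ.* total ys s) ∎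
        where
        add : ∀ a b → a ≡ (a ℤ.+ b) ℤ.- b
        add = ℤR.solve-∀
        factor : ∀ a b c → a ℤ.* b ℤ.- a ℤ.* c ≡ - (a ℤ.* (c ℤ.- b))
        factor = ℤR.solve-∀

  -- The expected count is at least (p + 1) m / q, whereas a low count is below (p m + σ) / q. As σ
  -- is at most m / 2, the gap is at least m / (2 q), which is the deviation required above.
  tail : ∀ {m} .{{_ : NonZero L}} .{{_ : NonZero m}} p q σ g (fs : Fin m → X → V) →
         suc p * (L * m) ≤ q * mass g fs → 2 * σ ≤ m →
         # (λ s → low q (p * m) σ g (sample fs s)) (vecs xs m) * (m * m) ≤ 48 * q ^ 4 * L ^ m
  tail {m} p q σ g fs dense slack =
    ℕP.*-cancelʳ-≤ _ _ (L ^ 4 * (m * m)) {{ℕP.m*n≢0 (L ^ 4) (m * m) {{ℕP.m^n≢0 L 4}} {{ℕP.m*n≢0 m m}}}}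
      (≡.subst₂ _≤_ (lhs N L m) (rhs (48 * q ^ 4) (m * m) (L ^ 4) (L ^ m))
        (deviation q g fs (λ s → low q (p * m) σ g (sample fs s)) far))
    where
    N = # (λ s → low q (p * m) σ g (sample fs s)) (vecs xs m)
    lhs : ∀ N L m → N * (L * m) ^ 4 ≡ N * (m * m) * (L ^ 4 * (m * m))
    lhs = h
      where
      h : ∀ N L m → N * ((L * m) * ((L * m) * ((L * m) * ((L * m) * 1)))) ≡ N * (m * m) * ((L * (L * (L * (L * 1)))) * (m * m))
      h = ℕR.solve-∀
    rhs : ∀ q a b c → q * (a * (b * c)) ≡ q * c * (b * a)
    rhs = ℕR.solve-∀
    far : ∀ s → low q (p * m) σ g (sample fs s) ≡ true → L * m + 2 * q * (L * # g (sample fs s)) ≤ 2 * q * mass g fs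
    far s e = begin
      L * m + 2 * q * (L * # g (sample fs s))      ≡⟨ e₁ L m q (# g (sample fs s)) ⟩
      L * m + 2 * L * (q * # g (sample fs s))      ≤⟨ ℕP.+-monoʳ-≤ (L * m) (ℕP.*-monoʳ-≤ (2 * L) (ℕP.<⇒≤ (ℕP.<ᵇ⇒< _ _ (subst T (≡.sym e) _)))) ⟩
      L * m + 2 * L * (p * m + σ)                  ≡⟨ e₂ L m p σ ⟩
      L * m + 2 * p * (L * m) + L * (2 * σ)        ≤⟨ ℕP.+-monoʳ-≤ (L * m + 2 * p * (L * m)) (ℕP.*-monoʳ-≤ L slack) ⟩
      L * m + 2 * p * (L * m) + L * m              ≡⟨ e₃ (L * m) p ⟩
      2 * (suc p * (L * m))                        ≤⟨ ℕP.*-monoʳ-≤ 2 dense ⟩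
      2 * (q * mass g fs)                          ≡⟨ ℕP.*-assoc 2 q _ ⟨
      2 * q * mass g fs ∎
      where
      open ℕP.≤-Reasoning
      e₁ : ∀ L m q h → L * m + 2 * q * (L * h) ≡ L * m + 2 * L * (q * h)
      e₁ = ℕR.solve-∀
      e₂ : ∀ L m p σ → L * m + 2 * L * (p * m + σ) ≡ L * m + 2 * p * (L * m) + L * (2 * σ)
      e₂ = ℕR.solve-∀
      e₃ : ∀ a p → a + 2 * p * a + a ≡ 2 * (suc p * a)
      e₃ = ℕR.solve-∀

  -- A uniform tuple stays uniform when one coordinate is redrawn.
  ∑-resample : ∀ {m} (b : Fin m) (h : Vec X m → ℕ) →
               ∑ xs (λ x → ∑ (vecs xs m) (λ s → h (s [ b ]≔ x))) ≡ L * ∑ (vecs xs m) h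
  ∑-resample {suc m} Fin.zero h = begin
    ∑ xs (λ x → ∑ (vecs xs (suc m)) (λ s → h (s [ Fin.zero ]≔ x)))
      ≡⟨ ∑-cong xs (λ x → ∑-vecs xs m (λ s → h (s [ Fin.zero ]≔ x))) ⟩
    ∑ xs (λ x → ∑ xs (λ _ → ∑ (vecs xs m) (λ s → h (x ∷ s))))
      ≡⟨ ∑-cong xs (λ x → ∑-const xs _) ⟩
    ∑ xs (λ x → L * ∑ (vecs xs m) (λ s → h (x ∷ s)))
      ≡⟨ ∑-*ˡ xs L _ ⟩
    L * ∑ xs (λ x → ∑ (vecs xs m) (λ s → h (x ∷ s)))
      ≡⟨ cong (L *_) (≡.sym (∑-vecs xs m h)) ⟩
    L * ∑ (vecs xs (suc m)) h ∎ where open ≡-Reasoning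
  ∑-resample {suc m} (Fin.suc b) h = begin
    ∑ xs (λ x → ∑ (vecs xs (suc m)) (λ s → h (s [ Fin.suc b ]≔ x)))
      ≡⟨ ∑-cong xs (λ x → ∑-vecs xs m (λ s → h (s [ Fin.suc b ]≔ x))) ⟩
    ∑ xs (λ x → ∑ xs (λ y → ∑ (vecs xs m) (λ s → h (y ∷ (s [ b ]≔ x)))))
      ≡⟨ ∑-swap xs xs _ ⟩
    ∑ xs (λ y → ∑ xs (λ x → ∑ (vecs xs m) (λ s → h (y ∷ (s [ b ]≔ x)))))
      ≡⟨ ∑-cong xs (λ y → ∑-resample b (h ∘ (y ∷_))) ⟩
    ∑ xs (λ y → L * ∑ (vecs xs m) (λ s → h (y ∷ s)))
      ≡⟨ ∑-*ˡ xs L _ ⟩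
    L * ∑ xs (λ y → ∑ (vecs xs m) (λ s → h (y ∷ s)))
      ≡⟨ cong (L *_) (≡.sym (∑-vecs xs m h)) ⟩
    L * ∑ (vecs xs (suc m)) h ∎ where open ≡-Reasoning

  #-resample : ∀ {m} (b : Fin m) x g (fs : Fin m → X → V) s →
               # g (sample fs s) ≤ suc (# g (sample fs (s [ b ]≔ x)))
  #-resample Fin.zero    x g fs (y ∷ s) = ℕP.+-mono-≤ (𝟙≤1 (g (fs Fin.zero y))) (ℕP.m≤n+m _ (𝟙 (g (fs Fin.zero x))))
  #-resample (Fin.suc b) x g fs (y ∷ s) =
    ℕP.≤-trans (ℕP.+-monoʳ-≤ (𝟙 (g (fs Fin.zero y))) (#-resample b x g (fs ∘ Fin.suc) s))
      (ℕP.≤-reflexive (ℕP.+-suc _ _))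

𝟙-any : ∀ (P : Y → Bool) ys → 𝟙 (any P ys) ≤ # P ys
𝟙-any P []       = z≤n
𝟙-any P (y ∷ ys) with P y
... | true  = s≤s z≤n
... | false = 𝟙-any P ys

𝟙-mono : ∀ {a b} → (a ≡ true → b ≡ true) → 𝟙 a ≤ 𝟙 b
𝟙-mono {false} h = z≤n
𝟙-mono {true}  h rewrite h ≡.refl = ℕP.≤-refl

T⇒≡ : ∀ {b} → T b → b ≡ true
T⇒≡ {true} _ = ≡.refl

≡⇒T : ∀ {b} → b ≡ true → T b
≡⇒T ≡.refl = _

∑-tabulate : ∀ {m} (h : Fin m → Y) (φ : Y → ℕ) → ∑ (tabulate h) φ ≡ ∑ (allFin m) (φ ∘ h)
∑-tabulate {m = m} h φ = ≡.trans (cong (λ ys → ∑ ys φ) (≡.sym (ListP.map-tabulate (λ b → b) h))) (∑-map h (allFin m) φ)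

module _ {X V : Set} (xs : List X) where
  open Tail {X} {V} xs
  private
    L : ℕ
    L = length xs

  -- The vertex `v` is an entry of the sample, hence not independent of its own degree into it.
  -- Redrawing the coordinate that produced `v` restores independence and changes the count by at
  -- most one, which costs `q` of surplus. The union over m positions then turns 1 / m^2 into 1 / m.
  concentration : ∀ {m} .{{_ : NonZero L}} .{{_ : NonZero m}} p q σ (E : V → V → Bool) (fs : Fin m → X → V) →
    (∀ v → suc p * (L * m) ≤ q * mass (E v) fs) → 2 * (σ + q) ≤ m →
    # (λ s → any (λ v → low q (p * m) σ (E v) (sample fs s)) (sample fs s)) (vecs xs m) * m ≤ 48 * q ^ 4 * L ^ m
  concentration {m} p q σ E fs dense slack = ℕP.*-cancelʳ-≤ _ _ m (begin
    # (λ s → any (bad s) (sample fs s)) (vecs xs m) * m * m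
      ≡⟨ ℕP.*-assoc (# (λ s → any (bad s) (sample fs s)) (vecs xs m)) m m ⟩
    # (λ s → any (bad s) (sample fs s)) (vecs xs m) * (m * m)
      ≤⟨ ℕP.*-monoˡ-≤ (m * m) (∑-mono (vecs xs m) (λ s → 𝟙-any (bad s) (sample fs s))) ⟩
    ∑ (vecs xs m) (λ s → ∑ (sample fs s) (𝟙 ∘ bad s)) * (m * m)
      ≡⟨ cong (_* (m * m)) (≡.trans (∑-cong (vecs xs m) (λ s → ∑-tabulate (λ b → fs b (lookup s b)) (𝟙 ∘ bad s))) (∑-swap (vecs xs m) (allFin m) _)) ⟩
    ∑ (allFin m) (λ b → ∑ (vecs xs m) (λ s → 𝟙 (bad s (fs b (lookup s b))))) * (m * m)
      ≡⟨ ∑-*ʳ (allFin m) (m * m) _ ⟨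
    ∑ (allFin m) (λ b → ∑ (vecs xs m) (λ s → 𝟙 (bad s (fs b (lookup s b)))) * (m * m))
      ≤⟨ ∑-mono (allFin m) position ⟩
    ∑ (allFin m) (λ _ → 48 * q ^ 4 * L ^ m)
      ≡⟨ ∑-const (allFin m) _ ⟩
    length (allFin m) * (48 * q ^ 4 * L ^ m)
      ≡⟨ cong (_* (48 * q ^ 4 * L ^ m)) (ListP.length-tabulate {n = m} (λ b → b)) ⟩
    m * (48 * q ^ 4 * L ^ m) ≡⟨ ℕP.*-comm m _ ⟩
    48 * q ^ 4 * L ^ m * m ∎)
    where
    open ℕP.≤-Reasoning
    bad : Vec X m → V → Bool
    bad s v = low q (p * m) σ (E v) (sample fs s)

    resampled : ∀ b x s → 𝟙 (bad (s [ b ]≔ x) (fs b (lookup (s [ b ]≔ x) b))) ≤ 𝟙 (low q (p * m) (σ + q) (E (fs b x)) (sample fs s))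
    resampled b x s rewrite VecP.lookup∘update b s x = 𝟙-mono λ e → T⇒≡ (ℕP.<⇒<ᵇ (begin-strict
      q * # g (sample fs s)                        ≤⟨ ℕP.*-monoʳ-≤ q (#-resample b x g fs s) ⟩
      q * suc (# g (sample fs (s [ b ]≔ x)))       ≡⟨ ℕP.*-suc q _ ⟩
      q + q * # g (sample fs (s [ b ]≔ x))         <⟨ ℕP.+-monoʳ-< q (ℕP.<ᵇ⇒< _ _ (≡⇒T e)) ⟩
      q + (p * m + σ)                              ≡⟨ ℕP.+-comm q _ ⟩
      p * m + σ + q                                ≡⟨ ℕP.+-assoc (p * m) σ q ⟩
      p * m + (σ + q)                              ∎))
      where g = E (fs b x)

    position : ∀ b → ∑ (vecs xs m) (λ s → 𝟙 (bad s (fs b (lookup s b)))) * (m * m) ≤ 48 * q ^ 4 * L ^ m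
    position b = ℕP.*-cancelˡ-≤ L (begin
      L * (∑ (vecs xs m) h * (m * m))     ≡⟨ ℕP.*-assoc L _ _ ⟨
      L * ∑ (vecs xs m) h * (m * m)       ≡⟨ cong (_* (m * m)) (∑-resample b h) ⟨
      ∑ xs (λ x → ∑ (vecs xs m) (λ s → h (s [ b ]≔ x))) * (m * m)
        ≤⟨ ℕP.*-monoˡ-≤ (m * m) (∑-mono xs λ x → ∑-mono (vecs xs m) (resampled b x)) ⟩
      ∑ xs (λ x → # (λ s → low q (p * m) (σ + q) (E (fs b x)) (sample fs s)) (vecs xs m)) * (m * m)
        ≡⟨ ∑-*ʳ xs (m * m) _ ⟨
      ∑ xs (λ x → # (λ s → low q (p * m) (σ + q) (E (fs b x)) (sample fs s)) (vecs xs m) * (m * m))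
        ≤⟨ ∑-mono xs (λ x → tail p q (σ + q) (E (fs b x)) fs (dense (fs b x)) slack) ⟩
      ∑ xs (λ _ → 48 * q ^ 4 * L ^ m)     ≡⟨ ∑-const xs _ ⟩
      L * (48 * q ^ 4 * L ^ m)            ∎)
      where
      h : Vec X m → ℕ
      h s = 𝟙 (bad s (fs b (lookup s b)))

-- Duplicate-free lists up to permutation

∈⇒↭∷ : ∀ {x : X} {xs} → x ∈ xs → ∃ λ ys → xs ↭ x ∷ ys
∈⇒↭∷ x∈ with ∈-∃++ x∈
... | ys , zs , ≡.refl = ys ++ zs , ↭P.shift _ ys zs

-- Provides the vertices and the colours that remain once the absorbers have been taken out.
complement : ∀ {xs ys : List X} → Unique xs → (∀ {z} → z ∈ xs → z ∈ ys) → ∃ λ zs → ys ↭ xs ++ zs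
complement {ys = ys} []       sub = ys , ↭-refl
complement {xs = x ∷ xs} {ys} (x∉ ∷ u) sub =
  let ys′ , p = ∈⇒↭∷ (sub (here ≡.refl))
      zs , q  = complement u λ z∈ → avoid (λ { ≡.refl → All.lookup x∉ z∈ ≡.refl }) (↭P.∈-resp-↭ p (sub (there z∈)))
  in zs , ↭-trans p (↭-prep x q)
  where
  avoid : ∀ {x z : X} {ws} → (z ≡ x → ⊥) → z ∈ x ∷ ws → z ∈ ws
  avoid ne (here e)  = ⊥-elim (ne e)
  avoid ne (there m) = m

unique-↭ : ∀ {xs ys : List X} → Unique xs → Unique ys →
           (∀ {z} → z ∈ xs → z ∈ ys) → (∀ {z} → z ∈ ys → z ∈ xs) → xs ↭ ys
unique-↭ {xs = xs} {ys} ux uy xs⊆ys ys⊆xs with complement ux xs⊆ys | complement uy ys⊆xs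
... | []     , p | _      = ↭-sym (↭-trans p (↭-reflexive (ListP.++-identityʳ xs)))
... | z ∷ zs , p | ws , q = ⊥-elim (ℕP.<-irrefl ≡.refl (begin-strict
    length xs                        <⟨ ℕP.m<m+n (length xs) (s≤s z≤n) ⟩
    length xs + suc (length zs)      ≡⟨ ListP.length-++ xs ⟨
    length (xs ++ z ∷ zs)            ≡⟨ ↭P.↭-length p ⟨
    length ys                        ≤⟨ ℕP.m≤m+n _ _ ⟩
    length ys + length ws            ≡⟨ ListP.length-++ ys ⟨
    length (ys ++ ws)                ≡⟨ ↭P.↭-length q ⟨
    length xs ∎))
  where open ℕP.≤-Reasoning

Unique-resp-↭ : ∀ {xs ys : List X} → xs ↭ ys → Unique xs → Unique ys
Unique-resp-↭ {X = X} p = ↭SetoidP.Unique-resp-↭ (≡.setoid X) (↭⇒↭ₛ p)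

Unique-++⁻ˡ : ∀ (xs : List X) {ys} → Unique (xs ++ ys) → Unique xs
Unique-++⁻ˡ []       u        = []
Unique-++⁻ˡ (x ∷ xs) (x∉ ∷ u) = AllP.++⁻ˡ xs x∉ ∷ Unique-++⁻ˡ xs u

Unique-++⁻ʳ : ∀ (xs : List X) {ys} → Unique (xs ++ ys) → Unique ys
Unique-++⁻ʳ []       u       = u
Unique-++⁻ʳ (x ∷ xs) (_ ∷ u) = Unique-++⁻ʳ xs u

Unique-++⇒disjoint : ∀ (xs : List X) {ys v} → Unique (xs ++ ys) → v ∈ xs → v ∈ ys → ⊥
Unique-++⇒disjoint (x ∷ xs) (x∉ ∷ u) (here ≡.refl) v∈ys = All.lookup (AllP.++⁻ʳ xs x∉) v∈ys ≡.refl
Unique-++⇒disjoint (x ∷ xs) (_ ∷ u)  (there v∈xs)  v∈ys = Unique-++⇒disjoint xs u v∈xs v∈ys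

Unique-tabulate⁻ : ∀ {m} {φ : Fin m → X} → Unique (tabulate φ) → ∀ {a b} → φ a ≡ φ b → a ≡ b
Unique-tabulate⁻ u        {Fin.zero}  {Fin.zero}  e = ≡.refl
Unique-tabulate⁻ {φ = φ} (x∉ ∷ u) {Fin.zero}  {Fin.suc b} e = ⊥-elim (AllP.tabulate⁻ x∉ b e)
Unique-tabulate⁻ {φ = φ} (x∉ ∷ u) {Fin.suc a} {Fin.zero}  e = ⊥-elim (AllP.tabulate⁻ x∉ a (≡.sym e))
Unique-tabulate⁻ (x∉ ∷ u) {Fin.suc a} {Fin.suc b} e = cong Fin.suc (Unique-tabulate⁻ u e)

concatMap-position : ∀ (h : X → List Y) {xs p p′ v} → Unique (concatMap h xs) →
                     p ∈ xs → p′ ∈ xs → v ∈ h p → v ∈ h p′ → p ≡ p′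
concatMap-position h u (here ≡.refl) (here ≡.refl) _ _ = ≡.refl
concatMap-position h {x ∷ xs} u (here ≡.refl) (there b) v∈ v∈′ =
  ⊥-elim (Unique-++⇒disjoint (h x) u v∈ (∈-concatMap⁺ h (Any.map (λ { ≡.refl → v∈′ }) b)))
concatMap-position h {x ∷ xs} u (there a) (here ≡.refl) v∈ v∈′ =
  ⊥-elim (Unique-++⇒disjoint (h x) u v∈′ (∈-concatMap⁺ h (Any.map (λ { ≡.refl → v∈ }) a)))
concatMap-position h {x ∷ xs} u (there a) (there b) = concatMap-position h (Unique-++⁻ʳ (h x) u) a b

Unique-concatMap⁻ : ∀ (h : X → List Y) {xs p} → Unique (concatMap h xs) → p ∈ xs → Unique (h p)
Unique-concatMap⁻ h {x ∷ xs} u (here ≡.refl) = Unique-++⁻ˡ (h x) u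
Unique-concatMap⁻ h {x ∷ xs} u (there p∈)    = Unique-concatMap⁻ h (Unique-++⁻ʳ (h x) u) p∈

-- Tilings by coloured copies of F

-- The defining property of the threshold for one fixed ε, with its density written as p / q and
-- denominators cleared.
record Threshold {r} (F : Graph r) (p q m₀ : ℕ) : Set where
  field
    factor : ∀ m → m₀ ≤ m → r ∣ m → (H : Graph m) →
             (∀ v → p * m ≤ q * # (adj H v) (allFin m)) → FFactor F H

module Factors {r N n : ℕ} (F : Graph r) (G : Fin n → Graph N) where

  Placement : Set
  Placement = Fin n × (Fin r → Fin N)

  verts : Placement → List (Fin N)
  verts (c , φ) = tabulate φ

  Valid : Placement → Set
  Valid (c , φ) = EdgePreserving F (G c) φ

  -- Permutations of lists encode disjointness and exact use of every colour, so partial tilings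
  -- combine by concatenation. Injectivity is recovered only once, in `transversal`.
  record Tiling (vs : List (Fin N)) (cs : List (Fin n)) : Set where
    constructor tiling
    field
      placements : List Placement
      valid      : All Valid placements
      covers     : concatMap verts placements ↭ vs
      colours    : List.map proj₁ placements ↭ cs

  Tiling-resp : ∀ {vs vs′ cs cs′} → vs ↭ vs′ → cs ↭ cs′ → Tiling vs cs → Tiling vs′ cs′
  Tiling-resp p q (tiling ps ok cov col) = tiling ps ok (↭-trans cov p) (↭-trans col q)

  Tiling-++ : ∀ {vs vs′ cs cs′} → Tiling vs cs → Tiling vs′ cs′ → Tiling (vs ++ vs′) (cs ++ cs′)
  Tiling-++ (tiling ps ok cov col) (tiling ps′ ok′ cov′ col′) = tiling (ps ++ ps′) (AllP.++⁺ ok ok′)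
    (↭-trans (↭-reflexive (ListP.concatMap-++ verts ps ps′)) (↭P.++⁺ cov cov′))
    (↭-trans (↭-reflexive (ListP.map-++ proj₁ ps ps′)) (↭P.++⁺ col col′))

  Tiling-[] : Tiling [] []
  Tiling-[] = tiling [] [] ↭-refl ↭-refl

  Tiling-copy : ∀ {c φ} → EdgePreserving F (G c) φ → Tiling (tabulate φ) (c ∷ [])
  Tiling-copy {c} {φ} e = tiling ((c , φ) ∷ []) (e ∷ []) (↭-reflexive (ListP.++-identityʳ (tabulate φ))) ↭-refl

  Tiling-length : ∀ {vs cs} → Tiling vs cs → length vs ≡ length cs * r
  Tiling-length {vs} {cs} (tiling ps ok cov col) = begin
    length vs                     ≡⟨ ↭P.↭-length cov ⟨
    length (concatMap verts ps)   ≡⟨ go ps ⟩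
    length ps * r                 ≡⟨ cong (_* r) (≡.trans (≡.sym (ListP.length-map proj₁ ps)) (↭P.↭-length col)) ⟩
    length cs * r                 ∎
    where
    open ≡-Reasoning
    go : ∀ ps → length (concatMap verts ps) ≡ length ps * r
    go []             = ≡.refl
    go ((c , φ) ∷ ps) = ≡.trans (ListP.length-++ (tabulate φ)) (cong₂ _+_ (ListP.length-tabulate φ) (go ps))

  Agree : List (Fin N) → Fin n → Fin n → Set
  Agree us c c′ = ∀ u v → u ∈ us → v ∈ us → adj (G c) u v ≡ adj (G c′) u v

  Dense : ℕ → ℕ → Fin n → List (Fin N) → Set
  Dense p q c us = ∀ v → v ∈ us → p * length us ≤ q * # (adj (G c) v) us

  copy-agree : ∀ {us c c′ φ} → (∀ a → φ a ∈ us) → Agree us c c′ →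
               EdgePreserving F (G c) φ → EdgePreserving F (G c′) φ
  copy-agree φ∈ ag e a b ab = ≡.trans (≡.sym (ag _ _ (φ∈ a) (φ∈ b))) (e a b ab)

  copies-tile : ∀ {c₀ us} (φs : List (Fin r → Fin N)) cs → length φs ≡ length cs →
                All (EdgePreserving F (G c₀)) φs → (∀ {φ} → φ ∈ φs → ∀ a → φ a ∈ us) →
                All (Agree us c₀) cs → Tiling (concatMap tabulate φs) cs
  copies-tile []       []       _ _        _  _        = Tiling-[]
  copies-tile (φ ∷ φs) (c ∷ cs) e (v ∷ vs) φ∈ (a ∷ as) =
    Tiling-++ (Tiling-copy (copy-agree (φ∈ (here ≡.refl)) a v))
              (copies-tile φs cs (ℕP.suc-injective e) vs (λ z → φ∈ (there z)) as)

  module _ {p q m₀ : ℕ} (thr : Threshold F p q m₀) where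

    -- The auxiliary graph `H` lives on the positions of `us`. Hence sampled tuples with repeated
    -- vertices can be tiled as well, as multisets.
    factor-list : ∀ {c us} → m₀ ≤ length us → r ∣ length us → Dense p q c us →
                  ∃ λ φs → All (EdgePreserving F (G c)) φs × concatMap tabulate φs ↭ us
    factor-list {c} {us} large div dense =
      List.map (look ∘_) (tabulate φ) ,
      AllP.map⁺ (AllP.tabulate⁺ ep) ,
      ↭-trans (↭-reflexive relabel)
        (↭-trans (↭P.map⁺ look whole)
          (↭-reflexive (≡.trans (ListP.map-tabulate (λ i → i) look) (ListP.tabulate-lookup us))))
      where
      look = List.lookup us
      m = length us
      H : Graph m
      H = record { adj   = λ a b → adj (G c) (look a) (look b)
                 ; sym   = λ a b → Graph.sym (G c) (look a) (look b)
                 ; irref = λ a → irref (G c) (look a) }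
      degree : ∀ v → # (adj H v) (allFin m) ≡ # (adj (G c) (look v)) us
      degree v = ≡.trans (≡.sym (∑-tabulate look _)) (cong (# (adj (G c) (look v))) (ListP.tabulate-lookup us))
      ff = Threshold.factor thr m large div H λ v →
             ℕP.≤-trans (dense _ (∈-lookup v)) (ℕP.≤-reflexive (cong (q *_) (≡.sym (degree v))))
      k   = proj₁ ff
      φ   = proj₁ (proj₂ ff)
      ep  = proj₁ (proj₂ (proj₂ ff))
      inj = proj₁ (proj₂ (proj₂ (proj₂ ff)))
      sur = proj₂ (proj₂ (proj₂ (proj₂ ff)))
      listed : List (Fin m)
      listed = concat (tabulate λ i → tabulate (φ i))
      whole : listed ↭ allFin m
      whole = unique-↭
        (UniqueP.concat⁺ (AllP.tabulate⁺ λ i → UniqueP.tabulate⁺ λ e → proj₂ (inj i i _ _ e))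
          (AllPairsP.tabulate⁺ λ {i} {j} i≢j {v} (v∈ , v∈′) →
            let a , e = ∈-tabulate⁻ v∈ ; b , e′ = ∈-tabulate⁻ v∈′ in i≢j (proj₁ (inj i j a b (≡.trans (≡.sym e) e′)))))
        (UniqueP.allFin⁺ m)
        (λ _ → ∈-allFin _)
        (λ {z} _ → let i , a , e = sur z in
          ∈-concat⁺′ (subst (_∈ tabulate (φ i)) e (∈-tabulate⁺ {f = φ i} a)) (∈-tabulate⁺ {f = λ i → tabulate (φ i)} i))
      relabel : concatMap tabulate (List.map (look ∘_) (tabulate φ)) ≡ List.map look listed
      relabel = begin
        concat (List.map tabulate (List.map (look ∘_) (tabulate φ)))
          ≡⟨ cong concat (≡.trans (cong (List.map tabulate) (ListP.map-tabulate φ (look ∘_))) (ListP.map-tabulate _ tabulate)) ⟩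
        concat (tabulate λ i → tabulate (look ∘ φ i))
          ≡⟨ cong concat (ListP.tabulate-cong λ i → ≡.sym (ListP.map-tabulate (φ i) look)) ⟩
        concat (tabulate λ i → List.map look (tabulate (φ i)))
          ≡⟨ cong concat (≡.sym (ListP.map-tabulate (λ i → tabulate (φ i)) (List.map look))) ⟩
        concat (List.map (List.map look) (tabulate λ i → tabulate (φ i)))
          ≡⟨ ListP.concat-map (tabulate λ i → tabulate (φ i)) ⟩
        List.map look listed ∎ where open ≡-Reasoning

    private
      copies-length : ∀ (φs : List (Fin r → Fin N)) → length (concatMap tabulate φs) ≡ length φs * r
      copies-length []       = ≡.refl
      copies-length (φ ∷ φs) = ≡.trans (ListP.length-++ (tabulate φ)) (cong₂ _+_ (ListP.length-tabulate φ) (copies-length φs))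

      copy-∈ : ∀ {φs us} → concatMap tabulate φs ↭ us → ∀ {φ : Fin r → Fin N} → φ ∈ φs → ∀ a → φ a ∈ us
      copy-∈ cov {φ} φ∈ a = ↭P.∈-resp-↭ cov (∈-concatMap⁺ tabulate (Any.map (λ { ≡.refl → ∈-tabulate⁺ {f = φ} a }) φ∈))

    block-tiling : ∀ .{{_ : NonZero r}} {c us cs} → m₀ ≤ length us → length us ≡ length cs * r →
                   Dense p q c us → All (Agree us c) cs → Tiling us cs
    block-tiling {c} {us} {cs} large len dense agree =
      let φs , ok , cov = factor-list large (divides (length cs) len) dense
          count = ℕP.*-cancelʳ-≡ (length φs) (length cs) r
                    (≡.trans (≡.sym (copies-length φs)) (≡.trans (↭P.↭-length cov) len))
      in Tiling-resp cov ↭-refl (copies-tile φs cs count ok (copy-∈ cov) agree)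

    -- Colour c takes a copy of F inside the block A; the deleted vertices are replaced by xs,
    -- and the resulting block is still dense in c₀.
    absorb : ∀ .{{_ : NonZero r}} {c c₀ A xs k} {cs : List (Fin n)} → m₀ ≤ length A → length A ≡ suc k * r →
             length cs ≡ suc k → length xs ≡ r → Dense p q c A →
             (∀ v → v ∈ A ++ xs → p * length A + q * r ≤ q * # (adj (G c₀) v) A) →
             All (Agree (A ++ xs) c₀) cs → Tiling (A ++ xs) (c ∷ cs)
    absorb {c} {c₀} {A} {xs} {k} {cs} large len lencs lenxs dense strong agree
      with factor-list large (divides (suc k) len) dense
    ... | [] , ok , cov = ⊥-elim (ℕP.1+n≢0 {ℕ.pred (suc k * r)} (≡.trans (ℕP.suc-pred (suc k * r) {{ℕP.m*n≢0 (suc k) r}}) (≡.trans (≡.sym len) (≡.sym (↭P.↭-length cov)))))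
    ... | φ ∷ φs , ok ∷ _ , cov =
      Tiling-resp moved ↭-refl (Tiling-++ (Tiling-copy ok)
        (block-tiling {c₀} (subst (m₀ ≤_) (≡.sym lenB) large) (≡.trans lenB (≡.trans len (cong (_* r) (≡.sym lencs)))) denseB
          (All.map (λ ag u v u∈ v∈ → ag u v (B⊆ u∈) (B⊆ v∈)) agree)))
      where
      rest = concatMap tabulate φs
      B = rest ++ xs
      moved : tabulate φ ++ B ↭ A ++ xs
      moved = ↭-trans (↭-sym (↭P.++-assoc (tabulate φ) rest xs)) (↭P.++⁺ʳ xs cov)
      lenB : length B ≡ length A
      lenB = begin
        length (rest ++ xs)               ≡⟨ ListP.length-++ rest ⟩
        length rest + length xs           ≡⟨ cong (_+_ (length rest)) (≡.trans lenxs (≡.sym (ListP.length-tabulate φ))) ⟩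
        length rest + length (tabulate φ) ≡⟨ ℕP.+-comm (length rest) _ ⟩
        length (tabulate φ) + length rest ≡⟨ ListP.length-++ (tabulate φ) ⟨
        length (tabulate φ ++ rest)       ≡⟨ ↭P.↭-length cov ⟩
        length A ∎ where open ≡-Reasoning
      B⊆ : ∀ {v} → v ∈ B → v ∈ A ++ xs
      B⊆ v∈ = ↭P.∈-resp-↭ moved (∈-++⁺ʳ (tabulate φ) v∈)
      -- Removing the first copy costs a vertex at most `r` neighbours; the term `q * r` in the
      -- hypothesis was reserved for this, and the neighbours in `xs` can only help.
      denseB : Dense p q c₀ B
      denseB v v∈ = ℕP.+-cancelʳ-≤ (q * r) _ _ (begin
        p * length B + q * r                             ≡⟨ cong (λ z → p * z + q * r) lenB ⟩
        p * length A + q * r                             ≤⟨ strong v (B⊆ v∈) ⟩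
        q * # g A                                        ≡⟨ cong (q *_) (∑-↭ _ cov) ⟨
        q * # g (tabulate φ ++ rest)                     ≡⟨ cong (q *_) (∑-++ (tabulate φ) rest _) ⟩
        q * (# g (tabulate φ) + # g rest)                ≤⟨ ℕP.*-monoʳ-≤ q (ℕP.+-mono-≤ (ℕP.≤-trans (#≤length g (tabulate φ)) (ℕP.≤-reflexive (ListP.length-tabulate φ))) (ℕP.≤-trans (ℕP.m≤m+n _ _) (ℕP.≤-reflexive (≡.sym (∑-++ rest xs _))))) ⟩
        q * (r + # g B)                                  ≡⟨ ≡.trans (ℕP.*-distribˡ-+ q r _) (ℕP.+-comm (q * r) _) ⟩
        q * # g B + q * r ∎)
        where
        open ℕP.≤-Reasoning
        g = adj (G c₀) v

-- Each colour occurs in the list of placements, which yields its copy. Since the concatenated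
-- vertices have no repetition, a shared vertex forces the same placement and the same position.
transversal : ∀ {r n} (F : Graph r) (G : Fin n → Graph (r * n)) →
              Factors.Tiling F G (allFin (r * n)) (allFin n) → TransversalFactor F G
transversal {r} {n} F G (Factors.tiling ps ok cov col) =
  (λ i → proj₂ (pl i)) ,
  (λ i → subst (λ c → EdgePreserving F (G c) (proj₂ (pl i))) (≡.sym (colour i)) (All.lookup ok (pl∈ i))) ,
  λ i j a b e → separate i j a b e
  where
  open Factors F G
  find : ∀ i → ∃ λ p → p ∈ ps × i ≡ proj₁ p
  find i = ∈-map⁻ proj₁ (↭P.∈-resp-↭ (↭-sym col) (∈-allFin i))
  pl : Fin n → Placement
  pl i = proj₁ (find i)
  pl∈ : ∀ i → pl i ∈ ps
  pl∈ i = proj₁ (proj₂ (find i))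
  colour : ∀ i → i ≡ proj₁ (pl i)
  colour i = proj₂ (proj₂ (find i))
  uniq : Unique (concatMap verts ps)
  uniq = Unique-resp-↭ (↭-sym cov) (UniqueP.allFin⁺ (r * n))
  separate : ∀ i j a b → proj₂ (pl i) a ≡ proj₂ (pl j) b → i ≡ j × a ≡ b
  separate i j a b e = i≡j , Unique-tabulate⁻ {φ = proj₂ (pl i)} (Unique-concatMap⁻ verts uniq (pl∈ i))
      (≡.trans e (cong (λ c → proj₂ (pl c) b) (≡.sym i≡j)))
    where
    same : pl i ≡ pl j
    same = concatMap-position verts uniq (pl∈ i) (pl∈ j) (∈-tabulate⁺ {f = proj₂ (pl i)} a)
             (subst (_∈ verts (pl j)) (≡.sym e) (∈-tabulate⁺ {f = proj₂ (pl j)} b))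
    i≡j : i ≡ j
    i≡j = ≡.trans (colour i) (≡.trans (cong proj₁ same) (≡.sym (colour j)))

-- Selecting a family by a weight argument

∑-filterᵇ : ∀ (P : X → Bool) xs (f : X → ℕ) → ∑ (filterᵇ P xs) f ≡ ∑ xs (λ x → 𝟙 (P x) * f x)
∑-filterᵇ P []       f = ≡.refl
∑-filterᵇ P (x ∷ xs) f with P x
... | true  = cong₂ _+_ (≡.sym (ℕP.+-identityʳ (f x))) (∑-filterᵇ P xs f)
... | false = ∑-filterᵇ P xs f

∈-filterᵇ⁻ : ∀ (P : X → Bool) {x} xs → x ∈ filterᵇ P xs → x ∈ xs × P x ≡ true
∈-filterᵇ⁻ P (y ∷ xs) x∈ with P y in e
∈-filterᵇ⁻ P (y ∷ xs) (here ≡.refl) | true  = here ≡.refl , e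
∈-filterᵇ⁻ P (y ∷ xs) (there x∈)    | true  = let a , b = ∈-filterᵇ⁻ P xs x∈ in there a , b
∈-filterᵇ⁻ P (y ∷ xs) x∈            | false = let a , b = ∈-filterᵇ⁻ P xs x∈ in there a , b

𝟙-∧ : ∀ a b → 𝟙 (a ∧ b) ≡ 𝟙 b * 𝟙 a
𝟙-∧ true  true  = ≡.refl
𝟙-∧ true  false = ≡.refl
𝟙-∧ false true  = ≡.refl
𝟙-∧ false false = ≡.refl

#>0⇒∃ : ∀ (P : X → Bool) xs → 0 < # P xs → ∃ λ x → x ∈ xs × P x ≡ true
#>0⇒∃ P (x ∷ xs) lt with P x in e
... | true  = x , here ≡.refl , e
... | false = let y , y∈ , py = #>0⇒∃ P xs lt in y , there y∈ , py

-- Bernoulli's inequality 1 + k/x ≤ (1 + 1/x)^k, multiplied by x^(k + 1).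
bernoulli : ∀ x k → (x + k) * x ^ k ≤ x * suc x ^ k
bernoulli x zero    = ℕP.≤-reflexive (cong (_* 1) (ℕP.+-identityʳ x))
bernoulli x (suc k) = begin
  (x + suc k) * (x * x ^ k)           ≤⟨ ℕP.m≤m+n _ (k * x ^ k) ⟩
  (x + suc k) * (x * x ^ k) + k * x ^ k ≡⟨ e x k (x ^ k) ⟩
  suc x * ((x + k) * x ^ k)           ≤⟨ ℕP.*-monoʳ-≤ (suc x) (bernoulli x k) ⟩
  suc x * (x * suc x ^ k)             ≡⟨ e′ x (suc x ^ k) ⟩
  x * (suc x * suc x ^ k)             ∎
  where
  open ℕP.≤-Reasoning
  e : ∀ x k y → (x + suc k) * (x * y) + k * y ≡ suc x * ((x + k) * y)
  e = ℕR.solve-∀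
  e′ : ∀ x y → suc x * (x * y) ≡ x * (suc x * y)
  e′ = ℕR.solve-∀

*-^-distrib : ∀ k a b → (a * b) ^ k ≡ a ^ k * b ^ k
*-^-distrib zero    a b = ≡.refl
*-^-distrib (suc k) a b = ≡.trans (cong (a * b *_) (*-^-distrib k a b)) (e a b (a ^ k) (b ^ k))
  where
  e : ∀ a b c d → a * b * (c * d) ≡ a * c * (b * d)
  e = ℕR.solve-∀

-- By Bernoulli (1 + 1/x)^x is at least 2; raise this to the power `j`.
growth : ∀ x .{{_ : NonZero x}} j → 2 ^ j * x ^ (x * j) ≤ suc x ^ (x * j)
growth x j = begin
  2 ^ j * x ^ (x * j)     ≡⟨ cong (2 ^ j *_) (≡.sym (ℕP.^-*-assoc x x j)) ⟩
  2 ^ j * (x ^ x) ^ j     ≡⟨ *-^-distrib j 2 (x ^ x) ⟨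
  (2 * x ^ x) ^ j         ≤⟨ ℕP.^-monoˡ-≤ j (ℕP.*-cancelˡ-≤ x (ℕP.≤-trans (ℕP.≤-reflexive (e x (x ^ x))) (bernoulli x x))) ⟩
  (suc x ^ x) ^ j         ≡⟨ ℕP.^-*-assoc (suc x) x j ⟩
  suc x ^ (x * j)         ∎
  where
  open ℕP.≤-Reasoning
  e : ∀ x y → x * (2 * y) ≡ (x + x) * y
  e = ℕR.solve-∀

data Chain {E : Set} (ok : List E → E → Bool) : List E → Set where
  []  : Chain ok []
  _∷_ : ∀ {e es} → ok es e ≡ true → Chain ok es → Chain ok (e ∷ es)

-- Derandomised selection: candidates are chosen one at a time so as to minimise the total weight,
-- where the weight of a demand doubles whenever the chosen candidate does not serve it.
module Selection {D E : Set} (ds : List D) (es : List E) (serves : D → E → Bool)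
                 (ok : List E → E → Bool) (h′ g ℓ : ℕ) where
  private
    h x steps : ℕ
    h = suc h′
    -- `x` is 2 h - 1: a good choice multiplies the total weight by at most x / h = 2 - 1/h. The
    -- number of steps is a multiple of `x` so that `growth` applies.
    x = suc (h′ + h′)
    steps = x * (g + ℓ)

    weight : List E → D → ℕ
    weight []       d = 1
    weight (e ∷ fam) d = (if serves d e then 1 else 2) * weight fam d

    Φ : List E → ℕ
    Φ fam = ∑ ds (weight fam)

    Φ-step : ∀ e fam → Φ (e ∷ fam) + ∑ ds (λ d → weight fam d * 𝟙 (serves d e)) ≡ 2 * Φ fam
    Φ-step e fam = ≡.trans (≡.sym (∑-+ ds _ _)) (≡.trans (∑-cong ds λ d → split (serves d e) (weight fam d)) (∑-*ˡ ds 2 _))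
      where
      split : ∀ b w → (if b then 1 else 2) * w + w * 𝟙 b ≡ 2 * w
      split true  w = cong₂ _+_ (ℕP.*-identityˡ w) (≡.trans (ℕP.*-identityʳ w) (≡.sym (ℕP.*-identityˡ w)))
      split false w = ≡.trans (cong (_+_ (2 * w)) (ℕP.*-zeroʳ w)) (ℕP.+-identityʳ _)

    -- Every choice doubles exactly one of the two factors on the left.
    weight-count : ∀ fam d → weight fam d * 2 ^ # (serves d) fam ≡ 2 ^ length fam
    weight-count []        d = ≡.refl
    weight-count (e ∷ fam) d with serves d e
    ... | true  = ≡.trans (ar (weight fam d) (2 ^ # (serves d) fam)) (cong (2 *_) (weight-count fam d))
      where
      ar : ∀ a b → 1 * a * (2 * b) ≡ 2 * (a * b)
      ar = ℕR.solve-∀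
    ... | false = ≡.trans (ℕP.*-assoc 2 (weight fam d) _) (cong (2 *_) (weight-count fam d))

  module _ (nonempty : 0 < length es) {d₀ : D} (d₀∈ : d₀ ∈ ds)
           (hit : ∀ {fam} → Chain ok fam → length fam < steps → ∀ d → d ∈ ds →
                  length es ≤ h * # (λ e → serves d e ∧ ok fam e) es) where
    private
      -- Adding `e` doubles the total weight and then subtracts the weight of the demands that `e`
      -- serves. Each demand is served by at least a proportion 1 / h of the candidates, so on
      -- average over the admissible ones at least `Φ fam` / h is subtracted.
      step : ∀ {fam} → Chain ok fam → length fam < steps →
             ∃ λ e → ok fam e ≡ true × h * Φ (e ∷ fam) ≤ x * Φ fam
      step {fam} ch lt =
        let e , e∈ , le = ∑-pigeonhole oks (λ e → h * Φ (e ∷ fam) + Φ fam) (λ _ → 2 * h * Φ fam) oks>0 average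
        in e , proj₂ (∈-filterᵇ⁻ (ok fam) es e∈) , ℕP.+-cancelʳ-≤ (Φ fam) _ _ (ℕP.≤-trans le (ℕP.≤-reflexive (ar h′ (Φ fam))))
        where
        open ℕP.≤-Reasoning
        oks = filterᵇ (ok fam) es
        ar : ∀ h y → 2 * suc h * y ≡ suc (h + h) * y + y
        ar = ℕR.solve-∀
        served : ∀ d → ∑ oks (λ e → 𝟙 (serves d e)) ≡ # (λ e → serves d e ∧ ok fam e) es
        served d = ≡.trans (∑-filterᵇ (ok fam) es _) (∑-cong es λ e → ≡.sym (𝟙-∧ (serves d e) (ok fam e)))
        oks≤ : length oks ≤ length es
        oks≤ = ℕP.≤-trans (ℕP.≤-reflexive (length-filterᵇ (ok fam) es)) (#≤length (ok fam) es)
        oks>0 : 0 < length oks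
        oks>0 = ℕP.≰⇒> λ le → ℕP.<-irrefl ≡.refl (begin-strict
          0                                                <⟨ nonempty ⟩
          length es                                        ≤⟨ hit ch lt d₀ d₀∈ ⟩
          h * # (λ e → serves d₀ e ∧ ok fam e) es          ≡⟨ cong (h *_) (served d₀) ⟨
          h * # (serves d₀) oks                            ≤⟨ ℕP.*-monoʳ-≤ h (ℕP.≤-trans (#≤length (serves d₀) oks) le) ⟩
          h * 0                                            ≡⟨ ℕP.*-zeroʳ h ⟩
          0                                                ∎)
        gain : E → ℕ
        gain e = ∑ ds (λ d → weight fam d * 𝟙 (serves d e))
        average : ∑ oks (λ e → h * Φ (e ∷ fam) + Φ fam) ≤ ∑ oks (λ _ → 2 * h * Φ fam)
        average = begin
          ∑ oks (λ e → h * Φ (e ∷ fam) + Φ fam)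
            ≡⟨ ≡.trans (∑-+ oks _ _) (cong₂ _+_ (∑-*ˡ oks h _) (∑-const oks (Φ fam))) ⟩
          h * ∑ oks (λ e → Φ (e ∷ fam)) + length oks * Φ fam
            ≤⟨ ℕP.+-monoʳ-≤ (h * ∑ oks (λ e → Φ (e ∷ fam))) (begin
              length oks * Φ fam                          ≡⟨ ℕP.*-comm (length oks) (Φ fam) ⟩
              Φ fam * length oks                          ≡⟨ ∑-*ʳ ds (length oks) (weight fam) ⟨
              ∑ ds (λ d → weight fam d * length oks)      ≤⟨ ∑-mono-∈ ds (λ d d∈ → ℕP.*-monoʳ-≤ (weight fam d) (ℕP.≤-trans oks≤ (hit ch lt d d∈))) ⟩
              ∑ ds (λ d → weight fam d * (h * # (λ e → serves d e ∧ ok fam e) es))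
                ≡⟨ ∑-cong ds (λ d → ≡.trans (cong (λ z → weight fam d * (h * z)) (≡.sym (served d))) (ar′ (weight fam d) h (# (serves d) oks))) ⟩
              ∑ ds (λ d → h * (weight fam d * # (serves d) oks))
                ≡⟨ ∑-*ˡ ds h _ ⟩
              h * ∑ ds (λ d → weight fam d * # (serves d) oks)
                ≡⟨ cong (h *_) (≡.trans (∑-cong ds (λ d → ≡.sym (∑-*ˡ oks (weight fam d) _))) (∑-swap ds oks _)) ⟩
              h * ∑ oks (λ e → ∑ ds (λ d → weight fam d * 𝟙 (serves d e))) ∎) ⟩
          h * ∑ oks (λ e → Φ (e ∷ fam)) + h * ∑ oks (λ e → ∑ ds (λ d → weight fam d * 𝟙 (serves d e)))
            ≡⟨ ≡.trans (≡.sym (ℕP.*-distribˡ-+ h (∑ oks (λ e → Φ (e ∷ fam))) (∑ oks gain)))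
                      (cong (h *_) (≡.sym (∑-+ oks (λ e → Φ (e ∷ fam)) gain))) ⟩
          h * ∑ oks (λ e → Φ (e ∷ fam) + ∑ ds (λ d → weight fam d * 𝟙 (serves d e)))
            ≡⟨ cong (h *_) (∑-cong oks λ e → Φ-step e fam) ⟩
          h * ∑ oks (λ _ → 2 * Φ fam)             ≡⟨ ∑-*ˡ oks h _ ⟨
          ∑ oks (λ _ → h * (2 * Φ fam))           ≡⟨ ∑-cong oks (λ _ → ar″ h (Φ fam)) ⟩
          ∑ oks (λ _ → 2 * h * Φ fam)             ∎
          where
          ar′ : ∀ a b c → a * (b * c) ≡ b * (a * c)
          ar′ = ℕR.solve-∀
          ar″ : ∀ a b → a * (2 * b) ≡ 2 * a * b
          ar″ = ℕR.solve-∀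

      iterate : ∀ i → i ≤ steps →
                ∃ λ fam → Chain ok fam × length fam ≡ i × h ^ i * Φ fam ≤ x ^ i * length ds
      iterate zero    _  = [] , [] , ≡.refl , ℕP.≤-reflexive (cong (1 *_) (≡.sym (length-∑ ds)))
      iterate (suc i) lt =
        let fam , ch , len , le = iterate i (ℕP.<⇒≤ lt)
            e , oke , le′ = step ch (subst (_< steps) (≡.sym len) lt)
        in e ∷ fam , oke ∷ ch , cong suc len , (begin
          h * h ^ i * Φ (e ∷ fam)       ≡⟨ ar h (h ^ i) (Φ (e ∷ fam)) ⟩
          h ^ i * (h * Φ (e ∷ fam))     ≤⟨ ℕP.*-monoʳ-≤ (h ^ i) le′ ⟩
          h ^ i * (x * Φ fam)           ≡⟨ ar′ x (h ^ i) (Φ fam) ⟩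
          x * (h ^ i * Φ fam)           ≤⟨ ℕP.*-monoʳ-≤ x le ⟩
          x * (x ^ i * length ds)       ≡⟨ ℕP.*-assoc x (x ^ i) (length ds) ⟨
          x * x ^ i * length ds         ∎)
        where
        open ℕP.≤-Reasoning
        ar : ∀ a b c → a * b * c ≡ b * (a * c)
        ar = ℕR.solve-∀
        ar′ : ∀ a b c → b * (a * c) ≡ a * (b * c)
        ar′ = ℕR.solve-∀

    -- A demand served fewer than `g` times has weight above 2^(steps - g), but the total weight is
    -- at most (x / h)^steps times the number of demands. As 2 h = x + 1, this would give (1 +
    -- 1/x)^steps < 2^(g + ℓ), against `growth`.
    select : length ds < 2 ^ ℓ →
             ∃ λ fam → Chain ok fam × length fam ≡ steps × (∀ d → d ∈ ds → g ≤ # (serves d) fam)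
    select few with iterate steps ℕP.≤-refl
    ... | fam , ch , len , le = fam , ch , len , λ d d∈ → ℕP.≮⇒≥ λ lt → ℕP.<-irrefl ≡.refl (begin-strict
      2 ^ (g + ℓ) * x ^ steps                                  ≤⟨ growth x (g + ℓ) ⟩
      suc x ^ steps                                            ≡⟨ cong (_^ steps) (double h′) ⟩
      (2 * h) ^ steps                                          ≡⟨ *-^-distrib steps 2 h ⟩
      2 ^ steps * h ^ steps                                    ≡⟨ cong (λ z → 2 ^ z * h ^ steps) len ⟨
      2 ^ length fam * h ^ steps                               ≡⟨ cong (_* h ^ steps) (weight-count fam d) ⟨
      weight fam d * 2 ^ # (serves d) fam * h ^ steps          ≤⟨ ℕP.*-monoˡ-≤ (h ^ steps) (ℕP.*-mono-≤ (∈-∑-≤ (weight fam) d∈) (ℕP.^-monoʳ-≤ 2 (ℕP.<⇒≤ lt))) ⟩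
      Φ fam * 2 ^ g * h ^ steps                                ≡⟨ ar (Φ fam) (2 ^ g) (h ^ steps) ⟩
      2 ^ g * (h ^ steps * Φ fam)                              ≤⟨ ℕP.*-monoʳ-≤ (2 ^ g) le ⟩
      2 ^ g * (x ^ steps * length ds)                          <⟨ ℕP.*-monoʳ-< (2 ^ g) {{ℕP.m^n≢0 2 g}} (ℕP.*-monoʳ-< (x ^ steps) {{ℕP.m^n≢0 x steps}} few) ⟩
      2 ^ g * (x ^ steps * 2 ^ ℓ)                              ≡⟨ ar′ (2 ^ g) (x ^ steps) (2 ^ ℓ) ⟩
      2 ^ g * 2 ^ ℓ * x ^ steps                                ≡⟨ cong (_* x ^ steps) (≡.sym (ℕP.^-distribˡ-+-* 2 g ℓ)) ⟩
      2 ^ (g + ℓ) * x ^ steps                                  ∎)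
      where
      open ℕP.≤-Reasoning
      double : ∀ h → suc (suc (h + h)) ≡ 2 * suc h
      double = ℕR.solve-∀
      ar : ∀ a b c → a * b * c ≡ b * (c * a)
      ar = ℕR.solve-∀
      ar′ : ∀ a b c → a * (b * c) ≡ a * c * b
      ar′ = ℕR.solve-∀

-- Absorbing a list of demands

module Absorption {r N n : ℕ} (F : Graph r) (G : Fin n → Graph N) where
  open Factors F G

  absorb-all : ∀ {D E : Set} (serves : D → E → Bool)
    (A : E → List (Fin N)) (K : E → List (Fin n)) (xs : D → List (Fin N)) (c : D → Fin n) →
    (∀ {d e} → serves d e ≡ true → Tiling (A e ++ xs d) (c d ∷ K e)) →
    ∀ fam → All (λ e → Tiling (A e) (K e)) fam → ∀ ds → All (λ d → length ds ≤ # (serves d) fam) ds →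
    Tiling (concatMap A fam ++ concatMap xs ds) (concatMap K fam ++ List.map c ds)
  absorb-all serves A K xs c sound fam ok [] _ =
    Tiling-resp (↭-reflexive (≡.sym (ListP.++-identityʳ _))) (↭-reflexive (≡.sym (ListP.++-identityʳ _))) (base fam ok)
    where
    base : ∀ fam → All (λ e → Tiling (A e) (K e)) fam → Tiling (concatMap A fam) (concatMap K fam)
    base []        []       = Tiling-[]
    base (e ∷ fam) (t ∷ ts) = Tiling-++ t (base fam ts)
  absorb-all {E = E} serves A K xs c sound fam ok (d ∷ ds) (many ∷ manys) =
    let e , e∈ , se = #>0⇒∃ (serves d) fam (ℕP.≤-trans (s≤s z≤n) many)
        fam′ , p = ∈⇒↭∷ e∈
        fewer : ∀ {d} → suc (length ds) ≤ # (serves d) fam → length ds ≤ # (serves d) fam′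
        fewer {d} le = ℕP.≤-pred (ℕP.≤-trans le (ℕP.≤-trans (ℕP.≤-reflexive (∑-↭ (𝟙 ∘ serves d) p)) (ℕP.+-monoˡ-≤ _ (𝟙≤1 (serves d e)))))
        rec = absorb-all serves A K xs c sound fam′ (All.tail (↭P.All-resp-↭ p ok)) ds (All.map fewer manys)
    in Tiling-resp
         (↭-trans (exchange (A e) (xs d) (concatMap A fam′) (concatMap xs ds))
                  (↭P.++⁺ʳ (concatMap xs (d ∷ ds)) (↭-sym (concatMap-↭ A p))))
         (↭-trans (exchange (K e) (c d ∷ []) (concatMap K fam′) (List.map c ds))
                  (↭P.++⁺ʳ (List.map c (d ∷ ds)) (↭-sym (concatMap-↭ K p))))
         (Tiling-++ (Tiling-resp ↭-refl (↭P.++-comm (c d ∷ []) (K e)) (sound se)) rec)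
    where
    concatMap-↭ : ∀ {Y : Set} (h : E → List Y) {xs ys} → xs ↭ ys → concatMap h xs ↭ concatMap h ys
    concatMap-↭ h _↭_.refl          = ↭-refl
    concatMap-↭ h (_↭_.prep x p)    = ↭P.++⁺ˡ (h x) (concatMap-↭ h p)
    concatMap-↭ h (_↭_.swap x y p)  = ↭-trans (↭P.shifts (h x) (h y)) (↭P.++⁺ˡ (h y) (↭P.++⁺ˡ (h x) (concatMap-↭ h p)))
    concatMap-↭ h (_↭_.trans p q)   = ↭-trans (concatMap-↭ h p) (concatMap-↭ h q)
    exchange : ∀ {Y : Set} (a b c d : List Y) → (a ++ b) ++ (c ++ d) ↭ (a ++ c) ++ (b ++ d)
    exchange a b c d = ↭-trans (↭P.++-assoc a b (c ++ d))
      (↭-trans (↭P.++⁺ˡ a (↭P.shifts b c)) (↭-sym (↭P.++-assoc a c (b ++ d))))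

-- Boolean tests, popular answers and fresh tuples

∧-true⁻ : ∀ {a b} → a ∧ b ≡ true → a ≡ true × b ≡ true
∧-true⁻ {true} e = ≡.refl , e

∧-true⁺ : ∀ {a b} → a ≡ true → b ≡ true → a ∧ b ≡ true
∧-true⁺ ≡.refl e = e

all-true⁻ : ∀ (P : X → Bool) ys → all P ys ≡ true → ∀ {y} → y ∈ ys → P y ≡ true
all-true⁻ P (y ∷ ys) e (here ≡.refl) = proj₁ (∧-true⁻ e)
all-true⁻ P (y ∷ ys) e (there y∈)    = all-true⁻ P ys (proj₂ (∧-true⁻ {P y} e)) y∈

all-true⁺ : ∀ (P : X → Bool) ys → (∀ y → y ∈ ys → P y ≡ true) → all P ys ≡ true
all-true⁺ P []       h = ≡.refl
all-true⁺ P (y ∷ ys) h = ∧-true⁺ (h y (here ≡.refl)) (all-true⁺ P ys λ z z∈ → h z (there z∈))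

any-true⁺ : ∀ (P : X → Bool) ys {y} → y ∈ ys → P y ≡ true → any P ys ≡ true
any-true⁺ P (y ∷ ys) (here ≡.refl) e rewrite e = ≡.refl
any-true⁺ P (y ∷ ys) (there y∈)    e with P y
... | true  = ≡.refl
... | false = any-true⁺ P ys y∈ e

any-true⁻ : ∀ (P : X → Bool) ys → any P ys ≡ true → ∃ λ y → y ∈ ys × P y ≡ true
any-true⁻ P (y ∷ ys) e with P y in q
... | true  = y , here ≡.refl , q
... | false = let z , z∈ , pz = any-true⁻ P ys e in z , there z∈ , pz

none⁻ : ∀ (P : X → Bool) ys → not (any P ys) ≡ true → ∀ {y} → y ∈ ys → P y ≡ false
none⁻ P ys e {y} y∈ with P y in q
... | false = ≡.refl
... | true  with () ← ≡.trans (≡.sym (cong not (any-true⁺ P ys y∈ q))) e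

#-not : ∀ (P : X → Bool) xs → # P xs + # (not ∘ P) xs ≡ length xs
#-not P xs = ≡.trans (≡.sym (∑-+ xs (𝟙 ∘ P) (𝟙 ∘ not ∘ P))) (≡.trans (∑-cong xs (split ∘ P)) (≡.sym (length-∑ xs)))
  where
  split : ∀ b → 𝟙 b + 𝟙 (not b) ≡ 1
  split true  = ≡.refl
  split false = ≡.refl

#-mono : ∀ {P Q : X → Bool} xs → (∀ x → P x ≡ true → Q x ≡ true) → # P xs ≤ # Q xs
#-mono xs h = ∑-mono xs λ x → 𝟙-mono (h x)

#-split : ∀ (P Q : X → Bool) xs → # P xs ≤ # (λ x → P x ∧ Q x) xs + # (not ∘ Q) xs
#-split P Q xs = ℕP.≤-trans (∑-mono xs λ x → split (P x) (Q x)) (ℕP.≤-reflexive (∑-+ xs _ _))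
  where
  split : ∀ a b → 𝟙 a ≤ 𝟙 (a ∧ b) + 𝟙 (not b)
  split false b     = z≤n
  split true  true  = ℕP.≤-refl
  split true  false = ℕP.≤-refl

entries : ∀ {m} → Vec X m → List X
entries s = tabulate (lookup s)

length-entries : ∀ {m} (s : Vec X m) → length (entries s) ≡ m
length-entries s = ListP.length-tabulate (lookup s)

#-vecs-all : ∀ (R : X → Bool) xs k → # (λ K → all R (entries K)) (vecs xs k) ≡ # R xs ^ k
#-vecs-all R xs zero    = ≡.refl
#-vecs-all R xs (suc k) = begin
  # (λ K → all R (entries K)) (vecs xs (suc k)) ≡⟨ ∑-vecs xs k _ ⟩
  ∑ xs (λ x → ∑ (vecs xs k) (λ K → 𝟙 (R x ∧ all R (entries K))))
    ≡⟨ ∑-cong xs (λ x → ≡.trans (∑-cong (vecs xs k) λ K → ≡.trans (𝟙-∧ (R x) _) (ℕP.*-comm _ (𝟙 (R x))))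
                                (∑-*ˡ (vecs xs k) (𝟙 (R x)) _)) ⟩
  ∑ xs (λ x → 𝟙 (R x) * # (λ K → all R (entries K)) (vecs xs k))
    ≡⟨ ∑-*ʳ xs _ (𝟙 ∘ R) ⟩
  # R xs * # (λ K → all R (entries K)) (vecs xs k)
    ≡⟨ cong (# R xs *_) (#-vecs-all R xs k) ⟩
  # R xs * # R xs ^ k ∎ where open ≡-Reasoning

private
  _is_ : Bool → Bool → Bool
  a is true  = a
  a is false = not a

  is⇒≡ : ∀ a b → a is b ≡ true → a ≡ b
  is⇒≡ a     true  e = e
  is⇒≡ false false e = ≡.refl

majority : ∀ (t Q : X → Bool) xs → ∃ λ b → # Q xs ≤ 2 * # (λ x → Q x ∧ (t x is b)) xs
majority {X} t Q xs with ℕP.≤-total (# (λ x → Q x ∧ not (t x)) xs) (# (λ x → Q x ∧ t x) xs)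
... | inj₁ le = true , ℕP.≤-trans part (ℕP.+-monoʳ-≤ (# (λ x → Q x ∧ t x) xs) (ℕP.≤-trans le (ℕP.≤-reflexive (≡.sym (ℕP.+-identityʳ _)))))
  where
  part : # Q xs ≤ # (λ x → Q x ∧ t x) xs + # (λ x → Q x ∧ not (t x)) xs
  part = ℕP.≤-trans (∑-mono xs λ x → s (Q x) (t x)) (ℕP.≤-reflexive (∑-+ xs _ _))
    where
    s : ∀ a b → 𝟙 a ≤ 𝟙 (a ∧ b) + 𝟙 (a ∧ not b)
    s false b     = z≤n
    s true  true  = ℕP.≤-refl
    s true  false = ℕP.≤-refl
... | inj₂ le = false , ℕP.≤-trans part (ℕP.+-monoʳ-≤ (# (λ x → Q x ∧ not (t x)) xs) (ℕP.≤-trans le (ℕP.≤-reflexive (≡.sym (ℕP.+-identityʳ _)))))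
  where
  part : # Q xs ≤ # (λ x → Q x ∧ not (t x)) xs + # (λ x → Q x ∧ t x) xs
  part = ℕP.≤-trans (∑-mono xs λ x → s (Q x) (t x)) (ℕP.≤-reflexive (∑-+ xs _ _))
    where
    s : ∀ a b → 𝟙 a ≤ 𝟙 (a ∧ not b) + 𝟙 (a ∧ b)
    s false b     = z≤n
    s true  true  = ℕP.≤-refl
    s true  false = ℕP.≤-refl

-- Keep the more frequent answer to each test in turn; every test costs at most a factor of two.
popular : ∀ (tests : List (X → Bool)) (P : X → Bool) xs →
          ∃ λ Q → (∀ x → Q x ≡ true → P x ≡ true)
                × (∀ {t} → t ∈ tests → ∀ x y → Q x ≡ true → Q y ≡ true → t x ≡ t y)
                × # P xs ≤ 2 ^ length tests * # Q xs
popular []          P xs = P , (λ _ e → e) , (λ ()) , ℕP.≤-reflexive (≡.sym (ℕP.*-identityˡ _))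
popular (t ∷ tests) P xs with popular tests P xs
... | Q , Q⇒P , agree , le with majority t Q xs
... | b , le′ = (λ x → Q x ∧ (t x is b)) , (λ x e → Q⇒P x (proj₁ (∧-true⁻ e))) ,
    (λ { (here ≡.refl) x y ex ey → ≡.trans (value x ex) (≡.sym (value y ey))
       ; (there t∈)    x y ex ey → agree t∈ x y (proj₁ (∧-true⁻ ex)) (proj₁ (∧-true⁻ ey)) }) ,
    ℕP.≤-trans le (ℕP.≤-trans (ℕP.*-monoʳ-≤ (2 ^ length tests) le′) (ℕP.≤-reflexive (ar (2 ^ length tests) _)))
  where
  value : ∀ x → Q x ∧ (t x is b) ≡ true → t x ≡ b
  value x e = is⇒≡ (t x) b (proj₂ (∧-true⁻ {Q x} e))
  ar : ∀ T c → T * (2 * c) ≡ 2 * T * c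
  ar = ℕR.solve-∀

_∈ᵇ_ : ∀ {N} → Fin N → List (Fin N) → Bool
v ∈ᵇ us = any (λ u → does (v FinP.≟ u)) us

∉ᵇ⇒∉ : ∀ {N} {v : Fin N} us → not (v ∈ᵇ us) ≡ true → v ∈ us → ⊥
∉ᵇ⇒∉ {v = v} us e v∈ with () ← ≡.trans (≡.sym (none⁻ _ us e v∈)) (dec-true (v FinP.≟ v) ≡.refl)

#-∈ᵇ : ∀ {N} (us : List (Fin N)) → # (_∈ᵇ us) (allFin N) ≤ length us
#-∈ᵇ {N} us = begin
  # (_∈ᵇ us) (allFin N)                                        ≤⟨ ∑-mono (allFin N) (λ v → 𝟙-any (λ u → does (v FinP.≟ u)) us) ⟩
  ∑ (allFin N) (λ v → ∑ us (λ u → 𝟙 (does (v FinP.≟ u))))      ≡⟨ ∑-swap (allFin N) us _ ⟩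
  ∑ us (λ u → # (λ v → does (v FinP.≟ u)) (allFin N))          ≤⟨ ∑-mono us (λ u → single u (allFin N) (UniqueP.allFin⁺ N)) ⟩
  ∑ us (λ _ → 1)                                               ≡⟨ length-∑ us ⟨
  length us                                                    ∎
  where
  open ℕP.≤-Reasoning
  absent : ∀ u xs → All (λ x → u ≡ x → ⊥) xs → # (λ v → does (v FinP.≟ u)) xs ≤ 0
  absent u []       []       = z≤n
  absent u (x ∷ xs) (ne ∷ ns) with x FinP.≟ u
  ... | yes e = ⊥-elim (ne (≡.sym e))
  ... | no  _ = absent u xs ns
  single : ∀ u xs → Unique xs → # (λ v → does (v FinP.≟ u)) xs ≤ 1
  single u []       _        = z≤n
  single u (x ∷ xs) (x∉ ∷ un) with x FinP.≟ u
  ... | yes ≡.refl = s≤s (absent u xs x∉)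
  ... | no  _      = single u xs un

fresh : ∀ {N m} → List (Fin N) → Vec (Fin N) m → Bool
fresh used []      = true
fresh used (v ∷ s) = not (v ∈ᵇ used) ∧ fresh (v ∷ used) s

fresh-disjoint : ∀ {N m} used (s : Vec (Fin N) m) → fresh used s ≡ true → ∀ {v} → v ∈ entries s → v ∈ used → ⊥
fresh-disjoint used (x ∷ s) e (here ≡.refl) v∈ = ∉ᵇ⇒∉ used (proj₁ (∧-true⁻ e)) v∈
fresh-disjoint used (x ∷ s) e (there v∈s)   v∈ = fresh-disjoint (x ∷ used) s (proj₂ (∧-true⁻ {not (x ∈ᵇ used)} e)) v∈s (there v∈)

fresh-unique : ∀ {N m} used (s : Vec (Fin N) m) → fresh used s ≡ true → Unique (entries s)
fresh-unique used []      e = []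
fresh-unique used (x ∷ s) e = All.tabulate (λ y∈ → λ { ≡.refl → fresh-disjoint (x ∷ used) s e′ y∈ (here ≡.refl) }) ∷ fresh-unique (x ∷ used) s e′
  where e′ = proj₂ (∧-true⁻ {not (x ∈ᵇ used)} e)

-- A union bound: each of the `m` entries has to avoid at most `length used + m` vertices.
#-stale : ∀ {N} m (used : List (Fin N)) →
          N * # (not ∘ fresh used) (vecs (allFin N) m) ≤ m * (length used + m) * N ^ m
#-stale {N} zero    used = ℕP.≤-reflexive (ℕP.*-zeroʳ N)
#-stale {N} (suc m) used = begin
  N * # (not ∘ fresh used) (vecs (allFin N) (suc m))
    ≡⟨ cong (N *_) (∑-vecs (allFin N) m _) ⟩
  N * ∑ (allFin N) (λ v → ∑ (vecs (allFin N) m) (λ s → 𝟙 (not (fresh used (v ∷ s)))))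
    ≤⟨ ℕP.*-monoʳ-≤ N (∑-mono (allFin N) λ v → ℕP.≤-trans (∑-mono (vecs (allFin N) m) λ s → split (v ∈ᵇ used) (fresh (v ∷ used) s))
         (ℕP.≤-reflexive (∑-+ (vecs (allFin N) m) _ _))) ⟩
  N * ∑ (allFin N) (λ v → ∑ (vecs (allFin N) m) (λ _ → 𝟙 (v ∈ᵇ used)) + stale v)
    ≡⟨ cong (N *_) (≡.trans (∑-+ (allFin N) _ stale) (cong (_+ ∑ (allFin N) stale)
         (≡.trans (∑-cong (allFin N) λ v → ≡.trans (∑-const (vecs (allFin N) m) _) (cong (_* 𝟙 (v ∈ᵇ used)) lenv)) (∑-*ˡ (allFin N) (N ^ m) _)))) ⟩
  N * (N ^ m * # (_∈ᵇ used) (allFin N) + ∑ (allFin N) stale)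
    ≡⟨ ≡.trans (ℕP.*-distribˡ-+ N _ _) (cong (_+_ (N * (N ^ m * # (_∈ᵇ used) (allFin N)))) (≡.sym (∑-*ˡ (allFin N) N stale))) ⟩
  N * (N ^ m * # (_∈ᵇ used) (allFin N)) + ∑ (allFin N) (λ v → N * stale v)
    ≤⟨ ℕP.+-mono-≤ (ℕP.*-monoʳ-≤ N (ℕP.*-monoʳ-≤ (N ^ m) (#-∈ᵇ used))) (∑-mono (allFin N) λ v → #-stale m (v ∷ used)) ⟩
  N * (N ^ m * U) + ∑ (allFin N) (λ _ → m * (suc U + m) * N ^ m)
    ≡⟨ cong (_+_ (N * (N ^ m * U))) (≡.trans (∑-const (allFin N) _) (cong (_* (m * (suc U + m) * N ^ m)) (ListP.length-tabulate {n = N} (λ b → b)))) ⟩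
  N * (N ^ m * U) + N * (m * (suc U + m) * N ^ m)
    ≤⟨ ℕP.m≤m+n _ (N * N ^ m * suc m) ⟩
  N * (N ^ m * U) + N * (m * (suc U + m) * N ^ m) + N * N ^ m * suc m
    ≡⟨ ar N (N ^ m) U m ⟩
  suc m * (U + suc m) * (N * N ^ m) ∎
  where
  open ℕP.≤-Reasoning
  U = length used
  stale : Fin N → ℕ
  stale v = # (not ∘ fresh (v ∷ used)) (vecs (allFin N) m)
  lenv : length (vecs (allFin N) m) ≡ N ^ m
  lenv = ≡.trans (length-vecs (allFin N) m) (cong (_^ m) (ListP.length-tabulate {n = N} (λ b → b)))
  split : ∀ a b → 𝟙 (not (not a ∧ b)) ≤ 𝟙 a + 𝟙 (not b)
  split true  b = s≤s z≤n
  split false b = ℕP.≤-refl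
  ar : ∀ N P U m → N * (P * U) + N * (m * (suc U + m) * P) + N * P * suc m ≡ suc m * (U + suc m) * (N * P)
  ar = ℕR.solve-∀

low-false : ∀ {V : Set} q t σ (g : V → Bool) us → low q t σ g us ≡ false → t + σ ≤ q * # g us
low-false q t σ g us e = ℕP.≮⇒≥ λ lt → false≢true (≡.trans (≡.sym e) (T⇒≡ (ℕP.<⇒<ᵇ lt)))
  where
  false≢true : false ≡ true → ⊥
  false≢true ()

pairs : ∀ {X Y : Set} → List X → List Y → List (X × Y)
pairs xs ys = concatMap (λ x → List.map (x ,_) ys) xs

∑-pairs : ∀ {X Y : Set} (xs : List X) (ys : List Y) (f : X × Y → ℕ) →
          ∑ (pairs xs ys) f ≡ ∑ xs (λ x → ∑ ys (λ y → f (x , y)))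
∑-pairs xs ys f = ≡.trans (∑-concatMap _ xs f) (∑-cong xs λ x → ∑-map (x ,_) ys f)

length-pairs : ∀ {X Y : Set} (xs : List X) (ys : List Y) → length (pairs xs ys) ≡ length xs * length ys
length-pairs xs ys = ≡.trans (length-∑ (pairs xs ys)) (≡.trans (∑-pairs xs ys _)
  (≡.trans (∑-cong xs λ _ → ≡.sym (length-∑ ys)) (∑-const xs (length ys))))

∈-pairs : ∀ {X Y : Set} {xs : List X} {ys : List Y} {x y} → x ∈ xs → y ∈ ys → (x , y) ∈ pairs xs ys
∈-pairs x∈ y∈ = ∈-concatMap⁺ _ (Any.map (λ { ≡.refl → ∈-map⁺ _ y∈ }) x∈)

∈-vecs : ∀ {X : Set} (xs : List X) {m} (s : Vec X m) → (∀ {x} → x ∈ entries s → x ∈ xs) → s ∈ vecs xs m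
∈-vecs xs []      h = here ≡.refl
∈-vecs xs (x ∷ s) h = ∈-concatMap⁺ _ (Any.map (λ { ≡.refl → ∈-map⁺ (x ∷_) (∈-vecs xs s (λ z → h (there z))) }) (h (here ≡.refl)))

length-allFin : ∀ n → length (allFin n) ≡ n
length-allFin n = ListP.length-tabulate {n = n} (λ b → b)

module Colours {N n : ℕ} (G : Fin n → Graph N) where

  adjacencyTests : List (Fin N) → List (Fin n → Bool)
  adjacencyTests us = List.map (λ (u , v) c → adj (G c) u v) (pairs us us)

  length-tests : ∀ us → length (adjacencyTests us) ≡ length us * length us
  length-tests us = ≡.trans (ListP.length-map _ (pairs us us)) (length-pairs us us)

  popular-type : ∀ (P : Fin n → Bool) us cs →
    ∃ λ Q → (∀ c → Q c ≡ true → P c ≡ true)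
          × (∀ c c′ → Q c ≡ true → Q c′ ≡ true → ∀ u v → u ∈ us → v ∈ us → adj (G c) u v ≡ adj (G c′) u v)
          × # P cs ≤ 2 ^ (length us * length us) * # Q cs
  popular-type P us cs =
    let Q , Q⇒P , same , le = popular (adjacencyTests us) P cs
    in Q , Q⇒P ,
       (λ c c′ qc qc′ u v u∈ v∈ → same (∈-map⁺ (λ (u , v) c → adj (G c) u v) (∈-pairs u∈ v∈)) c c′ qc qc′) ,
       subst (λ z → # P cs ≤ 2 ^ z * # Q cs) (length-tests us) le

-- A positive proportion of all pairs are absorbers

module Absorbers {r N n : ℕ} (F : Graph r) (G : Fin n → Graph N) {p q m₀ : ℕ} (thr : Threshold F p q m₀) (k′ : ℕ)
                 {{r≢0 : NonZero r}} {{N≢0 : NonZero N}} {{n≢0 : NonZero n}}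
                 (degree : ∀ c v → suc p * N ≤ q * # (adj (G c) v) (allFin N)) where
  open Factors F G
  open Colours G

  k m : ℕ
  k = suc k′
  m = k * r

  Absorber Demand : Set
  Absorber = Vec (Fin N) m × Vec (Fin n) k
  Demand   = Vec (Fin N) r × Fin n

  block : Absorber → List (Fin N)
  block (s , K) = entries s

  palette : Absorber → List (Fin n)
  palette (s , K) = entries K

  -- Degrees are counted into `A` only, with a surplus `q * r` for the copy of F that the block
  -- gives away.
  strong : Fin n → List (Fin N) → List (Fin N) → Bool
  strong c us A = not (any (λ v → low q (p * m) (q * r) (adj (G c) v) A) us)

  agreeᵇ : List (Fin N) → Fin n → Fin n → Bool
  agreeᵇ us c c′ = all (λ u → all (λ v → does (adj (G c) u v BoolP.≟ adj (G c′) u v)) us) us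

  -- A condition that implies both tilings and is easy to count. The new colour `c` has to be dense
  -- on the block; the palette colours have to be dense at the vertices of `x` too, and the first of
  -- them represents their common graph on block and `x`. Distinctness of the entries is imposed
  -- later, by `clear`.
  serves : Demand → Absorber → Bool
  serves (x , c) (s , K) = strong c (entries s) (entries s)
    ∧ (all (λ c′ → strong c′ (entries s ++ entries x) (entries s)) (entries K)
    ∧ all (agreeᵇ (entries s ++ entries x) (lookup K Fin.zero)) (entries K))

  private
    strong⁻ : ∀ c us A → strong c us A ≡ true → ∀ v → v ∈ us → p * m + q * r ≤ q * # (adj (G c) v) A
    strong⁻ c us A e v v∈ = low-false q (p * m) (q * r) (adj (G c) v) A (none⁻ _ us e v∈)

    strong-dense : ∀ {c us} {s : Vec (Fin N) m} → (∀ {v} → v ∈ entries s → v ∈ us) → strong c us (entries s) ≡ true → Dense p q c (entries s)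
    strong-dense {c} {us} {s} sub e v v∈ =
      ℕP.≤-trans (ℕP.≤-reflexive (cong (p *_) (length-entries s))) (ℕP.≤-trans (ℕP.m≤m+n _ _) (strong⁻ c us (entries s) e v (sub v∈)))

    agree⁻ : ∀ {us c c′} → agreeᵇ us c c′ ≡ true → Agree us c c′
    agree⁻ {us} {c} {c′} e u v u∈ v∈ with adj (G c) u v BoolP.≟ adj (G c′) u v | all-true⁻ _ us (all-true⁻ _ us e u∈) v∈
    ... | yes eq | _ = eq

    agree⁺ : ∀ {us c c′} → Agree us c c′ → agreeᵇ us c c′ ≡ true
    agree⁺ {us} ag = all-true⁺ _ us λ u u∈ → all-true⁺ _ us λ v v∈ → dec-true (_ BoolP.≟ _) (ag u v u∈ v∈)

    serves⁻ : ∀ x c s K → serves (x , c) (s , K) ≡ true →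
              strong c (entries s) (entries s) ≡ true
              × (∀ {c′} → c′ ∈ entries K → strong c′ (entries s ++ entries x) (entries s) ≡ true)
              × (∀ {c′} → c′ ∈ entries K → Agree (entries s ++ entries x) (lookup K Fin.zero) c′)
    serves⁻ x c s K e =
      let e₁ , e₂₃ = ∧-true⁻ {strong c (entries s) (entries s)} e
          e₂ , e₃  = ∧-true⁻ {all (λ c′ → strong c′ (entries s ++ entries x) (entries s)) (entries K)} e₂₃
      in e₁ , all-true⁻ _ (entries K) e₂ , λ c∈ → agree⁻ (all-true⁻ _ (entries K) e₃ c∈)

  module _ (large : m₀ ≤ m) where
    private
      large′ : ∀ (s : Vec (Fin N) m) → m₀ ≤ length (entries s)
      large′ s = subst (m₀ ≤_) (≡.sym (length-entries s)) large

    serves-tiling : ∀ {d e} → serves d e ≡ true →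
                    Tiling (block e ++ entries (proj₁ d)) (proj₂ d ∷ palette e)
    serves-tiling {x , c} {s , K} e =
      let e₁ , e₂ , e₃ = serves⁻ x c s K e
      in absorb thr {c₀ = lookup K Fin.zero} (large′ s) (length-entries s) (length-entries K) (length-entries x)
           (strong-dense {c} {entries s} {s} (λ v∈ → v∈) e₁)
           (λ v v∈ → subst (λ z → p * z + q * r ≤ q * # (adj (G (lookup K Fin.zero)) v) (entries s)) (≡.sym (length-entries s))
                       (strong⁻ (lookup K Fin.zero) (entries s ++ entries x) (entries s) (e₂ (here ≡.refl)) v v∈))
           (All.tabulate λ c∈ → e₃ c∈)

    serves-block-tiling : ∀ {d e} → serves d e ≡ true → Tiling (block e) (palette e)
    serves-block-tiling {x , c} {s , K} e =
      let e₁ , e₂ , e₃ = serves⁻ x c s K e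
      in block-tiling thr {lookup K Fin.zero} (large′ s) (≡.trans (length-entries s) (cong (_* r) (≡.sym (length-entries K))))
           (strong-dense {lookup K Fin.zero} {entries s ++ entries x} {s} (∈-++⁺ˡ) (e₂ (here ≡.refl)))
           (All.tabulate λ c∈ u v u∈ v∈ → e₃ c∈ u v (∈-++⁺ˡ u∈) (∈-++⁺ˡ v∈))

  -- `Q / m` is the failure proportion from `concentration`; `types` bounds the number of graphs on
  -- the m + r positions of a block together with `x`. The proportion 1 / `h₀` arises as one half
  -- for the block times 1 / (2 types) for each of the `k` palette colours.
  Q types h₀ : ℕ
  Q = 48 * q ^ 4
  types = 2 ^ ((m + r) * (m + r))
  h₀ = 2 * (2 * types) ^ k

  absorbers : List Absorber
  absorbers = pairs (vecs (allFin N) m) (vecs (allFin n) k)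

  length-absorbers : length absorbers ≡ N ^ m * n ^ k
  length-absorbers = ≡.trans (length-pairs (vecs (allFin N) m) (vecs (allFin n) k))
    (cong₂ _*_ (≡.trans (length-vecs (allFin N) m) (cong (_^ m) (length-allFin N)))
               (≡.trans (length-vecs (allFin n) k) (cong (_^ k) (length-allFin n))))

  module _ (slack : 2 * (q * r + q) ≤ m) (spread : 2 * ((3 + 2 * r) * Q) ≤ m) where
    private
      instance
        m≢0 : NonZero m
        m≢0 = ℕP.m*n≢0 k r
        L≢0 : NonZero (length (allFin N))
        L≢0 = subst NonZero (≡.sym (length-allFin N)) N≢0
      open Tail {Fin N} {Fin N} (allFin N)

      self : Fin m → Fin N → Fin N
      self _ v = v

      sN : List (Vec (Fin N) m)
      sN = vecs (allFin N) m

      dense : ∀ c v → suc p * (length (allFin N) * m) ≤ q * mass (adj (G c) v) self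
      dense c v = begin
        suc p * (length (allFin N) * m)              ≡⟨ cong (λ z → suc p * (z * m)) (length-allFin N) ⟩
        suc p * (N * m)                              ≡⟨ ℕP.*-assoc (suc p) N m ⟨
        suc p * N * m                                ≤⟨ ℕP.*-monoˡ-≤ m (degree c v) ⟩
        q * # (adj (G c) v) (allFin N) * m           ≡⟨ ℕP.*-assoc q _ m ⟩
        q * (# (adj (G c) v) (allFin N) * m)         ≡⟨ cong (q *_) (ℕP.*-comm _ m) ⟩
        q * (m * # (adj (G c) v) (allFin N))         ≡⟨ cong (q *_) massEq ⟨
        q * mass (adj (G c) v) self                  ∎
        where
        open ℕP.≤-Reasoning
        massEq : mass (adj (G c) v) self ≡ m * # (adj (G c) v) (allFin N)
        massEq = ≡.trans (∑-tabulate {m = m} (λ _ → # (adj (G c) v) (allFin N)) (λ z → z))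
                   (≡.trans (∑-const (allFin m) _) (cong (_* # (adj (G c) v) (allFin N)) (length-allFin m)))

      Nᵐ : ∀ a → a * length (allFin N) ^ m ≡ a * N ^ m
      Nᵐ a = cong (λ z → a * z ^ m) (length-allFin N)

      weak-self : ∀ c → # (λ s → any (λ v → low q (p * m) (q * r) (adj (G c) v) (entries s)) (entries s)) sN * m ≤ Q * N ^ m
      weak-self c = ℕP.≤-trans (concentration (allFin N) p q (q * r) (adj (G c)) self (dense c) slack) (ℕP.≤-reflexive (Nᵐ Q))

      -- Here `v` is fixed before the sample is drawn, so `tail` applies directly; a factor `m` is
      -- given away to match `weak-self`.
      weak-at : ∀ c v → # (λ s → low q (p * m) (q * r) (adj (G c) v) (entries s)) sN * m ≤ Q * N ^ m
      weak-at c v = begin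
        # (λ s → low q (p * m) (q * r) (adj (G c) v) (entries s)) sN * m
          ≤⟨ ℕP.*-monoʳ-≤ (# (λ s → low q (p * m) (q * r) (adj (G c) v) (entries s)) sN) (ℕP.m≤m*n m m) ⟩
        # (λ s → low q (p * m) (q * r) (adj (G c) v) (entries s)) sN * (m * m)
          ≤⟨ tail p q (q * r) (adj (G c) v) self (dense c v) (ℕP.≤-trans (ℕP.*-monoʳ-≤ 2 (ℕP.m≤m+n (q * r) q)) slack) ⟩
        Q * length (allFin N) ^ m ≡⟨ Nᵐ Q ⟩
        Q * N ^ m ∎ where open ℕP.≤-Reasoning

      weak : ∀ c (x : Vec (Fin N) r) → # (λ s → not (strong c (entries s ++ entries x) (entries s))) sN * m ≤ suc r * (Q * N ^ m)
      weak c x = begin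
        # (λ s → not (strong c (entries s ++ entries x) (entries s))) sN * m
          ≤⟨ ℕP.*-monoˡ-≤ m (∑-mono sN λ s → ℕP.≤-trans (union s (entries s) (entries x)) (ℕP.+-monoʳ-≤ _ (𝟙-any (bad s) (entries x)))) ⟩
        ∑ sN (λ s → 𝟙 (any (bad s) (entries s)) + # (bad s) (entries x)) * m
          ≡⟨ cong (_* m) (≡.trans (∑-+ sN _ _) (cong (_+_ (# (λ s → any (bad s) (entries s)) sN)) (∑-swap sN (entries x) _))) ⟩
        (# (λ s → any (bad s) (entries s)) sN + ∑ (entries x) (λ v → # (λ s → bad s v) sN)) * m
          ≡⟨ ≡.trans (ℕP.*-distribʳ-+ m (# (λ s → any (bad s) (entries s)) sN) (∑ (entries x) (λ v → # (λ s → bad s v) sN))) (cong (_+_ (# (λ s → any (bad s) (entries s)) sN * m)) (≡.sym (∑-*ʳ (entries x) m _))) ⟩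
        # (λ s → any (bad s) (entries s)) sN * m + ∑ (entries x) (λ v → # (λ s → bad s v) sN * m)
          ≤⟨ ℕP.+-mono-≤ (weak-self c) (∑-mono (entries x) (weak-at c)) ⟩
        Q * N ^ m + ∑ (entries x) (λ _ → Q * N ^ m)
          ≡⟨ cong (_+_ (Q * N ^ m)) (≡.trans (∑-const (entries x) _) (cong (_* (Q * N ^ m)) (length-entries x))) ⟩
        suc r * (Q * N ^ m) ∎
        where
        open ℕP.≤-Reasoning
        bad : Vec (Fin N) m → Fin N → Bool
        bad s v = low q (p * m) (q * r) (adj (G c) v) (entries s)
        union : ∀ s us vs → 𝟙 (not (not (any (bad s) (us ++ vs)))) ≤ 𝟙 (any (bad s) us) + 𝟙 (any (bad s) vs)
        union s []       vs = ℕP.≤-reflexive (cong 𝟙 (BoolP.not-involutive _))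
        union s (u ∷ us) vs with bad s u
        ... | true  = s≤s z≤n
        ... | false = union s us vs

      missing : Vec (Fin N) r → Vec (Fin N) m → ℕ
      missing x s = # (λ c → not (strong c (entries s ++ entries x) (entries s))) (allFin n)

      -- Such a block leaves at least half of all colours as a pool for the palette.
      rich : Demand → Vec (Fin N) m → Bool
      rich (x , c) s = strong c (entries s) (entries s) ∧ (2 * missing x s ℕ.≤ᵇ n)

      -- Density of `c` itself fails for a proportion at most Q / m of the blocks. By `weak` and
      -- Markov's inequality, more than half of the colours fail for at most 2 (r + 1) Q / m of
      -- them. Together this is (3 + 2 r) Q / m, at most one half by `spread`.
      many-rich : ∀ d → N ^ m ≤ 2 * # (rich d) sN
      many-rich (x , c) = ℕP.+-cancelʳ-≤ (2 * poor) _ _ (begin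
          N ^ m + 2 * poor                  ≤⟨ ℕP.+-monoʳ-≤ (N ^ m) few-poor ⟩
          N ^ m + N ^ m                     ≡⟨ cong₂ _+_ tot tot ⟩
          (R + poor) + (R + poor)           ≡⟨ ar R poor ⟩
          2 * R + 2 * poor                  ∎)
        where
        open ℕP.≤-Reasoning
        d = (x , c)
        R = # (rich d) sN
        poor = # (not ∘ rich d) sN
        ar : ∀ a b → (a + b) + (a + b) ≡ 2 * a + 2 * b
        ar = ℕR.solve-∀
        tot : N ^ m ≡ R + poor
        tot = ≡.sym (≡.trans (#-not (rich d) sN) (≡.trans (length-vecs (allFin N) m) (cong (_^ m) (length-allFin N))))
        unbal : Vec (Fin N) m → Bool
        unbal s = not (2 * missing x s ℕ.≤ᵇ n)
        markov : # unbal sN * m ≤ 2 * (suc r * (Q * N ^ m))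
        markov = ℕP.*-cancelˡ-≤ n (begin
          n * (# unbal sN * m)                   ≡⟨ ℕP.*-assoc n _ m ⟨
          n * # unbal sN * m                     ≡⟨ cong (_* m) (∑-*ˡ sN n _) ⟨
          ∑ sN (λ s → n * 𝟙 (unbal s)) * m       ≤⟨ ℕP.*-monoˡ-≤ m (∑-mono sN λ s → pointwise s) ⟩
          ∑ sN (λ s → 2 * missing x s) * m       ≡⟨ cong (_* m) (≡.trans (∑-*ˡ sN 2 _) (cong (2 *_) (∑-swap sN (allFin n) _))) ⟩
          2 * ∑ (allFin n) failing * m
            ≡⟨ ≡.trans (ℕP.*-assoc 2 (∑ (allFin n) failing) m) (cong (2 *_) (≡.sym (∑-*ʳ (allFin n) m failing))) ⟩
          2 * ∑ (allFin n) (λ c → failing c * m)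
            ≤⟨ ℕP.*-monoʳ-≤ 2 (∑-mono (allFin n) λ c → weak c x) ⟩
          2 * ∑ (allFin n) (λ _ → suc r * (Q * N ^ m))   ≡⟨ cong (2 *_) (≡.trans (∑-const (allFin n) _) (cong (_* (suc r * (Q * N ^ m))) (length-allFin n))) ⟩
          2 * (n * (suc r * (Q * N ^ m)))                ≡⟨ ar′ n (suc r * (Q * N ^ m)) ⟩
          n * (2 * (suc r * (Q * N ^ m)))                ∎)
          where
          ar′ : ∀ a b → 2 * (a * b) ≡ a * (2 * b)
          ar′ = ℕR.solve-∀
          failing : Fin n → ℕ
          failing c = # (λ s → not (strong c (entries s ++ entries x) (entries s))) sN
          pointwise : ∀ s → n * 𝟙 (unbal s) ≤ 2 * missing x s
          pointwise s with 2 * missing x s ℕ.≤ᵇ n in e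
          ... | true  = ℕP.≤-trans (ℕP.≤-reflexive (ℕP.*-zeroʳ n)) z≤n
          ... | false = ℕP.≤-trans (ℕP.≤-reflexive (ℕP.*-identityʳ n)) (ℕP.<⇒≤ (ℕP.≰⇒> λ le → BoolP.not-¬ e (T⇒≡ (ℕP.≤⇒≤ᵇ le))))
        few-poor : 2 * poor ≤ N ^ m
        few-poor = ℕP.*-cancelʳ-≤ _ _ m (begin
          2 * poor * m ≤⟨ ℕP.*-monoˡ-≤ m (ℕP.*-monoʳ-≤ 2 (ℕP.≤-trans (∑-mono sN λ s → split (any (bad s) (entries s)) (2 * missing x s ℕ.≤ᵇ n)) (ℕP.≤-reflexive (∑-+ sN _ _)))) ⟩
          2 * (# (λ s → any (bad s) (entries s)) sN + # unbal sN) * m   ≡⟨ ar″ (# (λ s → any (bad s) (entries s)) sN) (# unbal sN) m ⟩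
          2 * (# (λ s → any (bad s) (entries s)) sN * m + # unbal sN * m) ≤⟨ ℕP.*-monoʳ-≤ 2 (ℕP.+-mono-≤ (weak-self c) markov) ⟩
          2 * (Q * N ^ m + 2 * (suc r * (Q * N ^ m)))                   ≡⟨ ar‴ Q (N ^ m) r ⟩
          2 * ((3 + 2 * r) * Q) * N ^ m                                 ≤⟨ ℕP.*-monoˡ-≤ (N ^ m) spread ⟩
          m * N ^ m                                                     ≡⟨ ℕP.*-comm m _ ⟩
          N ^ m * m ∎)
          where
          bad : Vec (Fin N) m → Fin N → Bool
          bad s v = low q (p * m) (q * r) (adj (G c) v) (entries s)
          split : ∀ a b → 𝟙 (not (not a ∧ b)) ≤ 𝟙 a + 𝟙 (not b)
          split true  b = s≤s z≤n
          split false b = ℕP.≤-refl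
          ar″ : ∀ a b m → 2 * (a + b) * m ≡ 2 * (a * m + b * m)
          ar″ = ℕR.solve-∀
          ar‴ : ∀ Q M r → 2 * (Q * M + 2 * (suc r * (Q * M))) ≡ 2 * ((3 + 2 * r) * Q) * M
          ar‴ = ℕR.solve-∀

      -- At least n / 2 colours are strong, and at least n / (2 types) of those induce the same
      -- graph on the block and `x`. Every `k`-tuple drawn from them is a valid palette.
      rich-serves : ∀ d s → rich d s ≡ true → n ^ k ≤ (2 * types) ^ k * # (λ K → serves d (s , K)) (vecs (allFin n) k)
      rich-serves (x , c) s e =
        let e₁ , e₂ = ∧-true⁻ {strong c (entries s) (entries s)} e
            us = entries s ++ entries x
            P : Fin n → Bool
            P c′ = strong c′ us (entries s)
            R , R⇒P , same , le = popular-type P us (allFin n)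
            lenus : length us ≡ m + r
            lenus = ≡.trans (ListP.length-++ (entries s)) (cong₂ _+_ (length-entries s) (length-entries x))
            half : n ≤ 2 * # P (allFin n)
            half = ℕP.+-cancelʳ-≤ (2 * missing x s) _ _ (begin
              n + 2 * missing x s               ≤⟨ ℕP.+-monoʳ-≤ n (ℕP.≤ᵇ⇒≤ _ _ (≡⇒T e₂)) ⟩
              n + n                             ≡⟨ cong₂ _+_ (tot P) (tot P) ⟩
              (# P (allFin n) + missing x s) + (# P (allFin n) + missing x s) ≡⟨ ar (# P (allFin n)) (missing x s) ⟩
              2 * # P (allFin n) + 2 * missing x s ∎)
        in begin
          n ^ k                                                      ≤⟨ ℕP.^-monoˡ-≤ k (ℕP.≤-trans half (ℕP.*-monoʳ-≤ 2 (subst (λ z → # P (allFin n) ≤ 2 ^ (z * z) * # R (allFin n)) lenus le))) ⟩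
          (2 * (types * # R (allFin n))) ^ k                         ≡⟨ cong (_^ k) (ℕP.*-assoc 2 types _) ⟨
          (2 * types * # R (allFin n)) ^ k                           ≡⟨ *-^-distrib k (2 * types) (# R (allFin n)) ⟩
          (2 * types) ^ k * # R (allFin n) ^ k                       ≡⟨ cong ((2 * types) ^ k *_) (#-vecs-all R (allFin n) k) ⟨
          (2 * types) ^ k * # (λ K → all R (entries K)) (vecs (allFin n) k)
            ≤⟨ ℕP.*-monoʳ-≤ ((2 * types) ^ k) (#-mono (vecs (allFin n) k) λ K eK →
                 ∧-true⁺ e₁ (∧-true⁺ (all-true⁺ _ (entries K) λ c′ c∈ → R⇒P c′ (all-true⁻ R (entries K) eK c∈))
                   (all-true⁺ _ (entries K) λ c′ c∈ → agree⁺ {us} {lookup K Fin.zero} {c′} (same (lookup K Fin.zero) c′ (all-true⁻ R (entries K) eK (∈-tabulate⁺ {f = lookup K} Fin.zero)) (all-true⁻ R (entries K) eK c∈))))) ⟩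
          (2 * types) ^ k * # (λ K → serves (x , c) (s , K)) (vecs (allFin n) k) ∎
        where
        open ℕP.≤-Reasoning
        tot : ∀ (P : Fin n → Bool) → n ≡ # P (allFin n) + # (not ∘ P) (allFin n)
        tot P = ≡.sym (≡.trans (#-not P (allFin n)) (length-allFin n))
        ar : ∀ a b → (a + b) + (a + b) ≡ 2 * a + 2 * b
        ar = ℕR.solve-∀

    many-serve : ∀ d → length absorbers ≤ h₀ * # (serves d) absorbers
    many-serve d = begin
      length absorbers                                  ≡⟨ length-absorbers ⟩
      N ^ m * n ^ k                                     ≤⟨ ℕP.*-monoˡ-≤ (n ^ k) (many-rich d) ⟩
      2 * # (rich d) sN * n ^ k                         ≡⟨ ≡.trans (ℕP.*-assoc 2 (# (rich d) sN) (n ^ k)) (cong (2 *_) (≡.sym (∑-*ʳ sN (n ^ k) (𝟙 ∘ rich d)))) ⟩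
      2 * ∑ sN (λ s → 𝟙 (rich d s) * n ^ k)             ≤⟨ ℕP.*-monoʳ-≤ 2 (∑-mono sN pointwise) ⟩
      2 * ∑ sN (λ s → (2 * types) ^ k * S s)            ≡⟨ cong (2 *_) (∑-*ˡ sN ((2 * types) ^ k) S) ⟩
      2 * ((2 * types) ^ k * ∑ sN S)                    ≡⟨ ℕP.*-assoc 2 ((2 * types) ^ k) (∑ sN S) ⟨
      h₀ * ∑ sN S                                       ≡⟨ cong (h₀ *_) (∑-pairs sN (vecs (allFin n) k) _) ⟨
      h₀ * # (serves d) absorbers                       ∎
      where
      open ℕP.≤-Reasoning
      S : Vec (Fin N) m → ℕ
      S s = # (λ K → serves d (s , K)) (vecs (allFin n) k)
      pointwise : ∀ s → 𝟙 (rich d s) * n ^ k ≤ (2 * types) ^ k * S s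
      pointwise s with rich d s in e
      ... | true  = ℕP.≤-trans (ℕP.≤-reflexive (ℕP.*-identityˡ _)) (rich-serves d s e)
      ... | false = z≤n

-- A disjoint family serving every demand often

module Family {r N n : ℕ} (F : Graph r) (G : Fin n → Graph N) {p q m₀ : ℕ} (thr : Threshold F p q m₀) (k′ : ℕ)
              {{r≢0 : NonZero r}} {{N≢0 : NonZero N}} {{n≢0 : NonZero n}}
              (degree : ∀ c v → suc p * N ≤ q * # (adj (G c) v) (allFin N)) where
  open Factors F G
  open Absorbers F G thr k′ degree public

  -- The leftover is unknown while the family is chosen, so all tuples are demands. Their number is
  -- polynomial in `n`, which the weight argument tolerates because ℓ will be linear in `n`.
  demands : List Demand
  demands = pairs (vecs (allFin N) r) (allFin n)

  ∈-demands : ∀ d → d ∈ demands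
  ∈-demands (x , c) = ∈-pairs (∈-vecs (allFin N) x (λ _ → ∈-allFin _)) (∈-allFin c)

  length-demands : length demands ≡ N ^ r * n
  length-demands = ≡.trans (length-pairs (vecs (allFin N) r) (allFin n))
    (cong₂ _*_ (≡.trans (length-vecs (allFin N) r) (cong (_^ r) (length-allFin N))) (length-allFin n))

  clear : List Absorber → Absorber → Bool
  clear fam (s , K) = fresh (concatMap block fam) s ∧ fresh (concatMap palette fam) K

  ok : List Absorber → Absorber → Bool
  ok fam e = clear fam e ∧ any (λ d → serves d e) demands

  private
    length-used : ∀ {X : Set} w (h : Absorber → List X) → (∀ e → length (h e) ≡ w) → ∀ fam → length (concatMap h fam) ≡ length fam * w
    length-used w h len []        = ≡.refl
    length-used w h len (e ∷ fam) = ≡.trans (ListP.length-++ (h e)) (cong₂ _+_ (len e) (length-used w h len fam))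

  length-blocks : ∀ fam → length (concatMap block fam) ≡ length fam * m
  length-blocks = length-used m block (λ (s , K) → length-entries s)

  length-palettes : ∀ fam → length (concatMap palette fam) ≡ length fam * k
  length-palettes = length-used k palette (λ (s , K) → length-entries K)

  #-unclear : n ≤ N → ∀ fam →
              n * # (not ∘ clear fam) absorbers ≤ suc (length fam) * (m * m + k * k) * length absorbers
  #-unclear n≤N fam = begin
    n * # (not ∘ clear fam) absorbers
      ≡⟨ cong (n *_) (∑-pairs sN sK _) ⟩
    n * ∑ sN (λ s → ∑ sK (λ K → 𝟙 (not (clear fam (s , K)))))
      ≤⟨ ℕP.*-monoʳ-≤ n (∑-mono sN λ s → ∑-mono sK λ K → split (fresh UV s) (fresh UC K)) ⟩
    n * ∑ sN (λ s → ∑ sK (λ K → 𝟙 (not (fresh UV s)) + 𝟙 (not (fresh UC K))))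
      ≡⟨ cong (n *_) (≡.trans (∑-cong sN λ s → ≡.trans (∑-+ sK _ _) (cong (_+ staleC) (∑-const sK _)))
                      (≡.trans (∑-+ sN _ _) (cong₂ _+_ (∑-*ˡ sN (length sK) _) (∑-const sN staleC)))) ⟩
    n * (length sK * staleV + length sN * staleC)
      ≡⟨ ar n (length sK) staleV (length sN) staleC ⟩
    length sK * (n * staleV) + length sN * (n * staleC)
      ≤⟨ ℕP.+-mono-≤ (ℕP.*-monoʳ-≤ (length sK) (ℕP.≤-trans (ℕP.*-monoˡ-≤ staleV n≤N) (#-stale m UV)))
                     (ℕP.*-monoʳ-≤ (length sN) (#-stale k UC)) ⟩
    length sK * (m * (length UV + m) * N ^ m) + length sN * (k * (length UC + k) * n ^ k)
      ≡⟨ cong₂ _+_ (cong₂ (λ a b → length sK * (m * (a + m) * b)) (length-blocks fam) (≡.sym lenN))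
                   (cong₂ (λ a b → length sN * (k * (a + k) * b)) (length-palettes fam) (≡.sym lenK)) ⟩
    length sK * (m * (length fam * m + m) * length sN) + length sN * (k * (length fam * k + k) * length sK)
      ≡⟨ ar′ (length sK) (length sN) m k (length fam) ⟩
    suc (length fam) * (m * m + k * k) * (length sN * length sK)
      ≡⟨ cong (suc (length fam) * (m * m + k * k) *_) (length-pairs sN sK) ⟨
    suc (length fam) * (m * m + k * k) * length absorbers ∎
    where
    open ℕP.≤-Reasoning
    sN = vecs (allFin N) m
    sK = vecs (allFin n) k
    UV = concatMap block fam
    UC = concatMap palette fam
    staleV = # (not ∘ fresh UV) sN
    staleC = # (not ∘ fresh UC) sK
    lenN : length sN ≡ N ^ m
    lenN = ≡.trans (length-vecs (allFin N) m) (cong (_^ m) (length-allFin N))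
    lenK : length sK ≡ n ^ k
    lenK = ≡.trans (length-vecs (allFin n) k) (cong (_^ k) (length-allFin n))
    split : ∀ a b → 𝟙 (not (a ∧ b)) ≤ 𝟙 (not a) + 𝟙 (not b)
    split true  b = ℕP.≤-refl
    split false b = s≤s z≤n
    ar : ∀ n a b c d → n * (a * b + c * d) ≡ a * (n * b) + c * (n * d)
    ar = ℕR.solve-∀
    ar′ : ∀ a b m k f → a * (m * (f * m + m) * b) + b * (k * (f * k + k) * a) ≡ suc f * (m * m + k * k) * (b * a)
    ar′ = ℕR.solve-∀

  module _ (large : m₀ ≤ m) (slack : 2 * (q * r + q) ≤ m) (spread : 2 * ((3 + 2 * r) * Q) ≤ m) (n≤N : n ≤ N) where

    -- A proportion 1 / `h₀` of all absorbers serves `d`, and `room` keeps those meeting the family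
    -- below half of that.
    many-ok : ∀ {fam B} → length fam < B → 2 * h₀ * (B * (m * m + k * k)) ≤ n →
              ∀ d → length absorbers ≤ 2 * h₀ * # (λ e → serves d e ∧ ok fam e) absorbers
    many-ok {fam} {B} lt room d = ℕP.+-cancelʳ-≤ (length absorbers) _ _ (begin
      L + L                                         ≤⟨ ℕP.+-mono-≤ (many-serve slack spread d) (many-serve slack spread d) ⟩
      h₀ * S + h₀ * S                               ≡⟨ ar h₀ S ⟩
      2 * h₀ * S                                    ≤⟨ ℕP.*-monoʳ-≤ (2 * h₀) (#-split (serves d) (clear fam) absorbers) ⟩
      2 * h₀ * (# (λ e → serves d e ∧ clear fam e) absorbers + U)
        ≡⟨ ℕP.*-distribˡ-+ (2 * h₀) (# (λ e → serves d e ∧ clear fam e) absorbers) U ⟩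
      2 * h₀ * # (λ e → serves d e ∧ clear fam e) absorbers + 2 * h₀ * U
        ≤⟨ ℕP.+-mono-≤ (ℕP.*-monoʳ-≤ (2 * h₀) (#-mono absorbers useful)) few ⟩
      2 * h₀ * # (λ e → serves d e ∧ ok fam e) absorbers + L ∎)
      where
      open ℕP.≤-Reasoning
      L = length absorbers
      S = # (serves d) absorbers
      U = # (not ∘ clear fam) absorbers
      ar : ∀ a b → a * b + a * b ≡ 2 * a * b
      ar = ℕR.solve-∀
      useful : ∀ e → serves d e ∧ clear fam e ≡ true → serves d e ∧ ok fam e ≡ true
      useful e t = let s , c = ∧-true⁻ {serves d e} t in
        ∧-true⁺ s (∧-true⁺ c (any-true⁺ (λ d → serves d e) demands (∈-demands d) s))
      few : 2 * h₀ * U ≤ L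
      few = ℕP.*-cancelˡ-≤ n (begin
        n * (2 * h₀ * U)                                         ≡⟨ ar′ n (2 * h₀) U ⟩
        2 * h₀ * (n * U)                                         ≤⟨ ℕP.*-monoʳ-≤ (2 * h₀) (#-unclear n≤N fam) ⟩
        2 * h₀ * (suc (length fam) * (m * m + k * k) * L)        ≤⟨ ℕP.*-monoʳ-≤ (2 * h₀) (ℕP.*-monoˡ-≤ L (ℕP.*-monoˡ-≤ (m * m + k * k) lt)) ⟩
        2 * h₀ * (B * (m * m + k * k) * L)                       ≡⟨ ℕP.*-assoc (2 * h₀) (B * (m * m + k * k)) L ⟨
        2 * h₀ * (B * (m * m + k * k)) * L                       ≤⟨ ℕP.*-monoˡ-≤ L room ⟩
        n * L ∎)
        where
        ar′ : ∀ a b c → a * (b * c) ≡ b * (a * c)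
        ar′ = ℕR.solve-∀

    private
      h′ : ℕ
      h′ = ℕ.pred (2 * h₀)
      instance
        h₀≢0 : NonZero h₀
        h₀≢0 = ℕP.m*n≢0 2 ((2 * types) ^ k) {{_}} {{ℕP.m^n≢0 (2 * types) k {{ℕP.m*n≢0 2 types {{_}} {{ℕP.m^n≢0 2 ((m + r) * (m + r))}}}}}}
      h≡ : suc h′ ≡ 2 * h₀
      h≡ = ℕP.suc-pred (2 * h₀) {{ℕP.m*n≢0 2 h₀}}

    size : ℕ → ℕ → ℕ
    size g ℓ = suc (h′ + h′) * (g + ℓ)

    size-≤ : ∀ g ℓ → size g ℓ ≤ 4 * h₀ * (g + ℓ)
    size-≤ g ℓ = ℕP.*-monoˡ-≤ (g + ℓ) (ℕP.≤-trans (ℕP.n≤1+n _) (ℕP.≤-reflexive (≡.trans (ar h′) (≡.trans (cong (2 *_) h≡) (≡.sym (ℕP.*-assoc 2 2 h₀))))))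
      where
      ar : ∀ h → suc (suc (h + h)) ≡ 2 * suc h
      ar = ℕR.solve-∀

    chain-tilings : ∀ {fam} → Chain ok fam → All (λ e → Tiling (block e) (palette e)) fam
    chain-tilings []               = []
    chain-tilings (_∷_ {e} {fam} o ch) =
      let d , _ , s = any-true⁻ (λ d → serves d e) demands (proj₂ (∧-true⁻ {clear fam e} o))
      in serves-block-tiling large {d} {e} s ∷ chain-tilings ch

    chain-unique : ∀ {fam} → Chain ok fam → Unique (concatMap block fam) × Unique (concatMap palette fam)
    chain-unique []                              = [] , []
    chain-unique (_∷_ {s , K} {fam} o ch) =
      let u , u′ = chain-unique ch
          c , c′ = ∧-true⁻ {fresh (concatMap block fam) s} (proj₁ (∧-true⁻ {clear fam (s , K)} o))
      in UniqueP.++⁺ (fresh-unique _ s c) u (λ (a , b) → fresh-disjoint _ s c a b) ,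
         UniqueP.++⁺ (fresh-unique _ K c′) u′ (λ (a , b) → fresh-disjoint _ K c′ a b)

    absorbing-family : ∀ g ℓ → N ^ r * n < 2 ^ ℓ → 2 * h₀ * (size g ℓ * (m * m + k * k)) ≤ n →
      ∃ λ fam → length fam ≡ size g ℓ × All (λ e → Tiling (block e) (palette e)) fam
              × (∃ λ V → allFin N ↭ concatMap block fam ++ V)
              × (∃ λ C → allFin n ↭ concatMap palette fam ++ C)
              × (∀ d → g ≤ # (serves d) fam)
    absorbing-family g ℓ few room =
      let fam , ch , len , enough = Selection.select demands absorbers serves ok h′ g ℓ
            (subst (0 <_) (≡.sym length-absorbers) (ℕ.>-nonZero⁻¹ _ {{ℕP.m*n≢0 (N ^ m) (n ^ k) {{ℕP.m^n≢0 N m}} {{ℕP.m^n≢0 n k}}}}))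
            (∈-demands d₀)
            (λ {fam} _ lt d _ → subst (λ z → length absorbers ≤ z * # (λ e → serves d e ∧ ok fam e) absorbers) (≡.sym h≡) (many-ok {fam} lt room d))
            (subst (_< 2 ^ ℓ) (≡.sym length-demands) few)
          u , u′ = chain-unique ch
      in fam , len , chain-tilings ch , complement u (λ _ → ∈-allFin _) , complement u′ (λ _ → ∈-allFin _) , λ d → enough d (∈-demands d)
      where
      d₀ : Demand
      d₀ = Vec.replicate r (Fin.fromℕ< (ℕ.>-nonZero⁻¹ N)) , Fin.fromℕ< (ℕ.>-nonZero⁻¹ n)

-- Rotated grids and the greedy cover

full-list : ∀ {c} {xs : List (Fin c)} → Unique xs → length xs ≡ c → xs ↭ allFin c
full-list {c} {xs} u len with complement u (λ {z} _ → ∈-allFin z)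
... | []     , p = ↭-sym (↭-trans p (↭-reflexive (ListP.++-identityʳ xs)))
... | z ∷ zs , p = ⊥-elim (ℕP.m≢1+m+n c (begin
  c                              ≡⟨ length-allFin c ⟨
  length (allFin c)              ≡⟨ ↭P.↭-length p ⟩
  length (xs ++ z ∷ zs)          ≡⟨ ListP.length-++ xs ⟩
  length xs + suc (length zs)    ≡⟨ cong (_+ suc (length zs)) len ⟩
  c + suc (length zs)            ≡⟨ ℕP.+-suc c _ ⟩
  suc (c + length zs)            ∎))
  where open ≡-Reasoning

enumerate-↭ : ∀ {a b c} (f : Fin a → Fin b → Fin c) → a * b ≡ c →
              (∀ i i′ j j′ → f i j ≡ f i′ j′ → i ≡ i′ × j ≡ j′) →
              concat (tabulate λ i → tabulate (f i)) ↭ allFin c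
enumerate-↭ {a} {b} f ab≡c inj = full-list
  (UniqueP.concat⁺ (AllP.tabulate⁺ λ i → UniqueP.tabulate⁺ λ e → proj₂ (inj i i _ _ e))
    (AllPairsP.tabulate⁺ λ {i} {i′} i≢i′ {v} (v∈ , v∈′) →
      let j , e = ∈-tabulate⁻ v∈ ; j′ , e′ = ∈-tabulate⁻ v∈′ in i≢i′ (proj₁ (inj i i′ j j′ (≡.trans (≡.sym e) e′)))))
  (≡.trans (len f) ab≡c)
  where
  len : ∀ {a b c} (f : Fin a → Fin b → Fin c) → length (concat (tabulate λ i → tabulate (f i))) ≡ a * b
  len {zero}  f = ≡.refl
  len {suc a} f = ≡.trans (ListP.length-++ (tabulate (f Fin.zero))) (cong₂ _+_ (ListP.length-tabulate (f Fin.zero)) (len (f ∘ Fin.suc)))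

rotate : ∀ {M} → Fin M → Fin M → Fin M
rotate {suc M} j t = (toℕ t + toℕ j) mod suc M

rotate-injective : ∀ {M} (j : Fin M) {t t′} → rotate j t ≡ rotate j t′ → t ≡ t′
rotate-injective {suc M} j {t} {t′} e = FinP.toℕ-injective (≡.trans (≡.sym (undo t)) (≡.trans (cong (λ z → (z + j′ % suc M) % suc M) residues) (undo t′)))
  where
  j′ = suc M ∸ toℕ j
  residues : (toℕ t + toℕ j) % suc M ≡ (toℕ t′ + toℕ j) % suc M
  residues = ≡.trans (≡.sym (FinP.toℕ-fromℕ< _)) (≡.trans (cong toℕ e) (FinP.toℕ-fromℕ< _))
  undo : ∀ (t : Fin (suc M)) → ((toℕ t + toℕ j) % suc M + j′ % suc M) % suc M ≡ toℕ t
  undo t = begin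
    ((toℕ t + toℕ j) % suc M + j′ % suc M) % suc M ≡⟨ %-distribˡ-+ (toℕ t + toℕ j) j′ (suc M) ⟨
    (toℕ t + toℕ j + j′) % suc M                   ≡⟨ cong (_% suc M) (≡.trans (ℕP.+-assoc (toℕ t) (toℕ j) j′) (cong (_+_ (toℕ t)) (ℕP.m+[n∸m]≡n (ℕP.<⇒≤ (FinP.toℕ<n j))))) ⟩
    (toℕ t + suc M) % suc M                        ≡⟨ [m+n]%n≡m%n (toℕ t) (suc M) ⟩
    toℕ t % suc M                                  ≡⟨ m<n⇒m%n≡m (FinP.toℕ<n t) ⟩
    toℕ t ∎ where open ≡-Reasoning

rotate-comm : ∀ {M} (j t : Fin M) → rotate j t ≡ rotate t j
rotate-comm {suc M} j t = cong (_mod suc M) (ℕP.+-comm (toℕ t) (toℕ j))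

-- A permutation of the sample space, applied in every coordinate, preserves the uniform
-- distribution. Hence all rows of the grid have the same average number of sparse colours.
∑-vecs-map : ∀ {X : Set} (ρ : X → X) xs → List.map ρ xs ↭ xs → ∀ m (f : Vec X m → ℕ) →
             ∑ (vecs xs m) (f ∘ Vec.map ρ) ≡ ∑ (vecs xs m) f
∑-vecs-map ρ xs perm zero    f = ≡.refl
∑-vecs-map ρ xs perm (suc m) f = begin
  ∑ (vecs xs (suc m)) (f ∘ Vec.map ρ)                          ≡⟨ ∑-vecs xs m _ ⟩
  ∑ xs (λ x → ∑ (vecs xs m) (λ s → f (ρ x ∷ Vec.map ρ s)))     ≡⟨ ∑-cong xs (λ x → ∑-vecs-map ρ xs perm m (λ s → f (ρ x ∷ s))) ⟩
  ∑ xs (λ x → ∑ (vecs xs m) (λ s → f (ρ x ∷ s)))               ≡⟨ ∑-map ρ xs _ ⟨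
  ∑ (List.map ρ xs) (λ x → ∑ (vecs xs m) (λ s → f (x ∷ s)))    ≡⟨ ∑-↭ _ perm ⟩
  ∑ xs (λ x → ∑ (vecs xs m) (λ s → f (x ∷ s)))                 ≡⟨ ∑-vecs xs m f ⟨
  ∑ (vecs xs (suc m)) f ∎ where open ≡-Reasoning

filterᵇ-↭ : ∀ {X : Set} (P : X → Bool) xs → xs ↭ filterᵇ P xs ++ filterᵇ (not ∘ P) xs
filterᵇ-↭ P []       = ↭-refl
filterᵇ-↭ P (x ∷ xs) with P x
... | true  = ↭-prep x (filterᵇ-↭ P xs)
... | false = ↭-trans (↭-prep x (filterᵇ-↭ P xs)) (↭-sym (↭P.shift x (filterᵇ P xs) (filterᵇ (not ∘ P) xs)))

module Cover {r N n : ℕ} (F : Graph r) (G : Fin n → Graph N) {p q m₀ : ℕ} (thr : Threshold F p q m₀) (k′ : ℕ)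
             {{r≢0 : NonZero r}} where
  open Factors F G
  open Colours G

  k m Q types : ℕ
  k = suc k′
  m = k * r
  Q = 48 * q ^ 4
  types = 2 ^ (m * m)

  sparse : Fin n → List (Fin N) → Bool
  sparse c us = any (λ v → low q (p * m) 0 (adj (G c) v) us) us

  -- `bound` is a double count. A row is skipped only when all but `types * k` of the colours then
  -- available are sparse on it, and the final leftover `lc` is among those colours. Each skipped
  -- row therefore accounts for at least `length lc` minus `types * k` defects.
  record Greedy (vs : List (Fin N)) (cs : List (Fin n)) (defect : ℕ) : Set where
    field
      {cv lv} : List (Fin N)
      {cc lc} : List (Fin n)
      skipped : ℕ
      tiled   : Tiling cv cc
      vs↭     : vs ↭ cv ++ lv
      cs↭     : cs ↭ cc ++ lc
      length-lv : length lv ≡ skipped * m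
      bound   : skipped * length lc ≤ defect + skipped * (types * k)

  greedy : m₀ ≤ m → ∀ bs → All (λ b → length b ≡ m) bs → ∀ cs →
           Greedy (concat bs) cs (∑ bs (λ b → # (λ c → sparse c b) cs))
  greedy large []       []         cs = record
    { skipped = 0 ; tiled = Tiling-[] ; vs↭ = ↭-refl ; cs↭ = ↭-refl ; length-lv = ≡.refl ; bound = z≤n }
  greedy large (b ∷ bs) (len ∷ lens) cs with types * k ℕP.≤? # (λ c → not (sparse c b)) cs
  ... | no few = record
      { skipped = suc skipped ; tiled = tiled
      ; vs↭ = ↭-trans (↭P.++⁺ˡ b vs↭) (↭P.shifts b cv)
      ; cs↭ = cs↭
      ; length-lv = ≡.trans (ListP.length-++ b) (cong₂ _+_ len length-lv)
      ; bound = begin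
          length lc + skipped * length lc
            ≤⟨ ℕP.+-mono-≤ lc≤ bound ⟩
          (# (λ c → sparse c b) cs + types * k) + (rest + skipped * (types * k))
            ≡⟨ ar (# (λ c → sparse c b) cs) (types * k) rest (skipped * (types * k)) ⟩
          # (λ c → sparse c b) cs + rest + (types * k + skipped * (types * k)) ∎ }
    where
    open Greedy (greedy large bs lens cs)
    open ℕP.≤-Reasoning
    rest = ∑ bs (λ b → # (λ c → sparse c b) cs)
    ar : ∀ a b c d → (a + b) + (c + d) ≡ a + c + (b + d)
    ar = ℕR.solve-∀
    lc≤ : length lc ≤ # (λ c → sparse c b) cs + types * k
    lc≤ = begin
      length lc                   ≤⟨ ℕP.m≤n+m _ (length cc) ⟩
      length cc + length lc       ≡⟨ ≡.trans (≡.sym (ListP.length-++ cc)) (≡.sym (↭P.↭-length cs↭)) ⟩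
      length cs                   ≡⟨ #-not (λ c → sparse c b) cs ⟨
      # (λ c → sparse c b) cs + # (λ c → not (sparse c b)) cs ≤⟨ ℕP.+-monoʳ-≤ _ (ℕP.<⇒≤ (ℕP.≰⇒> few)) ⟩
      # (λ c → sparse c b) cs + types * k ∎
  -- A pool of `types * k` dense colours contains `k` that induce the same graph on the row.
  ... | yes enough with popular-type (λ c → not (sparse c b)) b cs
  ...   | R , R⇒P , same , le = record
      { skipped = skipped
      ; tiled = Tiling-++ here-tiled tiled
      ; vs↭ = ↭-trans (↭P.++⁺ˡ b vs↭) (↭-sym (↭P.++-assoc b cv lv))
      ; cs↭ = ↭-trans taken (↭-trans (↭P.++⁺ˡ K cs↭) (↭-sym (↭P.++-assoc K cc lc)))
      ; length-lv = length-lv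
      -- Shrinking the pool from `cs` to `cs′` only lowers the defects of the later rows.
      ; bound = ℕP.≤-trans bound (ℕP.+-monoˡ-≤ (skipped * (types * k)) (ℕP.≤-trans (∑-mono bs λ b′ →
          ℕP.≤-trans (ℕP.m≤n+m (# (λ c → sparse c b′) cs′) (# (λ c → sparse c b′) K)) (ℕP.≤-reflexive (≡.trans (≡.sym (∑-++ K cs′ _)) (≡.sym (∑-↭ _ taken)))))
          (ℕP.m≤n+m _ (# (λ c → sparse c b) cs)))) }
    where
    K cs′ : List (Fin n)
    K = List.take k (filterᵇ R cs)
    cs′ = List.drop k (filterᵇ R cs) ++ filterᵇ (not ∘ R) cs
    taken : cs ↭ K ++ cs′
    taken = ↭-trans (filterᵇ-↭ R cs) (↭-trans
      (↭-reflexive (cong (_++ filterᵇ (not ∘ R) cs) (≡.sym (ListP.take++drop≡id k (filterᵇ R cs)))))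
      (↭P.++-assoc K (List.drop k (filterᵇ R cs)) (filterᵇ (not ∘ R) cs)))
    open Greedy (greedy large bs lens cs′)
    k≤ : k ≤ length (filterᵇ R cs)
    k≤ = subst (k ≤_) (≡.sym (length-filterᵇ R cs))
           (ℕP.*-cancelˡ-≤ types {{ℕP.m^n≢0 2 (m * m)}} (ℕP.≤-trans enough (subst (λ z → # (λ c → not (sparse c b)) cs ≤ 2 ^ (z * z) * # R cs) len le)))
    lenK : length K ≡ k
    lenK = ≡.trans (ListP.length-take k (filterᵇ R cs)) (ℕP.m≤n⇒m⊓n≡m k≤)
    K-R : ∀ {c} → c ∈ K → R c ≡ true
    K-R c∈ = proj₂ (∈-filterᵇ⁻ R cs (subst (_ ∈_) (ListP.take++drop≡id k (filterᵇ R cs)) (∈-++⁺ˡ c∈)))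
    first : ∀ (K : List (Fin n)) → length K ≡ k → ∃ λ c → c ∈ K
    first (c ∷ _) _ = c , here ≡.refl
    c₀ = proj₁ (first K lenK)
    Rc₀ = K-R (proj₂ (first K lenK))
    here-tiled : Tiling b K
    here-tiled = block-tiling thr {c₀} (subst (m₀ ≤_) (≡.sym len) large) (≡.trans len (cong (_* r) (≡.sym lenK)))
      (λ v v∈ → subst (λ z → p * z ≤ q * # (adj (G c₀) v) b) (≡.sym len)
        (ℕP.≤-trans (ℕP.≤-reflexive (≡.sym (ℕP.+-identityʳ (p * m)))) (low-false q (p * m) 0 (adj (G c₀) v) b (none⁻ _ b (R⇒P c₀ Rc₀) v∈))))
      (All.tabulate λ {c} c∈ → same c₀ c Rc₀ (K-R c∈))

  module Grid (M : ℕ) {{M≢0 : NonZero M}} (w : Fin (m * M) → Fin N)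
              (dense : ∀ c v → suc p * (M * m) ≤ q * # (adj (G c) v) (tabulate w)) (slack : 2 * q ≤ m) (C : List (Fin n)) where
    private
      instance
        m≢0 : NonZero m
        m≢0 = ℕP.m*n≢0 k r
        L≢0 : NonZero (length (allFin M))
        L≢0 = subst NonZero (≡.sym (length-allFin M)) M≢0
      open Tail {Fin M} {Fin N} (allFin M)

      cell : Fin m → Fin M → Fin N
      cell b t = w (combine {m} {M} b t)

      shifts : List (Vec (Fin M) m)
      shifts = vecs (allFin M) m

      -- For fixed `s` the rows partition the grid. For fixed `j` and uniform `s` a row is a uniform
      -- choice of one vertex per column, so `concentration` applies to it. Independently sampled
      -- rows would have only the second property.
      row : Vec (Fin M) m → Fin M → List (Fin N)
      row s j = sample cell (Vec.map (rotate j) s)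

      index : Fin m → Fin M → Fin (m * M)
      index = combine

      mass-grid : ∀ g → mass g cell ≡ # g (tabulate w)
      mass-grid g = begin
        mass g cell                                                          ≡⟨ ∑-tabulate (λ b → # (g ∘ cell b) (allFin M)) (λ z → z) ⟩
        ∑ (allFin m) (λ b → # (g ∘ cell b) (allFin M))                       ≡⟨ ∑-cong (allFin m) (λ b → ∑-tabulate (index b) (𝟙 ∘ g ∘ w)) ⟨
        ∑ (allFin m) (λ b → ∑ (tabulate (index b)) (𝟙 ∘ g ∘ w))              ≡⟨ ∑-concatMap (λ b → tabulate (index b)) (allFin m) (𝟙 ∘ g ∘ w) ⟨
        ∑ (concatMap (λ b → tabulate (index b)) (allFin m)) (𝟙 ∘ g ∘ w)      ≡⟨ cong (λ z → ∑ (concat z) (𝟙 ∘ g ∘ w)) (ListP.map-tabulate {n = m} (λ b → b) (λ b → tabulate (index b))) ⟩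
        ∑ (concat (tabulate λ b → tabulate (index b))) (𝟙 ∘ g ∘ w)           ≡⟨ ∑-↭ (𝟙 ∘ g ∘ w) (enumerate-↭ index ≡.refl λ i i′ j j′ e → FinP.combine-injective i j i′ j′ e) ⟩
        ∑ (allFin (m * M)) (𝟙 ∘ g ∘ w)                                       ≡⟨ ∑-tabulate w (𝟙 ∘ g) ⟨
        # g (tabulate w) ∎ where open ≡-Reasoning

      few-sparse : ∀ c → # (λ s → sparse c (sample cell s)) shifts * m ≤ Q * M ^ m
      few-sparse c = ℕP.≤-trans
        (concentration (allFin M) p q 0 (adj (G c)) cell
          (λ v → ≡.subst₂ _≤_ (cong (λ z → suc p * (z * m)) (≡.sym (length-allFin M))) (cong (q *_) (≡.sym (mass-grid (adj (G c) v)))) (dense c v)) slack)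
        (ℕP.≤-reflexive (cong (λ z → Q * z ^ m) (length-allFin M)))

      rotated : ∀ j → List.map (rotate j) (allFin M) ↭ allFin M
      rotated j = full-list (UniqueP.map⁺ (rotate-injective j) (UniqueP.allFin⁺ M)) (≡.trans (ListP.length-map (rotate j) (allFin M)) (length-allFin M))

      defects : Vec (Fin M) m → ℕ
      defects s = ∑ (allFin M) (λ j → # (λ c → sparse c (row s j)) C)

    -- For each row and colour a proportion at most `Q / m` of the shifts is bad. The number of bad
    -- pairs thus averages at most `Q / m` times the number of rows times the number of colours.
    good-shift : ∃ λ s → defects s * m ≤ M * (length C * Q)
    good-shift = let s , _ , le = ∑-pigeonhole shifts (λ s → defects s * m) (λ _ → M * (length C * Q)) nonempty average in s , le
      where
      open ℕP.≤-Reasoning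
      lenS : length shifts ≡ M ^ m
      lenS = ≡.trans (length-vecs (allFin M) m) (cong (_^ m) (length-allFin M))
      nonempty : 0 < length shifts
      nonempty = subst (0 <_) (≡.sym lenS) (ℕP.m^n>0 M m)
      average : ∑ shifts (λ s → defects s * m) ≤ ∑ shifts (λ _ → M * (length C * Q))
      average = begin
        ∑ shifts (λ s → defects s * m)
          ≡⟨ ≡.trans (∑-*ʳ shifts m defects) (cong (_* m) (≡.trans (∑-swap shifts (allFin M) _) (∑-cong (allFin M) λ j → ∑-swap shifts C _))) ⟩
        ∑ (allFin M) (λ j → ∑ C (λ c → # (λ s → sparse c (row s j)) shifts)) * m
          ≡⟨ cong (_* m) (∑-cong (allFin M) λ j → ∑-cong C λ c → ∑-vecs-map (rotate j) (allFin M) (rotated j) m (λ s → 𝟙 (sparse c (sample cell s)))) ⟩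
        ∑ (allFin M) (λ _ → failures) * m
          ≡⟨ ≡.trans (cong (_* m) (≡.trans (∑-const (allFin M) failures) (cong (_* failures) (length-allFin M)))) (≡.trans (ℕP.*-assoc M failures m) (cong (M *_) (≡.sym (∑-*ʳ C m failing)))) ⟩
        M * ∑ C (λ c → failing c * m)
          ≤⟨ ℕP.*-monoʳ-≤ M (∑-mono C few-sparse) ⟩
        M * ∑ C (λ _ → Q * M ^ m)
          ≡⟨ cong (M *_) (∑-const C _) ⟩
        M * (length C * (Q * M ^ m))
          ≡⟨ ar M (length C) Q (M ^ m) ⟩
        M ^ m * (M * (length C * Q))
          ≡⟨ ≡.trans (∑-const shifts _) (cong (_* (M * (length C * Q))) lenS) ⟨
        ∑ shifts (λ _ → M * (length C * Q)) ∎
        where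
        failing : Fin n → ℕ
        failing c = # (λ s → sparse c (sample cell s)) shifts
        failures = ∑ C failing
        ar : ∀ a b c d → a * (b * (c * d)) ≡ d * (a * (b * c))
        ar = ℕR.solve-∀

    private
      place : Vec (Fin M) m → Fin M → Fin m → Fin (m * M)
      place s j b = index b (lookup (Vec.map (rotate j) s) b)

      place-injective : ∀ s i i′ b b′ → place s i b ≡ place s i′ b′ → i ≡ i′ × b ≡ b′
      place-injective s i i′ b b′ e = helper (FinP.combine-injectiveˡ b t b′ t′ e) (FinP.combine-injectiveʳ b t b′ t′ e)
        where
        t  = lookup (Vec.map (rotate i) s) b
        t′ = lookup (Vec.map (rotate i′) s) b′
        helper : b ≡ b′ → t ≡ t′ → i ≡ i′ × b ≡ b′
        helper ≡.refl e′ = rotate-injective (lookup s b) (begin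
          rotate (lookup s b) i               ≡⟨ rotate-comm (lookup s b) i ⟩
          rotate i (lookup s b)               ≡⟨ VecP.lookup-map b (rotate i) s ⟨
          lookup (Vec.map (rotate i) s) b     ≡⟨ e′ ⟩
          lookup (Vec.map (rotate i′) s) b    ≡⟨ VecP.lookup-map b (rotate i′) s ⟩
          rotate i′ (lookup s b)              ≡⟨ rotate-comm i′ (lookup s b) ⟩
          rotate (lookup s b) i′              ∎) , ≡.refl
          where open ≡-Reasoning

      rows↭ : ∀ s → concat (tabulate (row s)) ↭ tabulate w
      rows↭ s = ↭-trans (↭-reflexive relabel) (↭-trans
        (↭P.map⁺ w (enumerate-↭ (place s) (ℕP.*-comm M m) (place-injective s))) (↭-reflexive (ListP.map-tabulate (λ b → b) w)))
        where
        relabel : concat (tabulate (row s)) ≡ List.map w (concat (tabulate λ j → tabulate (place s j)))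
        relabel = begin
          concat (tabulate (row s))                                            ≡⟨ cong concat (ListP.tabulate-cong λ j → ≡.sym (ListP.map-tabulate (place s j) w)) ⟩
          concat (tabulate λ j → List.map w (tabulate (place s j)))            ≡⟨ cong concat (≡.sym (ListP.map-tabulate (λ j → tabulate (place s j)) (List.map w))) ⟩
          concat (List.map (List.map w) (tabulate λ j → tabulate (place s j))) ≡⟨ ListP.concat-map (tabulate λ j → tabulate (place s j)) ⟩
          List.map w (concat (tabulate λ j → tabulate (place s j)))            ∎ where open ≡-Reasoning

      row-length : ∀ s j → length (row s j) ≡ m
      row-length s j = ListP.length-tabulate (λ b → cell b (lookup (Vec.map (rotate j) s) b))

    cover : m₀ ≤ m → ∃ λ defect → defect * m ≤ M * (length C * Q) × Greedy (tabulate w) C defect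
    cover large = defects s , proj₂ good-shift , record
      { skipped = skipped ; tiled = tiled ; vs↭ = ↭-trans (↭-sym (rows↭ s)) vs↭ ; cs↭ = cs↭ ; length-lv = length-lv
      ; bound = subst (λ z → skipped * length lc ≤ z + skipped * (types * k)) (∑-tabulate (row s) (λ b → # (λ c → sparse c b) C)) bound }
      where
      s = proj₁ good-shift
      open Greedy (greedy large (tabulate (row s)) (AllP.tabulate⁺ (row-length s)) C)

-- Numerical estimates and grouping of leftovers

n<2^n : ∀ n → n < 2 ^ n
n<2^n zero    = s≤s z≤n
n<2^n (suc n) = ℕP.+-mono-≤-< (ℕP.m^n>0 2 n) (ℕP.≤-trans (n<2^n n) (ℕP.≤-reflexive (≡.sym (ℕP.+-identityʳ _))))

-- Induction from v = 2 b + 1, where b (2 b + 2) = 2 b (b + 1) ≤ 2 * 2^b * 2^b. From there the right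
-- side doubles at each step while the left at most doubles.
linear<exponential : ∀ b v → suc (b + b) ≤ v → b * suc v ≤ 2 ^ v
linear<exponential b v le = subst (λ z → b * suc z ≤ 2 ^ z) (ℕP.m+[n∸m]≡n le) (go (v ∸ suc (b + b)))
  where
  open ℕP.≤-Reasoning
  go : ∀ i → b * suc (suc (b + b) + i) ≤ 2 ^ (suc (b + b) + i)
  go zero = begin
    b * suc (suc (b + b) + 0)       ≡⟨ e₁ b ⟩
    2 * (b * suc b)                 ≤⟨ ℕP.*-monoʳ-≤ 2 (ℕP.*-mono-≤ (ℕP.<⇒≤ (n<2^n b)) (n<2^n b)) ⟩
    2 * (2 ^ b * 2 ^ b)             ≡⟨ cong (2 *_) (ℕP.^-distribˡ-+-* 2 b b) ⟨
    2 ^ suc (b + b)                 ≡⟨ cong (2 ^_) (ℕP.+-identityʳ (suc (b + b))) ⟨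
    2 ^ (suc (b + b) + 0)           ∎
    where
    e₁ : ∀ b → b * suc (suc (b + b) + 0) ≡ 2 * (b * suc b)
    e₁ = ℕR.solve-∀
  go (suc i) = begin
    b * suc (suc (b + b) + suc i)       ≤⟨ ℕP.m≤m+n _ (b * (suc (b + b) + i)) ⟩
    b * suc (suc (b + b) + suc i) + b * (suc (b + b) + i) ≡⟨ e₂ b i ⟩
    2 * (b * suc (suc (b + b) + i))     ≤⟨ ℕP.*-monoʳ-≤ 2 (go i) ⟩
    2 ^ suc (suc (b + b) + i)           ≡⟨ cong (2 ^_) (ℕP.+-suc (suc (b + b)) i) ⟨
    2 ^ (suc (b + b) + suc i)           ∎
    where
    e₂ : ∀ b i → b * suc (suc (b + b) + suc i) + b * (suc (b + b) + i) ≡ 2 * (b * suc (suc (b + b) + i))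
    e₂ = ℕR.solve-∀

-- With v the integer part of u / R, the previous bound gives a u < a R (v + 1) ≤ 2^v; raise this to
-- the power `R`.
polynomial<exponential : ∀ a R .{{_ : NonZero a}} .{{_ : NonZero R}} u →
                         R * suc (a * R + a * R) ≤ u → (a * u) ^ R < 2 ^ u
polynomial<exponential a R u le = begin-strict
  (a * u) ^ R               <⟨ ℕP.^-monoˡ-< R (begin-strict
    a * u                     <⟨ ℕP.*-monoʳ-< a u< ⟩
    a * (R * suc v)           ≡⟨ ℕP.*-assoc a R _ ⟨
    a * R * suc v             ≤⟨ linear<exponential (a * R) v v≥ ⟩
    2 ^ v                     ∎) ⟩
  (2 ^ v) ^ R               ≡⟨ ℕP.^-*-assoc 2 v R ⟩
  2 ^ (v * R)               ≤⟨ ℕP.^-monoʳ-≤ 2 (m/n*n≤m u R) ⟩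
  2 ^ u                     ∎
  where
  open ℕP.≤-Reasoning
  v = u / R
  v≥ : suc (a * R + a * R) ≤ v
  v≥ = ℕP.≤-trans (ℕP.≤-reflexive (≡.sym (≡.trans (cong (_/ R) (ℕP.*-comm R (suc (a * R + a * R)))) (m*n/n≡m (suc (a * R + a * R)) R)))) (/-monoˡ-≤ R le)
  u< : u < R * suc v
  u< = begin-strict
    u                  ≡⟨ m≡m%n+[m/n]*n u R ⟩
    u % R + v * R      <⟨ ℕP.+-monoˡ-< (v * R) (m%n<n u R) ⟩
    R + v * R          ≡⟨ ℕP.*-comm (suc v) R ⟩
    R * suc v          ∎

-- Here `l` counts leftover colours, `z` skipped rows, `d` defects, `c` colours to be used, and `g`
-- is the target. If l > g, the lower-order terms are absorbed: l r ≤ 2 z m, as most leftover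
-- vertices lie in skipped rows, and z l m ≤ 2 M c Q by the double count. Multiplying the two and
-- cancelling r yields l^2 m ≤ 4 Q c^2, against the last hypothesis.
leftover-bound : ∀ {d} l g z m r .{{_ : NonZero r}} M c Q H → z * l ≤ d + z * H → d * m ≤ M * (c * Q) →
                 l * r ≤ z * m + m → M * m ≤ c * r → 2 * H ≤ g → 2 * m ≤ g * r → 4 * Q * (c * c) < g * g * m → l ≤ g
leftover-bound {d} l g z m r M c Q H b₁ b₂ b₃ b₄ b₅ b₆ b₇ = ℕP.≮⇒≥ λ g<l → let g≤l = ℕP.<⇒≤ g<l in
  ℕP.<-irrefl ≡.refl (begin-strict
    4 * Q * (c * c)           <⟨ b₇ ⟩
    g * g * m                 ≤⟨ ℕP.*-monoˡ-≤ m (ℕP.*-mono-≤ g≤l g≤l) ⟩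
    l * l * m                 ≤⟨ ℕP.*-cancelʳ-≤ (l * l * m) (4 * Q * (c * c)) r (begin
      l * l * m * r             ≡⟨ e₁ l m r ⟩
      l * r * (l * m)           ≤⟨ ℕP.*-monoˡ-≤ (l * m) (vertices g≤l) ⟩
      2 * (z * m) * (l * m)     ≡⟨ e₂ z l m ⟩
      2 * m * (z * l * m)       ≤⟨ ℕP.*-monoʳ-≤ (2 * m) (defects g≤l) ⟩
      2 * m * (2 * (M * (c * Q)))   ≡⟨ e₃ m M c Q ⟩
      4 * Q * c * (M * m)       ≤⟨ ℕP.*-monoʳ-≤ (4 * Q * c) b₄ ⟩
      4 * Q * c * (c * r)       ≡⟨ e₄ Q c r ⟩
      4 * Q * (c * c) * r       ∎) ⟩
    4 * Q * (c * c)           ∎)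
  where
  open ℕP.≤-Reasoning
  e₁ : ∀ l m r → l * l * m * r ≡ l * r * (l * m)
  e₁ = ℕR.solve-∀
  e₂ : ∀ z l m → 2 * (z * m) * (l * m) ≡ 2 * m * (z * l * m)
  e₂ = ℕR.solve-∀
  e₃ : ∀ m M c Q → 2 * m * (2 * (M * (c * Q))) ≡ 4 * Q * c * (M * m)
  e₃ = ℕR.solve-∀
  e₄ : ∀ Q c r → 4 * Q * c * (c * r) ≡ 4 * Q * (c * c) * r
  e₄ = ℕR.solve-∀
  vertices : g ≤ l → l * r ≤ 2 * (z * m)
  vertices g≤l = ℕP.+-cancelʳ-≤ (l * r) _ _ (begin
    l * r + l * r              ≤⟨ ℕP.+-mono-≤ b₃ b₃ ⟩
    (z * m + m) + (z * m + m)  ≡⟨ e₅ (z * m) m ⟩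
    2 * (z * m) + 2 * m        ≤⟨ ℕP.+-monoʳ-≤ (2 * (z * m)) (ℕP.≤-trans b₆ (ℕP.*-monoˡ-≤ r g≤l)) ⟩
    2 * (z * m) + l * r        ∎)
    where
    e₅ : ∀ a m → (a + m) + (a + m) ≡ 2 * a + 2 * m
    e₅ = ℕR.solve-∀
  defects : g ≤ l → z * l * m ≤ 2 * (M * (c * Q))
  defects g≤l = ℕP.+-cancelʳ-≤ (z * l * m) _ _ (begin
    z * l * m + z * l * m                    ≤⟨ ℕP.+-mono-≤ (ℕP.*-monoˡ-≤ m b₁) (ℕP.*-monoˡ-≤ m b₁) ⟩
    (d + z * H) * m + (d + z * H) * m        ≡⟨ e₆ d z H m ⟩
    2 * (d * m) + z * (2 * H) * m            ≤⟨ ℕP.+-mono-≤ (ℕP.*-monoʳ-≤ 2 b₂) (ℕP.*-monoˡ-≤ m (ℕP.*-monoʳ-≤ z (ℕP.≤-trans b₅ g≤l))) ⟩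
    2 * (M * (c * Q)) + z * l * m            ∎)
    where
    e₆ : ∀ d z H m → (d + z * H) * m + (d + z * H) * m ≡ 2 * (d * m) + z * (2 * H) * m
    e₆ = ℕR.solve-∀

as-tabulate : ∀ {X : Set} (xs : List X) {l} → length xs ≡ l → ∃ λ (w : Fin l → X) → tabulate w ≡ xs
as-tabulate xs ≡.refl = List.lookup xs , ListP.tabulate-lookup xs

as-entries : ∀ {X : Set} (xs : List X) {l} → length xs ≡ l → ∃ λ (s : Vec X l) → entries s ≡ xs
as-entries xs len = let w , e = as-tabulate xs len in Vec.tabulate w , ≡.trans (ListP.tabulate-cong (VecP.lookup∘tabulate w)) e

chunks : ∀ {X Y : Set} r (cs : List Y) (vs : List X) → length vs ≡ length cs * r →
         ∃ λ (ds : List (Vec X r × Y)) → concatMap (entries ∘ proj₁) ds ≡ vs × List.map proj₂ ds ≡ cs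
chunks r []       []       _   = [] , ≡.refl , ≡.refl
chunks r (c ∷ cs) vs       len =
  let x , ex = as-entries (List.take r vs) (≡.trans (ListP.length-take r vs) (ℕP.m≤n⇒m⊓n≡m (ℕP.≤-trans (ℕP.m≤m+n r _) (ℕP.≤-reflexive (≡.sym len)))))
      ds , ev , ec = chunks r cs (List.drop r vs) (≡.trans (ListP.length-drop r vs) (≡.trans (cong (_∸ r) len) (ℕP.m+n∸m≡n r _)))
  in (x , c) ∷ ds , ≡.trans (cong₂ _++_ ex ev) (ListP.take++drop≡id r vs) , cong (c ∷_) ec

-- Assembling absorbers, cover and leftover

module Assembly {r n : ℕ} (F : Graph r) (G : Fin n → Graph (r * n)) {p q m₀ : ℕ} (thr : Threshold F p q m₀)
                {{r≢0 : NonZero r}} {{q≢0 : NonZero q}} {{n≢0 : NonZero n}} {{N≢0 : NonZero (r * n)}}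
                (degree : ∀ c v → suc (suc p) * (r * n) ≤ q * # (adj (G c) v) (allFin (r * n)))
                (k₁′ k₂′ u : ℕ) where
  open Factors F G

  N : ℕ
  N = r * n

  degree₁ : ∀ c v → suc p * N ≤ q * # (adj (G c) v) (allFin N)
  degree₁ c v = ℕP.≤-trans (ℕP.m≤n+m _ N) (degree c v)

  n≤N : n ≤ N
  n≤N = ℕP.m≤n*m n r

  module A = Family F G thr k₁′ degree₁
  module C = Cover F G thr k₂′

  module Remainder (V : List (Fin N)) (cs : List (Fin n)) (len : length V ≡ length cs * r) (cs≤n : length cs ≤ n)
                   (dense : ∀ c v → suc p * N + q * C.m ≤ q * # (adj (G c) v) V) (V≤N : length V ≤ N) (m≤V : C.m ≤ length V)
                   (large : m₀ ≤ C.m) (slack : 2 * q ≤ C.m)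
                   (spread : ∀ {c} → c ≤ n → 4 * C.Q * (c * c) < u * u * C.m)
                   (2H≤u : 2 * (C.types * C.k) ≤ u) (2m≤ur : 2 * C.m ≤ u * r) where
    private
      instance
        m≢0 : NonZero C.m
        m≢0 = ℕP.m*n≢0 C.k r

      M : ℕ
      M = length V / C.m

      instance
        M≢0 : NonZero M
        M≢0 = ℕ.>-nonZero (ℕP.≤-trans (ℕP.≤-reflexive (≡.sym (m*n/n≡m 1 C.m))) (/-monoˡ-≤ C.m (ℕP.≤-trans (ℕP.≤-reflexive (ℕP.*-identityˡ C.m)) m≤V)))

      mM≤V : C.m * M ≤ length V
      mM≤V = ℕP.≤-trans (ℕP.≤-reflexive (ℕP.*-comm C.m M)) (m/n*n≤m (length V) C.m)

      W L : List (Fin N)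
      W = List.take (C.m * M) V
      L = List.drop (C.m * M) V

      W++L : V ≡ W ++ L
      W++L = ≡.sym (ListP.take++drop≡id (C.m * M) V)

      length-L : length L ≤ C.m
      length-L = begin
        length L                                          ≡⟨ ListP.length-drop (C.m * M) V ⟩
        length V ∸ C.m * M                                ≡⟨ cong₂ _∸_ (m≡m%n+[m/n]*n (length V) C.m) (ℕP.*-comm C.m M) ⟩
        (length V % C.m + M * C.m) ∸ M * C.m              ≡⟨ ℕP.m+n∸n≡m (length V % C.m) (M * C.m) ⟩
        length V % C.m                                    ≤⟨ ℕP.<⇒≤ (m%n<n (length V) C.m) ⟩
        C.m                                               ∎ where open ℕP.≤-Reasoning

      grid : ∃ λ (w : Fin (C.m * M) → Fin N) → tabulate w ≡ W
      grid = as-tabulate W (≡.trans (ListP.length-take (C.m * M) V) (ℕP.m≤n⇒m⊓n≡m mM≤V))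

      w : Fin (C.m * M) → Fin N
      w = proj₁ grid

      w≡ : tabulate w ≡ W
      w≡ = proj₂ grid

      -- At most `C.m` vertices fall outside the grid; the term `q * C.m` in `dense` pays for them.
      dense-W : ∀ c v → suc p * (M * C.m) ≤ q * # (adj (G c) v) (tabulate w)
      dense-W c v = ℕP.+-cancelʳ-≤ (q * C.m) _ _ (begin
        suc p * (M * C.m) + q * C.m             ≤⟨ ℕP.+-monoˡ-≤ (q * C.m) (ℕP.*-monoʳ-≤ (suc p) (ℕP.≤-trans (m/n*n≤m (length V) C.m) V≤N)) ⟩
        suc p * N + q * C.m                     ≤⟨ dense c v ⟩
        q * # g V                               ≡⟨ cong (q *_) (≡.trans (cong (# g) W++L) (∑-++ W L (𝟙 ∘ g))) ⟩
        q * (# g W + # g L)                     ≤⟨ ℕP.*-monoʳ-≤ q (ℕP.+-monoʳ-≤ (# g W) (ℕP.≤-trans (#≤length g L) length-L)) ⟩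
        q * (# g W + C.m)                       ≡⟨ ℕP.*-distribˡ-+ q (# g W) C.m ⟩
        q * # g W + q * C.m                     ≡⟨ cong (λ z → q * # g z + q * C.m) w≡ ⟨
        q * # g (tabulate w) + q * C.m          ∎)
        where
        open ℕP.≤-Reasoning
        g = adj (G c) v

      covered : ∃ λ defect → defect * C.m ≤ M * (length cs * C.Q) × C.Greedy (tabulate w) cs defect
      covered = C.Grid.cover M w dense-W slack cs large

    open C.Greedy (proj₂ (proj₂ covered)) public

    leftover : List (Fin N)
    leftover = lv ++ L

    V↭ : V ↭ cv ++ leftover
    V↭ = ↭-trans (↭-reflexive (≡.trans W++L (cong (_++ L) (≡.sym w≡)))) (↭-trans (↭P.++⁺ʳ L vs↭) (↭P.++-assoc cv lv L))

    -- The tiled part uses `r` vertices per colour, as does the whole, so the leftover splits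
    -- exactly into demands.
    length-leftover : length leftover ≡ length lc * r
    length-leftover = ℕP.+-cancelˡ-≡ (length cc * r) _ _ (begin
      length cc * r + length leftover   ≡⟨ cong (_+ length leftover) (Tiling-length tiled) ⟨
      length cv + length leftover       ≡⟨ ListP.length-++ cv ⟨
      length (cv ++ leftover)           ≡⟨ ↭P.↭-length V↭ ⟨
      length V                          ≡⟨ len ⟩
      length cs * r                     ≡⟨ cong (_* r) (≡.trans (↭P.↭-length cs↭) (ListP.length-++ cc)) ⟩
      (length cc + length lc) * r       ≡⟨ ℕP.*-distribʳ-+ r (length cc) (length lc) ⟩
      length cc * r + length lc * r     ∎) where open ≡-Reasoning

    few-left : length lc ≤ u
    few-left = leftover-bound (length lc) u skipped C.m r M (length cs) C.Q (C.types * C.k) bound (proj₁ (proj₂ covered))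
      (ℕP.≤-trans (ℕP.≤-reflexive (≡.trans (≡.sym length-leftover) (≡.trans (ListP.length-++ lv) (cong (_+ length L) length-lv)))) (ℕP.+-monoʳ-≤ (skipped * C.m) length-L))
      (ℕP.≤-trans (m/n*n≤m (length V) C.m) (ℕP.≤-reflexive len)) 2H≤u 2m≤ur (spread cs≤n)

  module Completion (B : ℕ) (fam : List A.Absorber) (lenfam : length fam ≡ B)
                    (tilings : All (λ e → Tiling (A.block e) (A.palette e)) fam)
                    (V : List (Fin N)) (V↭N : allFin N ↭ concatMap A.block fam ++ V)
                    (cs : List (Fin n)) (cs↭n : allFin n ↭ concatMap A.palette fam ++ cs)
                    (enough : ∀ d → u ≤ # (A.serves d) fam) (large₁ : m₀ ≤ A.m)
                    (removed : q * (B * A.m + C.m) ≤ n)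
                    (large₂ : m₀ ≤ C.m) (slack₂ : 2 * q ≤ C.m)
                    (spread₂ : ∀ {c} → c ≤ n → 4 * C.Q * (c * c) < u * u * C.m)
                    (2H≤u : 2 * (C.types * C.k) ≤ u) (2m≤ur : 2 * C.m ≤ u * r) where
    private
      blocks : List (Fin N)
      blocks = concatMap A.block fam

      palettes : List (Fin n)
      palettes = concatMap A.palette fam

      N≡ : N ≡ B * A.m + length V
      N≡ = begin
        N                          ≡⟨ length-allFin N ⟨
        length (allFin N)          ≡⟨ ↭P.↭-length V↭N ⟩
        length (blocks ++ V)       ≡⟨ ListP.length-++ blocks ⟩
        length blocks + length V   ≡⟨ cong (_+ length V) (≡.trans (A.length-blocks fam) (cong (_* A.m) lenfam)) ⟩
        B * A.m + length V         ∎ where open ≡-Reasoning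

      n≡ : n ≡ B * A.k + length cs
      n≡ = begin
        n                              ≡⟨ length-allFin n ⟨
        length (allFin n)              ≡⟨ ↭P.↭-length cs↭n ⟩
        length (palettes ++ cs)        ≡⟨ ListP.length-++ palettes ⟩
        length palettes + length cs    ≡⟨ cong (_+ length cs) (≡.trans (A.length-palettes fam) (cong (_* A.k) lenfam)) ⟩
        B * A.k + length cs            ∎ where open ≡-Reasoning

      len : length V ≡ length cs * r
      len = ℕP.+-cancelˡ-≡ (B * A.m) _ _ (begin
        B * A.m + length V               ≡⟨ N≡ ⟨
        r * n                            ≡⟨ cong (r *_) n≡ ⟩
        r * (B * A.k + length cs)        ≡⟨ ar r B A.k (length cs) ⟩
        B * A.m + length cs * r          ∎)
        where
        open ≡-Reasoning
        ar : ∀ r B k c → r * (B * k + c) ≡ B * (k * r) + c * r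
        ar = ℕR.solve-∀

      cs≤n : length cs ≤ n
      cs≤n = ℕP.≤-trans (ℕP.m≤n+m _ (B * A.k)) (ℕP.≤-reflexive (≡.sym n≡))

      V≤N : length V ≤ N
      V≤N = ℕP.≤-trans (ℕP.m≤n+m _ (B * A.m)) (ℕP.≤-reflexive (≡.sym N≡))

      m≤V : C.m ≤ length V
      m≤V = ℕP.+-cancelˡ-≤ (B * A.m) _ _ (begin
        B * A.m + C.m                  ≤⟨ ℕP.m≤n*m (B * A.m + C.m) q ⟩
        q * (B * A.m + C.m)            ≤⟨ removed ⟩
        n                              ≤⟨ n≤N ⟩
        N                              ≡⟨ N≡ ⟩
        B * A.m + length V             ∎) where open ℕP.≤-Reasoning

      -- One unit of degree surplus, worth `N`, pays for the vertices inside absorbers and sets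
      -- `q * C.m` aside for those outside the grid.
      dense : ∀ c v → suc p * N + q * C.m ≤ q * # (adj (G c) v) V
      dense c v = ℕP.+-cancelˡ-≤ (q * (B * A.m)) _ _ (begin
        q * (B * A.m) + (suc p * N + q * C.m)         ≡⟨ ar q (B * A.m) (suc p * N) C.m ⟩
        q * (B * A.m + C.m) + suc p * N               ≤⟨ ℕP.+-monoˡ-≤ (suc p * N) (ℕP.≤-trans removed n≤N) ⟩
        N + suc p * N                                 ≤⟨ degree c v ⟩
        q * # g (allFin N)                            ≡⟨ cong (q *_) (≡.trans (∑-↭ (𝟙 ∘ g) V↭N) (∑-++ blocks V (𝟙 ∘ g))) ⟩
        q * (# g blocks + # g V)                      ≤⟨ ℕP.*-monoʳ-≤ q (ℕP.+-monoˡ-≤ (# g V) (ℕP.≤-trans (#≤length g blocks) (ℕP.≤-reflexive (≡.trans (A.length-blocks fam) (cong (_* A.m) lenfam))))) ⟩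
        q * (B * A.m + # g V)                         ≡⟨ ℕP.*-distribˡ-+ q (B * A.m) (# g V) ⟩
        q * (B * A.m) + q * # g V                     ∎)
        where
        open ℕP.≤-Reasoning
        g = adj (G c) v
        ar : ∀ q a b c → q * a + (b + q * c) ≡ q * (a + c) + b
        ar = ℕR.solve-∀

      module Rem = Remainder V cs len cs≤n dense V≤N m≤V large₂ slack₂ spread₂ 2H≤u 2m≤ur

      split : ∃ λ (ds : List A.Demand) → concatMap (entries ∘ proj₁) ds ≡ Rem.leftover × List.map proj₂ ds ≡ Rem.lc
      split = chunks r Rem.lc Rem.leftover Rem.length-leftover

      ds : List A.Demand
      ds = proj₁ split

      ds≤u : length ds ≤ u
      ds≤u = ℕP.≤-trans (ℕP.≤-reflexive (≡.trans (≡.sym (ListP.length-map proj₂ ds)) (cong length (proj₂ (proj₂ split))))) Rem.few-left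

      absorbed : Tiling (blocks ++ Rem.leftover) (palettes ++ Rem.lc)
      absorbed = Tiling-resp (↭-reflexive (cong (blocks ++_) (proj₁ (proj₂ split)))) (↭-reflexive (cong (palettes ++_) (proj₂ (proj₂ split))))
        (Absorption.absorb-all F G A.serves A.block A.palette (entries ∘ proj₁) proj₂ (λ {d} {e} → A.serves-tiling large₁ {d} {e}) fam tilings ds
          (All.tabulate λ {d} _ → ℕP.≤-trans ds≤u (enough d)))

      perm-v : (blocks ++ Rem.leftover) ++ Rem.cv ↭ allFin N
      perm-v = ↭-trans (↭P.++-assoc blocks Rem.leftover Rem.cv)
        (↭-trans (↭P.++⁺ˡ blocks (↭-trans (↭P.++-comm Rem.leftover Rem.cv) (↭-sym Rem.V↭))) (↭-sym V↭N))

      perm-c : (palettes ++ Rem.lc) ++ Rem.cc ↭ allFin n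
      perm-c = ↭-trans (↭P.++-assoc palettes Rem.lc Rem.cc)
        (↭-trans (↭P.++⁺ˡ palettes (↭-trans (↭P.++-comm Rem.lc Rem.cc) (↭-sym Rem.cs↭))) (↭-sym cs↭n))

    completed : Tiling (allFin N) (allFin n)
    completed = Tiling-resp perm-v perm-c (Tiling-++ absorbed Rem.tiled)

  module _ (large₁ : m₀ ≤ A.m) (slack₁ : 2 * (q * r + q) ≤ A.m) (spread₁ : 2 * ((3 + 2 * r) * A.Q) ≤ A.m)
           (few-demands : N ^ r * n < 2 ^ u)
           (room : 2 * A.h₀ * (A.size large₁ slack₁ spread₁ n≤N u u * (A.m * A.m + A.k * A.k)) ≤ n)
           (removed : q * (A.size large₁ slack₁ spread₁ n≤N u u * A.m + C.m) ≤ n)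
           (large₂ : m₀ ≤ C.m) (slack₂ : 2 * q ≤ C.m)
           (spread₂ : ∀ {c} → c ≤ n → 4 * C.Q * (c * c) < u * u * C.m)
           (2H≤u : 2 * (C.types * C.k) ≤ u) (2m≤ur : 2 * C.m ≤ u * r) where

    assemble : Tiling (allFin N) (allFin n)
    assemble =
      let fam , lenfam , tilings , (V , V↭N) , (cs , cs↭n) , enough = A.absorbing-family large₁ slack₁ spread₁ n≤N u u few-demands room
      in Completion.completed _ fam lenfam tilings V V↭N cs cs↭n enough large₁ removed large₂ slack₂ spread₂ 2H≤u 2m≤ur

-- Choice of constants

module Constants (r p q m₀ : ℕ) where
  -- Subscript 1 belongs to absorbers, subscript 2 to the cover. `k₁′` adds up the three lower
  -- bounds on the absorber size, `h` is the reciprocal of the proportion of absorbers serving a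
  -- demand, and n / `D` is the number of leftover colours to be absorbed.
  Q k₁′ k₁ m₁ h D k₂′ k₂ m₂ H R a U n₀ : ℕ
  Q   = 48 * q ^ 4
  k₁′ = m₀ + 2 * (q * r + q) + 2 * ((3 + 2 * r) * Q)
  k₁  = suc k₁′
  m₁  = k₁ * r
  h   = 2 * (2 * 2 ^ ((m₁ + r) * (m₁ + r))) ^ k₁
  -- The family has at most 8 h u members with u = n / D. The first summand then gives `room` and
  -- the second gives `removed`.
  D   = 16 * (h * h) * (m₁ * m₁ + k₁ * k₁) + 16 * q * h * m₁
  -- The last term comes from 4 Q c^2 < u^2 `m₂` with c ≤ n ≤ 2 D u.
  k₂′ = m₀ + 2 * q + 16 * Q * (D * D)
  k₂  = suc k₂′
  m₂  = k₂ * r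
  H   = 2 ^ (m₂ * m₂) * k₂
  R   = suc r
  -- The number of demands is at most N^R, and N = r n is at most a u.
  a   = 2 * D * r
  -- A lower bound for `u`: the first term lets `leftover-bound` apply, the second makes (a u)^R
  -- less than 2^u.
  U   = suc (2 * H + R * suc (a * R + a * R))
  n₀  = U * D + 2 * q * m₂

module Parameters {r n : ℕ} (F : Graph r) (G : Fin n → Graph (r * n)) {p q m₀ : ℕ} (thr : Threshold F p q m₀)
                {{r≢0 : NonZero r}} {{q≢0 : NonZero q}} where
  open Constants r p q m₀

  instance
    h≢0 : NonZero h
    h≢0 = ℕP.m*n≢0 2 _ {{_}} {{ℕP.m^n≢0 (2 * 2 ^ ((m₁ + r) * (m₁ + r))) k₁ {{ℕP.m*n≢0 2 _ {{_}} {{ℕP.m^n≢0 2 ((m₁ + r) * (m₁ + r))}}}}}}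
    D≢0 : NonZero D
    D≢0 = ℕ.>-nonZero (ℕP.<-≤-trans (ℕ.>-nonZero⁻¹ (16 * (h * h) * (m₁ * m₁ + k₁ * k₁))
            {{ℕP.m*n≢0 (16 * (h * h)) (m₁ * m₁ + k₁ * k₁) {{ℕP.m*n≢0 16 (h * h) {{_}} {{ℕP.m*n≢0 h h}}}}
              {{ℕ.>-nonZero (ℕP.<-≤-trans (ℕ.>-nonZero⁻¹ (k₁ * k₁) {{ℕP.m*n≢0 k₁ k₁}}) (ℕP.m≤n+m _ (m₁ * m₁)))}}}}) (ℕP.m≤m+n _ _))

  u N : ℕ
  u = n / D
  N = r * n

  module _ (big : n₀ ≤ n) (degree : ∀ c v → suc (suc p) * N ≤ q * # (adj (G c) v) (allFin N)) where
    private
      open Factors F G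
      U≤u : U ≤ u
      U≤u = ℕP.≤-trans (ℕP.≤-reflexive (≡.sym (m*n/n≡m U D))) (/-monoˡ-≤ D (ℕP.≤-trans (ℕP.m≤m+n (U * D) (2 * q * m₂)) big))

      Du≤n : D * u ≤ n
      Du≤n = ℕP.≤-trans (ℕP.≤-reflexive (ℕP.*-comm D u)) (m/n*n≤m n D)

      1≤u : 1 ≤ u
      1≤u = ℕP.≤-trans (s≤s z≤n) U≤u

      n≤2Du : n ≤ 2 * D * u
      n≤2Du = begin
        n                   ≡⟨ m≡m%n+[m/n]*n n D ⟩
        n % D + u * D       ≤⟨ ℕP.+-monoˡ-≤ (u * D) (ℕP.<⇒≤ (m%n<n n D)) ⟩
        D + u * D           ≤⟨ ℕP.+-monoˡ-≤ (u * D) (ℕP.≤-trans (ℕP.≤-reflexive (≡.sym (ℕP.*-identityˡ D))) (ℕP.*-monoˡ-≤ D 1≤u)) ⟩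
        u * D + u * D       ≡⟨ ar u D ⟩
        2 * D * u           ∎
        where
        open ℕP.≤-Reasoning
        ar : ∀ u D → u * D + u * D ≡ 2 * D * u
        ar = ℕR.solve-∀

      2H≤u : 2 * H ≤ u
      2H≤u = ℕP.≤-trans (ℕP.≤-trans (ℕP.m≤m+n _ _) (ℕP.n≤1+n _)) U≤u

      instance
        n≢0 : NonZero n
        n≢0 = ℕ.>-nonZero (ℕP.<-≤-trans (ℕ.>-nonZero⁻¹ (D * u) {{ℕP.m*n≢0 D u {{D≢0}} {{ℕ.>-nonZero 1≤u}}}}) Du≤n)
        N≢0 : NonZero N
        N≢0 = ℕP.m*n≢0 r n

      k₁≤m₁ : k₁ ≤ m₁
      k₁≤m₁ = ℕP.m≤m*n k₁ r

      k₂≤m₂ : k₂ ≤ m₂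
      k₂≤m₂ = ℕP.m≤m*n k₂ r

      large₁ : m₀ ≤ m₁
      large₁ = ℕP.≤-trans (ℕP.≤-trans (ℕP.m≤m+n m₀ _) (ℕP.≤-trans (ℕP.m≤m+n _ _) (ℕP.n≤1+n _))) k₁≤m₁

      slack₁ : 2 * (q * r + q) ≤ m₁
      slack₁ = ℕP.≤-trans (ℕP.≤-trans (ℕP.m≤n+m _ m₀) (ℕP.≤-trans (ℕP.m≤m+n _ _) (ℕP.n≤1+n _))) k₁≤m₁

      spread₁ : 2 * ((3 + 2 * r) * Q) ≤ m₁
      spread₁ = ℕP.≤-trans (ℕP.≤-trans (ℕP.m≤n+m _ (m₀ + 2 * (q * r + q))) (ℕP.n≤1+n _)) k₁≤m₁

      open Assembly F G thr degree k₁′ k₂′ u using (module A; n≤N; assemble)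

      B : ℕ
      B = A.size large₁ slack₁ spread₁ n≤N u u

      B≤ : B ≤ 8 * h * u
      B≤ = ℕP.≤-trans (A.size-≤ large₁ slack₁ spread₁ n≤N u u) (ℕP.≤-reflexive (ar h u))
        where
        ar : ∀ h u → 4 * h * (u + u) ≡ 8 * h * u
        ar = ℕR.solve-∀

      room : 2 * h * (B * (m₁ * m₁ + k₁ * k₁)) ≤ n
      room = begin
        2 * h * (B * (m₁ * m₁ + k₁ * k₁))               ≤⟨ ℕP.*-monoʳ-≤ (2 * h) (ℕP.*-monoˡ-≤ (m₁ * m₁ + k₁ * k₁) B≤) ⟩
        2 * h * (8 * h * u * (m₁ * m₁ + k₁ * k₁))       ≡⟨ ar h u (m₁ * m₁ + k₁ * k₁) ⟩
        16 * (h * h) * (m₁ * m₁ + k₁ * k₁) * u          ≤⟨ ℕP.*-monoˡ-≤ u (ℕP.m≤m+n (16 * (h * h) * (m₁ * m₁ + k₁ * k₁)) (16 * q * h * m₁)) ⟩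
        D * u                                           ≤⟨ Du≤n ⟩
        n                                               ∎
        where
        open ℕP.≤-Reasoning
        ar : ∀ h u s → 2 * h * (8 * h * u * s) ≡ 16 * (h * h) * s * u
        ar = ℕR.solve-∀

      few-demands : N ^ r * n < 2 ^ u
      few-demands = begin-strict
        N ^ r * n                 ≤⟨ ℕP.*-monoʳ-≤ (N ^ r) n≤N ⟩
        N ^ r * N                 ≡⟨ ℕP.*-comm (N ^ r) N ⟩
        N ^ R                     ≤⟨ ℕP.^-monoˡ-≤ R N≤ ⟩
        (a * u) ^ R               <⟨ polynomial<exponential a R {{ℕP.m*n≢0 (2 * D) r {{ℕP.m*n≢0 2 D}}}} u (ℕP.≤-trans (ℕP.≤-trans (ℕP.m≤n+m _ (2 * H)) (ℕP.n≤1+n _)) U≤u) ⟩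
        2 ^ u                     ∎
        where
        open ℕP.≤-Reasoning
        N≤ : N ≤ a * u
        N≤ = ℕP.≤-trans (ℕP.*-monoʳ-≤ r n≤2Du) (ℕP.≤-reflexive (ar r D u))
          where
          ar : ∀ r D u → r * (2 * D * u) ≡ 2 * D * r * u
          ar = ℕR.solve-∀

      removed : q * (B * m₁ + m₂) ≤ n
      removed = ℕP.*-cancelˡ-≤ 2 (begin
        2 * (q * (B * m₁ + m₂))                    ≤⟨ ℕP.*-monoʳ-≤ 2 (ℕP.*-monoʳ-≤ q (ℕP.+-monoˡ-≤ m₂ (ℕP.*-monoˡ-≤ m₁ B≤))) ⟩
        2 * (q * (8 * h * u * m₁ + m₂))            ≡⟨ ar q h u m₁ m₂ ⟩
        16 * q * h * m₁ * u + 2 * q * m₂           ≤⟨ ℕP.+-mono-≤ (ℕP.≤-trans (ℕP.*-monoˡ-≤ u (ℕP.m≤n+m (16 * q * h * m₁) (16 * (h * h) * (m₁ * m₁ + k₁ * k₁)))) Du≤n)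
                                                                   (ℕP.≤-trans (ℕP.m≤n+m (2 * q * m₂) (U * D)) big) ⟩
        n + n                                      ≡⟨ cong (_+_ n) (≡.sym (ℕP.+-identityʳ n)) ⟩
        2 * n                                      ∎)
        where
        open ℕP.≤-Reasoning
        ar : ∀ q h u m₁ m₂ → 2 * (q * (8 * h * u * m₁ + m₂)) ≡ 16 * q * h * m₁ * u + 2 * q * m₂
        ar = ℕR.solve-∀

      large₂ : m₀ ≤ m₂
      large₂ = ℕP.≤-trans (ℕP.≤-trans (ℕP.m≤m+n m₀ _) (ℕP.≤-trans (ℕP.m≤m+n _ _) (ℕP.n≤1+n _))) k₂≤m₂

      slack₂ : 2 * q ≤ m₂
      slack₂ = ℕP.≤-trans (ℕP.≤-trans (ℕP.m≤n+m _ m₀) (ℕP.≤-trans (ℕP.m≤m+n _ _) (ℕP.n≤1+n _))) k₂≤m₂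

      spread₂ : ∀ {c} → c ≤ n → 4 * Q * (c * c) < u * u * m₂
      spread₂ {c} c≤n = begin-strict
        4 * Q * (c * c)                        ≤⟨ ℕP.*-monoʳ-≤ (4 * Q) (ℕP.*-mono-≤ c≤ c≤) ⟩
        4 * Q * ((2 * D * u) * (2 * D * u))    ≡⟨ ar Q D u ⟩
        u * u * (16 * Q * (D * D))             <⟨ ℕP.*-monoʳ-< (u * u) {{ℕP.m*n≢0 u u {{ℕ.>-nonZero 1≤u}} {{ℕ.>-nonZero 1≤u}}}}
                                                    (ℕP.<-≤-trans (s≤s (ℕP.m≤n+m (16 * Q * (D * D)) (m₀ + 2 * q))) k₂≤m₂) ⟩
        u * u * m₂                             ∎
        where
        open ℕP.≤-Reasoning
        c≤ = ℕP.≤-trans c≤n n≤2Du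
        ar : ∀ Q D u → 4 * Q * ((2 * D * u) * (2 * D * u)) ≡ u * u * (16 * Q * (D * D))
        ar = ℕR.solve-∀

      2m₂≤ur : 2 * m₂ ≤ u * r
      2m₂≤ur = ℕP.≤-trans (ℕP.≤-reflexive (≡.sym (ℕP.*-assoc 2 k₂ r)))
        (ℕP.*-monoˡ-≤ r (ℕP.≤-trans (ℕP.*-monoʳ-≤ 2 (ℕP.m≤n*m k₂ (2 ^ (m₂ * m₂)) {{ℕP.m^n≢0 2 (m₂ * m₂)}})) 2H≤u))

    everything-tiled : Tiling (allFin N) (allFin n)
    everything-tiled = assemble large₁ slack₁ spread₁ few-demands room removed large₂ slack₂ spread₂ 2H≤u 2m₂≤ur

-- From rational densities to natural numbers

private
  toℚᵘ-ℕ : ∀ n → toℚᵘ (ℕ→ℚ n) ℚᵘ.≃ ℚᵘ.mkℚᵘ (+ n) 0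
  toℚᵘ-ℕ n = ℚP.toℚᵘ-fromℚᵘ (ℚᵘ.mkℚᵘ (+ n) 0)

ℕ→ℚ-* : ∀ a b → ℕ→ℚ (a * b) ≡ ℕ→ℚ a ℚ.* ℕ→ℚ b
ℕ→ℚ-* a b = ℚP.toℚᵘ-injective (ℚᵘP.≃-trans (toℚᵘ-ℕ (a * b))
  (ℚᵘP.≃-trans (ℚᵘ.*≡* (cong (ℤ._* + 1) (ℤP.pos-* a b)))
  (ℚᵘP.≃-trans (ℚᵘP.*-cong (ℚᵘP.≃-sym (toℚᵘ-ℕ a)) (ℚᵘP.≃-sym (toℚᵘ-ℕ b)))
    (ℚᵘP.≃-sym (ℚP.toℚᵘ-homo-* (ℕ→ℚ a) (ℕ→ℚ b))))))

ℕ→ℚ-+ : ∀ a b → ℕ→ℚ (a + b) ≡ ℕ→ℚ a ℚ.+ ℕ→ℚ b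
ℕ→ℚ-+ a b = ℚP.toℚᵘ-injective (ℚᵘP.≃-trans (toℚᵘ-ℕ (a + b))
  (ℚᵘP.≃-trans (ℚᵘ.*≡* (cong (ℤ._* + 1) (≡.trans (ℤP.pos-+ a b) (≡.sym (cong₂ ℤ._+_ (ℤP.*-identityʳ (+ a)) (ℤP.*-identityʳ (+ b)))))))
  (ℚᵘP.≃-trans (ℚᵘP.+-cong (ℚᵘP.≃-sym (toℚᵘ-ℕ a)) (ℚᵘP.≃-sym (toℚᵘ-ℕ b)))
    (ℚᵘP.≃-sym (ℚP.toℚᵘ-homo-+ (ℕ→ℚ a) (ℕ→ℚ b))))))

ℕ→ℚ-mono : ∀ a b → a ≤ b → ℕ→ℚ a ℚ.≤ ℕ→ℚ b
ℕ→ℚ-mono a b le = ℚP.toℚᵘ-cancel-≤ (ℚᵘP.≤-respˡ-≃ (ℚᵘP.≃-sym (toℚᵘ-ℕ a)) (ℚᵘP.≤-respʳ-≃ (ℚᵘP.≃-sym (toℚᵘ-ℕ b))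
  (ℚᵘ.*≤* (ℤP.*-monoʳ-≤-nonNeg (+ 1) (ℤ.+≤+ le)))))

ℕ→ℚ-cancel : ∀ a b → ℕ→ℚ a ℚ.≤ ℕ→ℚ b → a ≤ b
ℕ→ℚ-cancel a b le with ℚᵘP.≤-respˡ-≃ (toℚᵘ-ℕ a) (ℚᵘP.≤-respʳ-≃ (toℚᵘ-ℕ b) (ℚP.toℚᵘ-mono-≤ le))
... | ℚᵘ.*≤* le′ = ℤP.drop‿+≤+ (≡.subst₂ ℤ._≤_ (ℤP.*-identityʳ (+ a)) (ℤP.*-identityʳ (+ b)) le′)

ℕ→ℚ-nonNeg : ∀ n → NonNegative (ℕ→ℚ n)
ℕ→ℚ-nonNeg n = ℚ.nonNegative (ℕ→ℚ-mono 0 n z≤n)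

ℕ→ℚ-pos : ∀ n .{{_ : NonZero n}} → Positive (ℕ→ℚ n)
ℕ→ℚ-pos n = ℚP.normalize-pos n 1

clear-denominator : ∀ x → .{{NonNegative x}} → ∃ λ a → ℕ→ℚ (↧ₙ x) ℚ.* x ≡ ℕ→ℚ a
clear-denominator x@(mkℚ (+ a) d-1 _) = a , ℚP.toℚᵘ-injective (ℚᵘP.≃-trans (ℚP.toℚᵘ-homo-* (ℕ→ℚ (suc d-1)) x)
  (ℚᵘP.≃-trans (ℚᵘP.*-congʳ {toℚᵘ x} (toℚᵘ-ℕ (suc d-1))) (ℚᵘP.≃-trans
    (ℚᵘ.*≡* (≡.trans (ℤP.*-identityʳ _) (≡.trans (ℤP.*-comm (+ suc d-1) (+ a)) (cong (λ z → + a ℤ.* + z) (≡.sym (ℕP.+-identityʳ (suc d-1)))))))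
    (ℚᵘP.≃-sym (toℚᵘ-ℕ a)))))

-- A common denominator of α and η makes both integral, and η positive integral. Doubling it makes η
-- worth at least the two units of degree surplus that the assembly spends.
rational-window : ∀ α η → .{{NonNegative α}} → .{{Positive η}} →
                  ∃₂ λ p q → NonZero q × ℕ→ℚ q ℚ.* α ≡ ℕ→ℚ p × ℕ→ℚ (2 + p) ℚ.≤ ℕ→ℚ q ℚ.* (α ℚ.+ η)
rational-window α η {{_}} {{η>0}} = p , q , ℕP.m*n≢0 2 (q₁ * q₂) {{_}} {{ℕP.m*n≢0 q₁ q₂}} , qα , (begin
    ℕ→ℚ (2 + p)                            ≤⟨ ℕ→ℚ-mono (2 + p) (p + 2 * (q₁ * e)) (ℕP.≤-trans (ℕP.+-monoˡ-≤ p 2≤) (ℕP.≤-reflexive (ℕP.+-comm (2 * (q₁ * e)) p))) ⟩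
    ℕ→ℚ (p + 2 * (q₁ * e))                 ≡⟨ ℕ→ℚ-+ p (2 * (q₁ * e)) ⟩
    ℕ→ℚ p ℚ.+ ℕ→ℚ (2 * (q₁ * e))           ≡⟨ cong₂ ℚ._+_ qα qη ⟨
    ℕ→ℚ q ℚ.* α ℚ.+ ℕ→ℚ q ℚ.* η            ≡⟨ ℚP.*-distribˡ-+ (ℕ→ℚ q) α η ⟨
    ℕ→ℚ q ℚ.* (α ℚ.+ η)                    ∎)
  where
  open ℚP.≤-Reasoning
  q₁ = ↧ₙ α
  q₂ = ↧ₙ η
  cleared-α = clear-denominator α
  cleared-η = clear-denominator η {{ℚP.pos⇒nonNeg η}}
  a = proj₁ cleared-α
  e = proj₁ cleared-η
  q = 2 * (q₁ * q₂)
  p = 2 * (q₂ * a)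
  scaled : ∀ b q′ x y → ℕ→ℚ q′ ℚ.* x ≡ ℕ→ℚ y → ℕ→ℚ (b * q′) ℚ.* x ≡ ℕ→ℚ (b * y)
  scaled b q′ x y eq = ≡.trans (cong (ℚ._* x) (ℕ→ℚ-* b q′)) (≡.trans (ℚP.*-assoc (ℕ→ℚ b) (ℕ→ℚ q′) x)
    (≡.trans (cong (ℕ→ℚ b ℚ.*_) eq) (≡.sym (ℕ→ℚ-* b y))))
  qα : ℕ→ℚ q ℚ.* α ≡ ℕ→ℚ p
  qα = ≡.trans (cong (λ z → ℕ→ℚ z ℚ.* α) (ar q₁ q₂)) (≡.trans (scaled (2 * q₂) q₁ α a (proj₂ cleared-α)) (cong ℕ→ℚ (ℕP.*-assoc 2 q₂ a)))
    where
    ar : ∀ x y → 2 * (x * y) ≡ 2 * y * x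
    ar = ℕR.solve-∀
  qη : ℕ→ℚ q ℚ.* η ≡ ℕ→ℚ (2 * (q₁ * e))
  qη = ≡.trans (cong (λ z → ℕ→ℚ z ℚ.* η) (≡.sym (ℕP.*-assoc 2 q₁ q₂))) (≡.trans (scaled (2 * q₁) q₂ η e (proj₂ cleared-η)) (cong ℕ→ℚ (ℕP.*-assoc 2 q₁ e)))
  e≢0 : NonZero e
  e≢0 = ℕ.≢-nonZero λ e≡0 → ℚP.<-irrefl (≡.sym (≡.trans (proj₂ cleared-η) (cong ℕ→ℚ e≡0)))
          (ℚP.positive⁻¹ (ℕ→ℚ q₂ ℚ.* η) {{ℚP.pos*pos⇒pos (ℕ→ℚ q₂) {{ℕ→ℚ-pos q₂}} η {{η>0}}}})
  2≤ : 2 ≤ 2 * (q₁ * e)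
  2≤ = ℕP.m≤m*n 2 (q₁ * e) {{ℕP.m*n≢0 q₁ e {{_}} {{e≢0}}}}

edgeless-transversal : ∀ {r n} (F : Graph r) → (∀ a b → adj F a b ≡ true → ⊥) →
                       (G : Fin n → Graph (r * n)) → TransversalFactor F G
edgeless-transversal F none G =
  (λ i a → Fin.combine a i) ,
  (λ i a b ab → ⊥-elim (none a b ab)) ,
  λ i j a b e → FinP.combine-injectiveʳ a i b j e , FinP.combine-injectiveˡ a i b j e

-- If the empty graph has an F-factor then F has no edges.
nonpositive-threshold : ∀ {r} .{{_ : NonZero r}} (F : Graph r) α n₁ → α ℚ.≤ 0ℚ →
  (∀ n → n ≥ n₁ → r ∣ n → (H : Graph n) → MinDegAtLeast H (α ℚ.* ℕ→ℚ n) → FFactor F H) →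
  ∀ a b → adj F a b ≡ true → ⊥
nonpositive-threshold {r} F α n₁ α≤0 factor a b ab =
  let k , φ , ep , _ , sur = factor m m≥ (divides (suc n₁) ≡.refl) empty
        λ v → ℚP.≤-trans (ℚP.*-monoʳ-≤-nonNeg (ℕ→ℚ m) {{ℕ→ℚ-nonNeg m}} α≤0)
                (ℚP.≤-trans (ℚP.≤-reflexive (ℚP.*-zeroˡ (ℕ→ℚ m))) (ℕ→ℚ-mono 0 (deg empty v) z≤n))
      i , _ = sur (Fin.fromℕ< (ℕ.>-nonZero⁻¹ m {{ℕP.m*n≢0 (suc n₁) r}}))
      false≡true = ep i a b ab
  in absurd false≡true
  where
  m = suc n₁ * r
  m≥ : m ≥ n₁
  m≥ = ℕP.≤-trans (ℕP.n≤1+n n₁) (ℕP.m≤m*n (suc n₁) r)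
  empty : Graph m
  empty = record { adj = λ _ _ → false ; sym = λ _ _ → ≡.refl ; irref = λ _ → ≡.refl }
  absurd : false ≡ true → ⊥
  absurd ()

deg-# : ∀ {N} (H : Graph N) v → deg H v ≡ # (adj H v) (allFin N)
deg-# H v = length-filterᵇ (adj H v) (allFin _)

module Window {r : ℕ} {{r≢0 : NonZero r}} (F : Graph r) (α η : ℚ) (m₀ : ℕ)
              (factor : ∀ n → n ≥ m₀ → r ∣ n → (H : Graph n) → MinDegAtLeast H (α ℚ.* ℕ→ℚ n) → FFactor F H)
              (p q : ℕ) {{q≢0 : NonZero q}} (qα : ℕ→ℚ q ℚ.* α ≡ ℕ→ℚ p)
              (window : ℕ→ℚ (2 + p) ℚ.≤ ℕ→ℚ q ℚ.* (α ℚ.+ η)) where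
  open ℚP.≤-Reasoning

  threshold : Threshold F p q m₀
  threshold = record { factor = λ m m≥ div H dense → factor m m≥ div H λ v →
    ℚP.*-cancelˡ-≤-pos (ℕ→ℚ q) {{ℕ→ℚ-pos q}} (begin
      ℕ→ℚ q ℚ.* (α ℚ.* ℕ→ℚ m)          ≡⟨ ℚP.*-assoc (ℕ→ℚ q) α (ℕ→ℚ m) ⟨
      ℕ→ℚ q ℚ.* α ℚ.* ℕ→ℚ m            ≡⟨ cong (ℚ._* ℕ→ℚ m) qα ⟩
      ℕ→ℚ p ℚ.* ℕ→ℚ m                  ≡⟨ ℕ→ℚ-* p m ⟨
      ℕ→ℚ (p * m)                      ≤⟨ ℕ→ℚ-mono (p * m) (q * # (adj H v) (allFin m)) (dense v) ⟩
      ℕ→ℚ (q * # (adj H v) (allFin m)) ≡⟨ cong (λ z → ℕ→ℚ (q * z)) (deg-# H v) ⟨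
      ℕ→ℚ (q * deg H v)                ≡⟨ ℕ→ℚ-* q (deg H v) ⟩
      ℕ→ℚ q ℚ.* ℕ→ℚ (deg H v)          ∎) }

  degrees : ∀ {N n} (Gs : Fin n → Graph N) → (∀ i → MinDegAtLeast (Gs i) ((α ℚ.+ η) ℚ.* ℕ→ℚ N)) →
            ∀ c v → suc (suc p) * N ≤ q * # (adj (Gs c) v) (allFin N)
  degrees {N} Gs mindeg c v = ℕ→ℚ-cancel (suc (suc p) * N) (q * # (adj (Gs c) v) (allFin N)) (begin
    ℕ→ℚ (suc (suc p) * N)                 ≡⟨ ℕ→ℚ-* (suc (suc p)) N ⟩
    ℕ→ℚ (2 + p) ℚ.* ℕ→ℚ N                 ≤⟨ ℚP.*-monoʳ-≤-nonNeg (ℕ→ℚ N) {{ℕ→ℚ-nonNeg N}} window ⟩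
    ℕ→ℚ q ℚ.* (α ℚ.+ η) ℚ.* ℕ→ℚ N         ≡⟨ ℚP.*-assoc (ℕ→ℚ q) (α ℚ.+ η) (ℕ→ℚ N) ⟩
    ℕ→ℚ q ℚ.* ((α ℚ.+ η) ℚ.* ℕ→ℚ N)       ≤⟨ ℚP.*-monoˡ-≤-nonNeg (ℕ→ℚ q) {{ℕ→ℚ-nonNeg q}} (mindeg c v) ⟩
    ℕ→ℚ q ℚ.* ℕ→ℚ (deg (Gs c) v)          ≡⟨ ℕ→ℚ-* q (deg (Gs c) v) ⟨
    ℕ→ℚ (q * deg (Gs c) v)                ≡⟨ cong (λ z → ℕ→ℚ (q * z)) (deg-# (Gs c) v) ⟩
    ℕ→ℚ (q * # (adj (Gs c) v) (allFin N)) ∎)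

  window-transversal : ∀ n → n ≥ Constants.n₀ r p q m₀ → ∀ (Gs : Fin n → Graph (r * n)) →
    (∀ i → MinDegAtLeast (Gs i) ((α ℚ.+ η) ℚ.* ℕ→ℚ (r * n))) → TransversalFactor F Gs
  window-transversal n n≥ Gs mindeg =
    transversal F Gs (Parameters.everything-tiled F Gs threshold n≥ (degrees Gs mindeg))

-- Writing the density as a quotient of naturals requires α to be nonnegative. For nonpositive α
-- every graph, even the empty one, meets the degree condition, which forces F to be edgeless; then
-- any disjoint sets of `r` vertices serve as copies.
transversal-above-threshold : ∀ {r} {{_ : NonZero r}} (F : Graph r) α η → 0ℚ ℚ.< η → ∀ m₀ →
  (∀ n → n ≥ m₀ → r ∣ n → (H : Graph n) → MinDegAtLeast H (α ℚ.* ℕ→ℚ n) → FFactor F H) →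
  Dec (α ℚ.≤ 0ℚ) →
  Σ ℕ λ n0 → ∀ n → n ≥ n0 → ∀ (Gs : Fin n → Graph (r * n)) →
    (∀ i → MinDegAtLeast (Gs i) ((α ℚ.+ η) ℚ.* ℕ→ℚ (r * n))) → TransversalFactor F Gs
transversal-above-threshold F α η 0<η m₀ factor (yes α≤0) =
  0 , λ n _ Gs _ → edgeless-transversal F (nonpositive-threshold F α m₀ α≤0 factor) Gs
transversal-above-threshold {r} F α η 0<η m₀ factor (no α≰0) =
  let p , q , q≢0 , qα , window = rational-window α η {{ℚ.nonNegative (ℚP.<⇒≤ (ℚP.≰⇒> α≰0))}} {{ℚ.positive 0<η}}
  in Constants.n₀ r p q m₀ , Window.window-transversal F α η m₀ factor p q {{q≢0}} qα window

theorem1p3 : ∀ (r : ℕ) (F : Graph r) (d ε : ℚ) → 0ℚ ℚ.< ε → FactorThreshold F d →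
    Σ ℕ λ n0 → ∀ (n : ℕ) → n ≥ n0 → ∀ (Gs : Fin n → Graph (r * n)) →
    (∀ i → MinDegAtLeast (Gs i) ((d ℚ.+ ε) ℚ.* ℕ→ℚ (r * n))) →
    TransversalFactor F Gs
theorem1p3 zero      F d ε 0<ε thr = 0 , λ n _ Gs _ → edgeless-transversal F (λ ()) Gs
theorem1p3 r@(suc _) F d ε 0<ε thr =
  let n₀ , main = transversal-above-threshold F (d ℚ.+ η) η 0<η (proj₁ (thr η 0<η)) (proj₂ (thr η 0<η)) (d ℚ.+ η ℚP.≤? 0ℚ)
  in n₀ , λ n n≥ Gs mindeg → main n n≥ Gs λ i → subst (λ x → MinDegAtLeast (Gs i) (x ℚ.* ℕ→ℚ (r * n))) (≡.sym halves) (mindeg i)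
  where
  -- Half of ε goes into the density at which F-factors are guaranteed, the other half remains as
  -- degree surplus.
  η : ℚ
  η = ε ℚ.* ℚ.½
  0<η : 0ℚ ℚ.< η
  0<η = ℚP.positive⁻¹ η {{ℚP.pos*pos⇒pos ε {{ℚ.positive 0<ε}} ℚ.½}}
  halves : (d ℚ.+ η) ℚ.+ η ≡ d ℚ.+ ε
  halves = ≡.trans (ℚP.+-assoc d η η) (cong (d ℚ.+_) (≡.trans (≡.sym (ℚP.*-distribˡ-+ ε ℚ.½ ℚ.½)) (ℚP.*-identityʳ ε)))
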